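{- Let $\Delta$ be a $(d-1)$-dimensional homology manifold without boundary ($d\ge4$, connected, pure) with nonzero first Betti number. Then $f_i(\Delta)\ge f_i(M^d)$ for all $i$, where $f_0(M^d)=2d+1$ and, for $1\le i\le d-1$, $f_i(M^d)=\frac{2d+1}{i+1}\,\phi_{i-1}(2d,d-1)$.
   Context: $f_i$ denotes the number of $i$-dimensional faces. For integers $N,e$: $\phi_0(N,e)=N$, $\phi_j(N,e)=\binom{e}{j}N-\binom{e+1}{j+1}j$ for $1\le j\le e-2$, and $\phi_{e-1}(N,e)=(e-1)N-(e+1)(e-2)$; $\phi_j(N,e)$ is the number of $j$-faces of an $(e-1)$-dimensional stacked sphere with $N$ vertices. The numbers $f_i(M^d)$ are the face numbers of Kühnel's triangulation $M^d$: a $2$-neighborly complex with $2d+1$ vertices, homeomorphic to $S^1\times S^{d-2}$ ($d$ odd) or the nonorientable $S^{d-2}$-bundle over $S^1$ ($d$ even), in which every vertex link is a stacked $(d-2)$-sphere with $2d$ vertices. Homology manifold (over a field $k$): for every nonempty face $\rho$, the link $\operatorname{lk}\rho=\{\tau:\tau\cap\rho=\emptyset,\tau\cup\rho\in\Delta\}$ has the $k$-homology of $S^{d-|\rho|-1}$ or $B^{d-|\rho|-1}$; without boundary means every link has the homology of a sphere. Betti numbers are over $k$. -}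

module Defs where

open import Level using (Level; _⊔_)
open import Data.Bool using (Bool; true; false; _∧_; _∨_; not; if_then_else_)
open import Data.Nat using (ℕ; zero; suc; _∸_; _≤_; _<_; _≡ᵇ_; _/_)
  renaming (_+_ to _+ℕ_; _*_ to _*ℕ_)
open import Data.Nat.Combinatorics using (_C_)
open import Data.Fin using (Fin; zero; suc)
open import Data.Vec using (Vec; []; _∷_; zipWith; replicate; lookup)
open import Data.List using (List; []; _∷_; map; _++_; filter; length; foldr)
open import Data.List using () renaming (allFin to allFinL)
open import Data.Product using (Σ; ∃; _×_; _,_)
open import Data.Sum using (_⊎_)
open import Relation.Nullary using (¬_)
open import Relation.Binary.PropositionalEquality using (_≡_)
open import Algebra.Bundles using (CommutativeRing)
open import Data.Bool.Properties using (T?)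
open import Data.Bool using (T)

record Field (c ℓ : Level) : Set (Level.suc (c ⊔ ℓ)) where
  field
    commutativeRing : CommutativeRing c ℓ
  open CommutativeRing commutativeRing public
  field
    0≉1     : ¬ (0# ≈ 1#)
    inverse : ∀ x → ¬ (x ≈ 0#) → Σ Carrier λ y → (x * y) ≈ 1#

Subset : ℕ → Set
Subset n = Vec Bool n

∅ : ∀ {n} → Subset n
∅ {n} = replicate n false

_∪_ : ∀ {n} → Subset n → Subset n → Subset n
_∪_ = zipWith _∨_

_∩_ : ∀ {n} → Subset n → Subset n → Subset n
_∩_ = zipWith _∧_

⁅_⁆ : ∀ {n} → Fin n → Subset n
⁅_⁆ {suc n} zero    = true ∷ ∅
⁅_⁆ {suc n} (suc i) = false ∷ ⁅ i ⁆

∣_∣ : ∀ {n} → Subset n → ℕ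
∣ [] ∣ = 0
∣ true  ∷ s ∣ = suc ∣ s ∣
∣ false ∷ s ∣ = ∣ s ∣

_∈ᵇ_ : ∀ {n} → Fin n → Subset n → Bool
i ∈ᵇ s = lookup s i

isEmpty : ∀ {n} → Subset n → Bool
isEmpty [] = true
isEmpty (b ∷ s) = not b ∧ isEmpty s

_⊆_ : ∀ {n} → Subset n → Subset n → Set
σ ⊆ τ = ∀ i → T (i ∈ᵇ σ) → T (i ∈ᵇ τ)

below : ∀ {n} → Fin n → Subset n → ℕ
below zero    _       = 0
below (suc i) (b ∷ s) = (if b then 1 else 0) +ℕ below i s

allSubsets : ∀ n → List (Subset n)
allSubsets zero    = [] ∷ []
allSubsets (suc n) = map (false ∷_) (allSubsets n) ++ map (true ∷_) (allSubsets n)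

even : ℕ → Bool
even zero = true
even (suc k) = not (even k)

record Complex (n : ℕ) : Set where
  field
    face     : Subset n → Bool
    downward : ∀ σ τ → σ ⊆ τ → T (face τ) → T (face σ)
open Complex public

fcount : ∀ {n} → Complex n → ℕ → ℕ
fcount {n} Δ i =
  length (filter (λ σ → T? (face Δ σ ∧ (∣ σ ∣ ≡ᵇ suc i))) (allSubsets n))

lkFace : ∀ {n} → Complex n → Subset n → Subset n → Bool
lkFace Δ ρ τ = isEmpty (τ ∩ ρ) ∧ face Δ (τ ∪ ρ)

PureOfDim : ∀ {n} → Complex n → ℕ → Set
PureOfDim {n} Δ d =
  (Σ (Subset n) λ σ → T (face Δ σ) × ∣ σ ∣ ≡ d)
  × (∀ σ → T (face Δ σ) → ∣ σ ∣ ≤ d)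
  × (∀ σ → T (face Δ σ) → Σ (Subset n) λ τ → T (face Δ τ) × ∣ τ ∣ ≡ d × σ ⊆ τ)

data Reach {n} (Δ : Complex n) : Fin n → Fin n → Set where
  here : ∀ {u} → Reach Δ u u
  step : ∀ {u v w} → T (face Δ (⁅ u ⁆ ∪ ⁅ v ⁆)) → Reach Δ v w → Reach Δ u w

Connected : ∀ {n} → Complex n → Set
Connected {n} Δ = ∀ u v → T (face Δ ⁅ u ⁆) → T (face Δ ⁅ v ⁆) → Reach Δ u v

-- Reduced simplicial homology with coefficients in a field K.
-- Complexes here are given by a face predicate F : Subset n → Bool (closed
-- under subsets).  Chains of "size" s are K-valued functions on subsets,
-- supported on faces with exactly s vertices; size s corresponds to
-- homological degree s - 1 (size 0 = the empty face, degree -1, giving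
-- the augmented = reduced chain complex).

module Homology {c ℓ} (K : Field c ℓ) where
  open Field K

  Σᶠ : ∀ {m} → (Fin m → Carrier) → Carrier
  Σᶠ {m} g = foldr (λ i acc → g i + acc) 0# (allFinL m)

  IsChain : ∀ {n} → (Subset n → Bool) → ℕ → (Subset n → Carrier) → Set ℓ
  IsChain F s x = ∀ σ → (F σ ≡ false ⊎ ¬ (∣ σ ∣ ≡ s)) → x σ ≈ 0#

  ∂ : ∀ {n} → (Subset n → Carrier) → Subset n → Carrier
  ∂ x τ = Σᶠ (λ v → if v ∈ᵇ τ then 0#
                    else (if even (below v τ) then x (τ ∪ ⁅ v ⁆)
                          else - x (τ ∪ ⁅ v ⁆)))

  IsCycle : ∀ {n} → (Subset n → Bool) → ℕ → (Subset n → Carrier) → Set ℓ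
  IsCycle F s z = IsChain F s z × (∀ τ → ∂ z τ ≈ 0#)

  IsBoundary : ∀ {n} → (Subset n → Bool) → ℕ → (Subset n → Carrier) → Set (c ⊔ ℓ)
  IsBoundary F s z = Σ _ λ w → IsChain F (suc s) w × (∀ τ → ∂ w τ ≈ z τ)

  lincomb : ∀ {n m} → (Fin m → Carrier) → (Fin m → Subset n → Carrier) → Subset n → Carrier
  lincomb a z σ = Σᶠ (λ i → a i * z i σ)

  -- HasBetti F s b : the reduced homology group of F in degree s - 1
  -- has dimension b over K, i.e. there are b cycles whose classes form a
  -- basis of (cycles)/(boundaries).
  HasBetti : ∀ {n} → (Subset n → Bool) → ℕ → ℕ → Set (c ⊔ ℓ)
  HasBetti {n} F s b =
    Σ (Fin b → Subset n → Carrier) λ z →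
      (∀ i → IsCycle F s (z i))
      × (∀ a → IsBoundary F s (lincomb a z) → ∀ i → a i ≈ 0#)
      × (∀ y → IsCycle F s y →
           Σ (Fin b → Carrier) λ a → IsBoundary F s (λ σ → y σ - lincomb a z σ))

  -- F has the K-homology of the sphere S^{m-1}: reduced homology is K in
  -- degree m - 1 (size m) and 0 otherwise.
  SphereHomology : ∀ {n} → (Subset n → Bool) → ℕ → Set (c ⊔ ℓ)
  SphereHomology F m = ∀ s → HasBetti F s (if s ≡ᵇ m then 1 else 0)

  HomologyManifoldWithoutBoundary : ∀ {n} → Complex n → ℕ → Set (c ⊔ ℓ)
  HomologyManifoldWithoutBoundary {n} Δ d =
    ∀ ρ → T (face Δ ρ) → 1 ≤ ∣ ρ ∣ → SphereHomology (lkFace Δ ρ) (d ∸ ∣ ρ ∣)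

  -- first Betti number of Δ over K (degree 1 = size 2; reduced and
  -- unreduced agree in degree 1)
  FirstBettiNonzero : ∀ {n} → Complex n → Set (c ⊔ ℓ)
  FirstBettiNonzero Δ = ¬ HasBetti (face Δ) 2 0

-- φ_j(N,e), face numbers of a stacked (e-1)-sphere with N vertices.
--   φ_0 = N ;  φ_j = C(e,j) N - C(e+1,j+1) j  (1 ≤ j ≤ e-2) ;
--   φ_{e-1} = (e-1) N - (e+1)(e-2).
-- (Truncated subtraction; in the range used the values are face numbers,
-- hence never truncated.)

φ : ℕ → ℕ → ℕ → ℕ
φ N e zero = N
φ N e (suc j) =
  if suc (suc j) ≡ᵇ e
  then (e ∸ 1)  *ℕ N ∸ (suc e)  *ℕ (e ∸ 2)
  else (e C suc j)  *ℕ N ∸ (suc e C suc (suc j))  *ℕ suc j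

-- f_i(M^d): f_0 = 2d+1, f_i = (2d+1)/(i+1) · φ_{i-1}(2d, d-1) for 1 ≤ i ≤ d-1
-- (the division is exact).
fM : ℕ → ℕ → ℕ
fM d zero    = suc (2  *ℕ d)
fM d (suc i) = (suc (2  *ℕ d)  *ℕ φ (2  *ℕ d) (d ∸ 1) i) / suc (suc i)

{-# OPTIONS --safe #-}
module Submission where

-- Add the vertices of Δ one at a time in some order. Adding v glues on the cone over the part of its link that is
-- already present, and joining v by one edge to each component of that part spans all edges modulo boundaries of
-- triangles. Since Δ is connected and its first homology does not vanish, the edges so chosen do not form a tree, hence
-- there are at least f₀ of them, for every order. For a random order the expected number of components seen in the link
-- of v is at most its value for a stacked sphere with deg v vertices, (deg v - 2d) / (d (d + 1)) + 1; this gives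
-- Σ deg v ≥ 2d f₀, that is f₁ ≥ d f₀, and in particular f₀ ≥ 2d + 1. The McMullen–Perles–Walkup reduction to edges of
-- links then bounds all face numbers.
--
-- Both the bound on components and the lower bound theorem for edges of links come from Fogelsanger's contraction
-- argument: the facets of a link form a minimal cycle modulo 2, and any minimal cycle of e-sets, e ≥ 3, can be rebuilt
-- from one of its facets by undoing contractions of edges whose ends have at least e - 1 common neighbours. Each such
-- step adds at least e edges, and raises the expected number of components by at most 1 / ((e + 1) (e + 2)).
--
-- The argument is classical, but the conclusion is decidable, so it may be carried out under double negation.

-- The links enter through their reduced homology in degree 0: a link of dimension 0 is a pair of
-- points, a larger one is connected. These two facts make the facets of a link a minimal cycle
-- modulo 2, whatever the field K. A contraction can make a minimal cycle decompose. So a facet F is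
-- fixed and the minimal cycle through F in the image is followed; vertices missed in this way are
-- reached later, from the larger set already built. This is why `Buildable` is relative to a
-- starting set and closed under gluing. The numbers of components before and after contracting y
-- into w cannot be compared for a single set of present vertices: the case with y alone is traded
-- against the case with w alone, which is possible because the two sets have equal weight. What
-- remains is y as a component by itself, which costs 1 only when y comes before the cut and w and
-- all common neighbours after it. The starting facet, a clique on e = d - 1 vertices, contributes e
-- / (e + 1), the probability that not all of it comes after the cut. Adding the deg v - e steps
-- gives the value for a stacked sphere.

open import Defs
open import Level using (Level; _⊔_)
open import Data.Bool using (Bool; true; false; T; not; _∧_; _∨_; _xor_; if_then_else_)
open import Data.Bool.Properties using (T-≡; T?; not-involutive; ∧-comm; ∧-zeroʳ; ∨-assoc; ∨-comm; ∨-identityʳ; xor-comm; xor-identityʳ; xor-same; ∧-distribˡ-xor) renaming (_≟_ to _≟ᵇ_)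
open import Data.Empty using (⊥; ⊥-elim)
open import Data.Fin using (Fin; zero; suc; toℕ)
import Data.Fin as Fin
open import Data.Fin.Properties using (_≟_; any?; all?)
import Data.Fin.Properties as Finₚ
open import Data.Fin.Subset.Properties using (anySubset?)
open import Data.List using (List; []; _∷_; length; filter; foldr)
import Data.List as List
import Data.List.Properties as Listₚ
open import Data.List.Membership.Propositional using (_∈_)
open import Data.List.Membership.Propositional.Properties using (∈-map⁺; ∈-++⁺ˡ; ∈-++⁺ʳ)
import Data.List.Relation.Unary.Any as Any
open import Data.List.Relation.Unary.Any.Properties using (lookup-index)
open import Data.Nat hiding (_≟_; _⊔_; less; equal; greater)
open import Data.Nat.Combinatorics using (_C_; nCk+nC[k+1]≡[n+1]C[k+1]; nC1≡n; nCk≡nC[n∸k])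
open import Data.Nat.DivMod using (m*n/n≡m; /-monoˡ-≤)
open import Data.Nat.Properties renaming (_≟_ to _≟ₙ_)
open import Data.Nat.Tactic.RingSolver using (solve-∀)
open import Data.Product using (Σ; ∃; _×_; _,_; proj₁; proj₂)
open import Data.Sum using (_⊎_; inj₁; inj₂; [_,_]′)
open import Data.Vec using ([]; _∷_; lookup; tabulate; _[_]≔_)
open import Data.Vec.Properties using (lookup∘update; lookup∘update′; lookup∘tabulate; lookup-zipWith; lookup-replicate; tabulate∘lookup; tabulate-cong; []≔-commutes; []≔-idempotent; []≔-lookup)
open import Function using (_∘_; id; case_of_; Equivalence)
open import Relation.Binary.PropositionalEquality using (_≡_; _≢_; refl; sym; trans; cong; cong₂; subst; subst₂; module ≡-Reasoning)
open import Relation.Nullary using (¬_; Dec; yes; no; does)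
open import Relation.Nullary.Decidable using (¬?; _×-dec_; _→-dec_; decidable-stable; dec-true; dec-false; ¬¬-excluded-middle)
import Algebra.Properties.Ring as RingProperties
import Data.Vec.Properties as Vecₚ
open import Relation.Binary.Definitions using (tri<; tri≈; tri>)
import Algebra.Properties.Semiring.Sum as SemiringSum

-- Finite sums and indicators

private
  variable
    n : ℕ

∑ : (Fin n → ℕ) → ℕ
∑ {zero}  f = 0
∑ {suc n} f = f zero + ∑ (f ∘ suc)

ind : Bool → ℕ
ind b = if b then 1 else 0

infix 8 _==_
_==_ : Fin n → Fin n → Bool
x == y = does (x ≟ y)

# : (Fin n → Bool) → ℕ
# P = ∑ (λ i → ind (P i))

==-refl : (x : Fin n) → (x == x) ≡ true
==-refl x = dec-true (x ≟ x) refl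

==-≢ : {x y : Fin n} → x ≢ y → (x == y) ≡ false
==-≢ {x = x} {y} x≢y = dec-false (x ≟ y) x≢y

==⇒≡ : {x y : Fin n} → (x == y) ≡ true → x ≡ y
==⇒≡ {x = x} {y} h with x ≟ y
... | yes p = p

does-true : ∀ {p} {P : Set p} (P? : Dec P) → does P? ≡ true → P
does-true (yes p) _ = p

does-false : ∀ {p} {P : Set p} (P? : Dec P) → does P? ≡ false → ¬ P
does-false (no ¬p) _ = ¬p

true≢false : ∀ {b} → b ≡ true → b ≡ false → ⊥
true≢false refl ()

¬true⇒false : ∀ {b} → ¬ (b ≡ true) → b ≡ false
¬true⇒false {false} _ = refl
¬true⇒false {true}  h = ⊥-elim (h refl)

¬false⇒true : ∀ {b} → ¬ (b ≡ false) → b ≡ true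
¬false⇒true {true}  _ = refl
¬false⇒true {false} h = ⊥-elim (h refl)

∧-true : ∀ {a b} → a ∧ b ≡ true → a ≡ true × b ≡ true
∧-true {true} {true} _ = refl , refl

∧-intro : ∀ {a b} → a ≡ true → b ≡ true → a ∧ b ≡ true
∧-intro refl refl = refl

∨-true : ∀ {a b} → a ∨ b ≡ true → a ≡ true ⊎ b ≡ true
∨-true {true}  _ = inj₁ refl
∨-true {false} h = inj₂ h

∨-introʳ : ∀ {a b} → b ≡ true → a ∨ b ≡ true
∨-introʳ {true}  _ = refl
∨-introʳ {false} h = h

∨-introˡ : ∀ {a b} → a ≡ true → a ∨ b ≡ true
∨-introˡ refl = refl

not-true : ∀ {a} → a ≡ false → not a ≡ true
not-true refl = refl

not-true⁻¹ : ∀ {a} → not a ≡ true → a ≡ false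
not-true⁻¹ {false} _ = refl

⇔⇒≡ : ∀ {a b} → (a ≡ true → b ≡ true) → (b ≡ true → a ≡ true) → a ≡ b
⇔⇒≡ {true}  {b}     f g = sym (f refl)
⇔⇒≡ {false} {false} f g = refl
⇔⇒≡ {false} {true}  f g = g refl

T⇒true : ∀ {b} → T b → b ≡ true
T⇒true = Equivalence.to T-≡

true⇒T : ∀ {b} → b ≡ true → T b
true⇒T = Equivalence.from T-≡

ind-≤1 : ∀ b → ind b ≤ 1
ind-≤1 true  = ≤-refl
ind-≤1 false = z≤n

ind-mono : ∀ {a b} → (a ≡ true → b ≡ true) → ind a ≤ ind b
ind-mono {false} _ = z≤n
ind-mono {true} h rewrite h refl = ≤-refl

¬¬-bind : ∀ {a b} {A : Set a} {B : Set b} → ¬ ¬ A → (A → ¬ ¬ B) → ¬ ¬ B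
¬¬-bind m f k = m (λ a → f a k)

¬¬-return : ∀ {a} {A : Set a} → A → ¬ ¬ A
¬¬-return a k = k a

¬¬-Fin : ∀ {p} {P : Fin n → Set p} → (∀ i → ¬ ¬ P i) → ¬ ¬ (∀ i → P i)
¬¬-Fin {n = zero}  h = ¬¬-return λ ()
¬¬-Fin {n = suc n} h = ¬¬-bind (h zero) λ p₀ → ¬¬-bind (¬¬-Fin (h ∘ suc)) λ ps →
  ¬¬-return λ { zero → p₀ ; (suc i) → ps i }

∑-cong : {f g : Fin n → ℕ} → (∀ i → f i ≡ g i) → ∑ f ≡ ∑ g
∑-cong {n = zero}  h = refl
∑-cong {n = suc n} h = cong₂ _+_ (h zero) (∑-cong (h ∘ suc))

∑-mono : {f g : Fin n → ℕ} → (∀ i → f i ≤ g i) → ∑ f ≤ ∑ g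
∑-mono {n = zero}  h = z≤n
∑-mono {n = suc n} h = +-mono-≤ (h zero) (∑-mono (h ∘ suc))

+-interchange : ∀ a b c d → (a + b) + (c + d) ≡ (a + c) + (b + d)
+-interchange = solve-∀

∑-+ : (f g : Fin n → ℕ) → ∑ (λ i → f i + g i) ≡ ∑ f + ∑ g
∑-+ {n = zero}  f g = refl
∑-+ {n = suc n} f g = trans (cong (f zero + g zero +_) (∑-+ (f ∘ suc) (g ∘ suc)))
  (+-interchange (f zero) (g zero) (∑ (f ∘ suc)) (∑ (g ∘ suc)))

∑-* : ∀ c (f : Fin n → ℕ) → ∑ (λ i → c * f i) ≡ c * ∑ f
∑-* {n = zero}  c f = sym (*-zeroʳ c)
∑-* {n = suc n} c f = trans (cong (c * f zero +_) (∑-* c (f ∘ suc))) (sym (*-distribˡ-+ c (f zero) (∑ (f ∘ suc))))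

∑-*ʳ : ∀ c (f : Fin n → ℕ) → ∑ (λ i → f i * c) ≡ ∑ f * c
∑-*ʳ c f = trans (∑-cong (λ i → *-comm (f i) c)) (trans (∑-* c f) (*-comm c (∑ f)))

∑-zero : {f : Fin n → ℕ} → (∀ i → f i ≡ 0) → ∑ f ≡ 0
∑-zero {n = zero}  h = refl
∑-zero {n = suc n} h = cong₂ _+_ (h zero) (∑-zero (h ∘ suc))

term≤∑ : (f : Fin n → ℕ) (i : Fin n) → f i ≤ ∑ f
term≤∑ f zero    = m≤m+n _ _
term≤∑ f (suc i) = ≤-trans (term≤∑ (f ∘ suc) i) (m≤n+m _ _)

∑-single : {f : Fin n → ℕ} (i : Fin n) → (∀ j → j ≢ i → f j ≡ 0) → ∑ f ≡ f i
∑-single {f = f} zero h = trans (cong (f zero +_) (∑-zero (λ j → h (suc j) λ ()))) (+-identityʳ _)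
∑-single {f = f} (suc i) h =
  cong₂ _+_ (h zero λ ()) (∑-single i λ j j≢i → h (suc j) (j≢i ∘ Finₚ.suc-injective))

#-== : (y : Fin n) → # (λ x → x == y) ≡ 1
#-== y = trans (∑-single y (λ j j≢y → cong ind (==-≢ j≢y))) (cong ind (==-refl y))

#-cong : {P Q : Fin n → Bool} → (∀ i → P i ≡ Q i) → # P ≡ # Q
#-cong h = ∑-cong (cong ind ∘ h)

#-mono : {P Q : Fin n → Bool} → (∀ i → P i ≡ true → Q i ≡ true) → # P ≤ # Q
#-mono h = ∑-mono (λ i → ind-mono (h i))

#-mono-< : {P Q : Fin n → Bool} (y : Fin n) → P y ≡ false → Q y ≡ true →
  (∀ i → P i ≡ true → Q i ≡ true) → # P < # Q
#-mono-< {P = P} {Q} y Py Qy h = begin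
  suc (# P)                            ≡⟨ +-comm 1 (# P) ⟩
  # P + 1                              ≡⟨ cong (# P +_) (sym (#-== y)) ⟩
  # P + # (_== y)                      ≡⟨ sym (∑-+ (ind ∘ P) (λ x → ind (x == y))) ⟩
  ∑ (λ x → ind (P x) + ind (x == y))   ≤⟨ ∑-mono pointwise ⟩
  # Q                                  ∎
  where
  open ≤-Reasoning
  pointwise : ∀ x → ind (P x) + ind (x == y) ≤ ind (Q x)
  pointwise x with x ≟ y
  ... | yes refl rewrite Py | Qy = ≤-refl
  ... | no _ = subst (_≤ ind (Q x)) (sym (+-identityʳ _)) (ind-mono (h x))

#-adjoin : {P Q : Fin n → Bool} (y : Fin n) → P y ≡ false →
  (∀ x → Q x ≡ P x ∨ x == y) → # Q ≡ suc (# P)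
#-adjoin {P = P} {Q} y Py h = begin
  # Q                                  ≡⟨ ∑-cong pointwise ⟩
  ∑ (λ x → ind (P x) + ind (x == y))   ≡⟨ ∑-+ (ind ∘ P) (λ x → ind (x == y)) ⟩
  # P + # (_== y)                      ≡⟨ cong (# P +_) (#-== y) ⟩
  # P + 1                              ≡⟨ +-comm (# P) 1 ⟩
  suc (# P)                            ∎
  where
  open ≡-Reasoning
  pointwise : ∀ x → ind (Q x) ≡ ind (P x) + ind (x == y)
  pointwise x rewrite h x with x ≟ y
  ... | yes refl rewrite Py = refl
  ... | no _ with P x
  ...   | true  = refl
  ...   | false = refl

∑-comm : ∀ {m} (f : Fin m → Fin n → ℕ) → ∑ (λ i → ∑ (f i)) ≡ ∑ (λ j → ∑ (λ i → f i j))
∑-comm {n = n} {m = zero} f = sym (∑-zero (λ (_ : Fin n) → refl))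
∑-comm {m = suc m} f = trans (cong (∑ (f zero) +_) (∑-comm (f ∘ suc))) (sym (∑-+ (f zero) (λ j → ∑ (λ i → f (suc i) j))))

#-transversal : (P Q : Fin n → Bool) (R : Fin n → Fin n → Bool) →
  (∀ i → P i ≡ true → ∃ λ j → Q j ≡ true × R i j ≡ true) →
  (∀ i i′ j → P i ≡ true → P i′ ≡ true → R i j ≡ true → R i′ j ≡ true → i ≡ i′) →
  # P ≤ # Q
#-transversal P Q R total unique = begin
  # P                                                    ≤⟨ ∑-mono row ⟩
  ∑ (λ i → ∑ (λ j → ind (P i ∧ R i j) * ind (Q j)))      ≡⟨ ∑-comm (λ i j → ind (P i ∧ R i j) * ind (Q j)) ⟩
  ∑ (λ j → ∑ (λ i → ind (P i ∧ R i j) * ind (Q j)))      ≡⟨ ∑-cong (λ j → ∑-*ʳ (ind (Q j)) (λ i → ind (P i ∧ R i j))) ⟩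
  ∑ (λ j → # (λ i → P i ∧ R i j) * ind (Q j))            ≤⟨ ∑-mono (λ j → ≤-trans (*-monoˡ-≤ (ind (Q j)) (column j)) (≤-reflexive (*-identityˡ _))) ⟩
  # Q                                                    ∎
  where
  open ≤-Reasoning
  row : ∀ i → ind (P i) ≤ ∑ (λ j → ind (P i ∧ R i j) * ind (Q j))
  row i with P i in Pi
  ... | false = z≤n
  ... | true with total i Pi
  ...   | j , Qj , Rij = ≤-trans (≤-reflexive (sym (cong₂ (λ a b → ind a * ind b) Rij Qj)))
                                 (term≤∑ (λ j → ind (R i j) * ind (Q j)) j)
  column : ∀ j → # (λ i → P i ∧ R i j) ≤ 1
  column j with any? (λ i → (P i ∧ R i j) ≟ᵇ true)
  ... | no none = ≤-trans (≤-reflexive (∑-zero (λ i → cong ind (¬true⇒false (λ h → none (i , h)))))) z≤n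
  ... | yes (i , h) = ≤-trans (≤-reflexive (∑-single i other)) (ind-≤1 _)
    where
    other : ∀ i′ → i′ ≢ i → ind (P i′ ∧ R i′ j) ≡ 0
    other i′ i′≢i = cong ind (¬true⇒false λ h′ → i′≢i
      (unique i′ i j (proj₁ (∧-true h′)) (proj₁ (∧-true h)) (proj₂ (∧-true {P i′} h′)) (proj₂ (∧-true {P i} h))))

least : (P : Fin n → Bool) (i : Fin n) → P i ≡ true →
  ∃ λ v → P v ≡ true × (∀ u → P u ≡ true → v Fin.≤ u)
least {n = suc n} P i Pi with P zero in P₀
... | true = zero , P₀ , λ _ _ → z≤n
least {n = suc n} P zero    Pi | false = ⊥-elim (true≢false Pi P₀)
least {n = suc n} P (suc i) Pi | false with least (P ∘ suc) i Pi
... | v , Pv , min = suc v , Pv , λ { zero P0 → ⊥-elim (true≢false P0 P₀) ; (suc u) Pu → s≤s (min u Pu) }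

-- Subsets and sums over all subsets

infixl 7 _⊞_ _⊟_
_⊞_ _⊟_ : Subset n → Fin n → Subset n
σ ⊞ x = σ [ x ]≔ true
σ ⊟ x = σ [ x ]≔ false

subset-ext : {σ τ : Subset n} → (∀ i → lookup σ i ≡ lookup τ i) → σ ≡ τ
subset-ext {σ = σ} {τ} h = trans (sym (tabulate∘lookup σ)) (trans (tabulate-cong h) (tabulate∘lookup τ))

lookup-⊞ : (σ : Subset n) (x i : Fin n) → lookup (σ ⊞ x) i ≡ i == x ∨ lookup σ i
lookup-⊞ σ x i with i ≟ x
... | yes refl = lookup∘update x σ true
... | no i≢x   = lookup∘update′ i≢x σ true

∈-⊞ : (σ : Subset n) (x : Fin n) → lookup (σ ⊞ x) x ≡ true
∈-⊞ σ x = lookup∘update x σ true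

∉-⊟ : (σ : Subset n) (x : Fin n) → lookup (σ ⊟ x) x ≡ false
∉-⊟ σ x = lookup∘update x σ false

⊞-other : (σ : Subset n) {x i : Fin n} → i ≢ x → lookup (σ ⊞ x) i ≡ lookup σ i
⊞-other σ i≢x = lookup∘update′ i≢x σ true

⊟-other : (σ : Subset n) {x i : Fin n} → i ≢ x → lookup (σ ⊟ x) i ≡ lookup σ i
⊟-other σ i≢x = lookup∘update′ i≢x σ false

⊞-mono : (σ : Subset n) (x : Fin n) {i : Fin n} → lookup σ i ≡ true → lookup (σ ⊞ x) i ≡ true
⊞-mono σ x {i} h = trans (lookup-⊞ σ x i) (∨-introʳ {i == x} h)

⊞-comm : (σ : Subset n) (x y : Fin n) → σ ⊞ x ⊞ y ≡ σ ⊞ y ⊞ x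
⊞-comm σ x y with x ≟ y
... | yes refl = refl
... | no x≢y   = []≔-commutes σ x y x≢y

⊞-⊟ : (σ : Subset n) (x : Fin n) → lookup σ x ≡ false → σ ⊞ x ⊟ x ≡ σ
⊞-⊟ σ x h = trans ([]≔-idempotent σ x) (trans (cong (σ [ x ]≔_) (sym h)) ([]≔-lookup σ x))

⊟-⊞ : (σ : Subset n) (x : Fin n) → lookup σ x ≡ true → σ ⊟ x ⊞ x ≡ σ
⊟-⊞ σ x h = trans ([]≔-idempotent σ x) (trans (cong (σ [ x ]≔_) (sym h)) ([]≔-lookup σ x))

⊞-⊟-comm : (σ : Subset n) {x y : Fin n} → x ≢ y → σ ⊞ x ⊟ y ≡ σ ⊟ y ⊞ x
⊞-⊟-comm σ {x} {y} x≢y = []≔-commutes σ x y x≢y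

∪-lookup : (σ τ : Subset n) (i : Fin n) → lookup (σ ∪ τ) i ≡ lookup σ i ∨ lookup τ i
∪-lookup σ τ i = lookup-zipWith _∨_ i σ τ

∩-lookup : (σ τ : Subset n) (i : Fin n) → lookup (σ ∩ τ) i ≡ lookup σ i ∧ lookup τ i
∩-lookup σ τ i = lookup-zipWith _∧_ i σ τ

∅-lookup : (i : Fin n) → lookup (∅ {n}) i ≡ false
∅-lookup i = lookup-replicate i false

⁅⁆≡∅⊞ : (x : Fin n) → ⁅ x ⁆ ≡ ∅ ⊞ x
⁅⁆≡∅⊞ zero    = refl
⁅⁆≡∅⊞ (suc x) = cong (false ∷_) (⁅⁆≡∅⊞ x)

⁅⁆-lookup : (x i : Fin n) → lookup ⁅ x ⁆ i ≡ i == x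
⁅⁆-lookup x i = trans (cong (λ σ → lookup σ i) (⁅⁆≡∅⊞ x)) (trans (lookup-⊞ ∅ x i) (lemma (i == x)))
  where
  lemma : ∀ b → b ∨ lookup ∅ i ≡ b
  lemma true  = refl
  lemma false = ∅-lookup i

∪⁅⁆ : (σ : Subset n) (x : Fin n) → σ ∪ ⁅ x ⁆ ≡ σ ⊞ x
∪⁅⁆ σ x = subset-ext λ i → trans (∪-lookup σ ⁅ x ⁆ i) (trans (cong (lookup σ i ∨_) (⁅⁆-lookup x i))
  (trans (∨-comm (lookup σ i) (i == x)) (sym (lookup-⊞ σ x i))))

∅-size : ∀ n → ∣ ∅ {n} ∣ ≡ 0
∅-size zero    = refl
∅-size (suc n) = ∅-size n

∁-size : Subset n → ℕ
∁-size []          = 0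
∁-size (true  ∷ σ) = ∁-size σ
∁-size (false ∷ σ) = suc (∁-size σ)

size-⊞ : (σ : Subset n) (x : Fin n) → lookup σ x ≡ false → ∣ σ ⊞ x ∣ ≡ suc ∣ σ ∣
size-⊞ (false ∷ σ) zero    h = refl
size-⊞ (true  ∷ σ) (suc x) h = cong suc (size-⊞ σ x h)
size-⊞ (false ∷ σ) (suc x) h = size-⊞ σ x h

size-⊟ : (σ : Subset n) (x : Fin n) → lookup σ x ≡ true → suc ∣ σ ⊟ x ∣ ≡ ∣ σ ∣
size-⊟ σ x h = trans (sym (size-⊞ (σ ⊟ x) x (∉-⊟ σ x))) (cong ∣_∣ (⊟-⊞ σ x h))

∁-size-⊞ : (σ : Subset n) (x : Fin n) → lookup σ x ≡ false → suc (∁-size (σ ⊞ x)) ≡ ∁-size σ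
∁-size-⊞ (false ∷ σ) zero    h = refl
∁-size-⊞ (true  ∷ σ) (suc x) h = ∁-size-⊞ σ x h
∁-size-⊞ (false ∷ σ) (suc x) h = cong suc (∁-size-⊞ σ x h)

size≡# : (σ : Subset n) → ∣ σ ∣ ≡ # (lookup σ)
size≡# []          = refl
size≡# (true  ∷ σ) = cong suc (size≡# σ)
size≡# (false ∷ σ) = size≡# σ

∁-size≡# : (σ : Subset n) → ∁-size σ ≡ # (λ i → not (lookup σ i))
∁-size≡# []          = refl
∁-size≡# (true  ∷ σ) = ∁-size≡# σ
∁-size≡# (false ∷ σ) = cong suc (∁-size≡# σ)

sizes-sum : (σ : Subset n) → ∣ σ ∣ + ∁-size σ ≡ n
sizes-sum []          = refl
sizes-sum (true  ∷ σ) = cong suc (sizes-sum σ)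
sizes-sum (false ∷ σ) = trans (+-suc _ _) (cong suc (sizes-sum σ))

size≥1⇒∈ : (σ : Subset n) → 1 ≤ ∣ σ ∣ → ∃ λ x → lookup σ x ≡ true
size≥1⇒∈ (true  ∷ σ) h = zero , refl
size≥1⇒∈ (false ∷ σ) h with size≥1⇒∈ σ h
... | x , p = suc x , p

∈⇒size≥1 : (σ : Subset n) {x : Fin n} → lookup σ x ≡ true → 1 ≤ ∣ σ ∣
∈⇒size≥1 σ {x} h = subst (1 ≤_) (size-⊟ σ x h) (s≤s z≤n)

size≡0⇒∅ : (σ : Subset n) → ∣ σ ∣ ≡ 0 → σ ≡ ∅
size≡0⇒∅ σ h = subset-ext λ i → trans (¬true⇒false (λ p → case subst (1 ≤_) h (∈⇒size≥1 σ p) of λ ())) (sym (∅-lookup i))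

∑ₛ : (Subset n → ℕ) → ℕ
∑ₛ {zero}  f = f []
∑ₛ {suc n} f = ∑ₛ (f ∘ (false ∷_)) + ∑ₛ (f ∘ (true ∷_))

∑ₛ-cong : {f g : Subset n → ℕ} → (∀ A → f A ≡ g A) → ∑ₛ f ≡ ∑ₛ g
∑ₛ-cong {zero}  h = h []
∑ₛ-cong {suc n} h = cong₂ _+_ (∑ₛ-cong (h ∘ (false ∷_))) (∑ₛ-cong (h ∘ (true ∷_)))

∑ₛ-mono : {f g : Subset n → ℕ} → (∀ A → f A ≤ g A) → ∑ₛ f ≤ ∑ₛ g
∑ₛ-mono {zero}  h = h []
∑ₛ-mono {suc n} h = +-mono-≤ (∑ₛ-mono (h ∘ (false ∷_))) (∑ₛ-mono (h ∘ (true ∷_)))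

∑ₛ-+ : (f g : Subset n → ℕ) → ∑ₛ (λ A → f A + g A) ≡ ∑ₛ f + ∑ₛ g
∑ₛ-+ {zero}  f g = refl
∑ₛ-+ {suc n} f g = trans
  (cong₂ _+_ (∑ₛ-+ (f ∘ (false ∷_)) (g ∘ (false ∷_))) (∑ₛ-+ (f ∘ (true ∷_)) (g ∘ (true ∷_))))
  (+-interchange (∑ₛ (f ∘ (false ∷_))) (∑ₛ (g ∘ (false ∷_))) _ _)

∑ₛ-* : ∀ c (f : Subset n → ℕ) → ∑ₛ (λ A → c * f A) ≡ c * ∑ₛ f
∑ₛ-* {zero}  c f = refl
∑ₛ-* {suc n} c f = trans (cong₂ _+_ (∑ₛ-* c (f ∘ (false ∷_))) (∑ₛ-* c (f ∘ (true ∷_)))) (sym (*-distribˡ-+ c _ _))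

∑ₛ-zero : {f : Subset n → ℕ} → (∀ A → f A ≡ 0) → ∑ₛ f ≡ 0
∑ₛ-zero {zero}  h = h []
∑ₛ-zero {suc n} h = cong₂ _+_ (∑ₛ-zero (h ∘ (false ∷_))) (∑ₛ-zero (h ∘ (true ∷_)))

∑ₛ-∑ : ∀ {m} (f : Subset n → Fin m → ℕ) → ∑ₛ (λ A → ∑ (f A)) ≡ ∑ (λ i → ∑ₛ (λ A → f A i))
∑ₛ-∑ {zero}  f = refl
∑ₛ-∑ {suc n} f = trans (cong₂ _+_ (∑ₛ-∑ (f ∘ (false ∷_))) (∑ₛ-∑ (f ∘ (true ∷_))))
  (sym (∑-+ (λ i → ∑ₛ (λ A → f (false ∷ A) i)) (λ i → ∑ₛ (λ A → f (true ∷ A) i))))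

∑ₛ-single : {f : Subset n → ℕ} (B : Subset n) → (∀ A → A ≢ B → f A ≡ 0) → ∑ₛ f ≡ f B
∑ₛ-single {f = f} [] h = refl
∑ₛ-single {f = f} (false ∷ B) h = trans
  (cong₂ _+_ (∑ₛ-single B (λ A A≢B → h (false ∷ A) λ { refl → A≢B refl })) (∑ₛ-zero (λ A → h (true ∷ A) λ ())))
  (+-identityʳ _)
∑ₛ-single {f = f} (true ∷ B) h =
  cong₂ _+_ (∑ₛ-zero (λ A → h (false ∷ A) λ ())) (∑ₛ-single B (λ A A≢B → h (true ∷ A) λ { refl → A≢B refl }))

-- Subsets are grouped in pairs that differ at x alone; adding one vertex to a random set is always
-- analysed on these pairs.
∑ₛ-pair : (x : Fin n) (f : Subset n → ℕ) →
  ∑ₛ f ≡ ∑ₛ (λ A → ind (not (lookup A x)) * (f A + f (A ⊞ x)))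
∑ₛ-pair {suc n} zero f = sym (trans
  (cong₂ _+_ (∑ₛ-cong {f = λ A → 1 * (f (false ∷ A) + f (true ∷ A))} (λ A → *-identityˡ _)) (∑ₛ-zero {n = n} (λ A → refl)))
  (trans (+-identityʳ _) (∑ₛ-+ (f ∘ (false ∷_)) (f ∘ (true ∷_)))))
∑ₛ-pair {suc n} (suc x) f = cong₂ _+_ (∑ₛ-pair x (f ∘ (false ∷_))) (∑ₛ-pair x (f ∘ (true ∷_)))

∑ₛ-shift : (x : Fin n) (f : Subset n → ℕ) →
  ∑ₛ (λ A → ind (lookup A x) * f A) ≡ ∑ₛ (λ A → ind (not (lookup A x)) * f (A ⊞ x))
∑ₛ-shift x f = trans (∑ₛ-pair x _) (∑ₛ-cong pointwise)
  where
  pointwise : ∀ A → ind (not (lookup A x)) * (ind (lookup A x) * f A + ind (lookup (A ⊞ x) x) * f (A ⊞ x))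
                  ≡ ind (not (lookup A x)) * f (A ⊞ x)
  pointwise A rewrite ∈-⊞ A x with lookup A x
  ... | true  = refl
  ... | false = cong (λ m → 1 * m) (*-identityˡ (f (A ⊞ x)))

-- The weight of a random initial segment of a random ordering

-- The probability that a uniformly random ordering of n elements, cut at a uniformly random place,
-- has exactly A before the cut is wt A / (n + 1)!.
wt : Subset n → ℕ
wt A = ∣ A ∣ ! * ∁-size A !

-- An unnormalised expectation. The total weight is (n + 1)!, and inequalities are multiplied by it
-- instead of being divided.
E : (Subset n → ℕ) → ℕ
E f = ∑ₛ (λ A → wt A * f A)

E-+ : (f g : Subset n → ℕ) → E (λ A → f A + g A) ≡ E f + E g
E-+ f g = trans (∑ₛ-cong (λ A → *-distribˡ-+ (wt A) (f A) (g A))) (∑ₛ-+ (λ A → wt A * f A) (λ A → wt A * g A))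

E-mono : {f g : Subset n → ℕ} → (∀ A → f A ≤ g A) → E f ≤ E g
E-mono h = ∑ₛ-mono (λ A → *-monoʳ-≤ (wt A) (h A))

rising : ℕ → ℕ → ℕ
rising m zero    = 1
rising m (suc k) = m * rising (suc m) k

rising-! : ∀ m k → m ! * rising (suc m) k ≡ (m + k) !
rising-! m zero    = trans (*-identityʳ (m !)) (cong _! (sym (+-identityʳ m)))
rising-! m (suc k) = trans (lemma m (m !) (rising (2 + m) k))
  (trans (rising-! (suc m) k) (cong _! (sym (+-suc m k))))
  where
  lemma : ∀ m a b → a * ((1 + m) * b) ≡ (a + m * a) * b
  lemma = solve-∀

-- The total weight a! b! (a+b+k+1)! / (a+b+1)! of the sets that contain a prescribed elements,
-- avoid b prescribed elements and are arbitrary on the other k.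
patternWt : ℕ → ℕ → ℕ → ℕ
patternWt a b k = a ! * b ! * rising (a + b + 2) k

-- One of the free elements is decided: it is either contained or avoided.
patternWt-split : ∀ a b k → patternWt a b (suc k) ≡ patternWt (suc a) b k + patternWt a (suc b) k
patternWt-split a b k = trans (lemma a b (a !) (b !) (rising (suc (a + b + 2)) k))
  (cong (λ m → patternWt (suc a) b k + a ! * (suc b) ! * rising m k) (shift a b))
  where
  lemma : ∀ a b x y r → x * y * ((a + b + 2) * r) ≡ (1 + a) * x * y * r + x * ((1 + b) * y) * r
  lemma = solve-∀
  shift : ∀ a b → suc (a + b + 2) ≡ a + suc b + 2
  shift = solve-∀

fits : (Fin n → Bool) → (Fin n → Bool) → Subset n → Bool
fits inn out []      = true
fits inn out (b ∷ A) = (if b then not (out zero) else not (inn zero)) ∧ fits (inn ∘ suc) (out ∘ suc) A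

fits-intro : (inn out : Fin n → Bool) (A : Subset n) →
  (∀ i → inn i ≡ true → lookup A i ≡ true) → (∀ i → out i ≡ true → lookup A i ≡ false) → fits inn out A ≡ true
fits-intro inn out [] h k = refl
fits-intro inn out (true ∷ A) h k = ∧-intro
  (not-true (¬true⇒false (λ p → true≢false refl (k zero p)))) (fits-intro _ _ A (h ∘ suc) (k ∘ suc))
fits-intro inn out (false ∷ A) h k = ∧-intro
  (not-true (¬true⇒false (λ p → true≢false (h zero p) refl))) (fits-intro _ _ A (h ∘ suc) (k ∘ suc))

fits-out : (inn out : Fin n → Bool) (A : Subset n) → fits inn out A ≡ true →
  ∀ i → lookup A i ≡ true → out i ≡ false
fits-out inn out (true ∷ A) h zero refl = not-true⁻¹ (proj₁ (∧-true h))
fits-out inn out (b ∷ A) h (suc i) Ai = fits-out _ _ A (proj₂ (∧-true {if b then _ else _} h)) i Ai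

-- The weight depends on the sizes of A and of its complement and is not a product over coordinates.
-- Hence a and b accumulate the coordinates already decided; a free coordinate is split by
-- `patternWt-split`.
fits-weight : (inn out : Fin n → Bool) → (∀ i → inn i ≡ true → out i ≡ false) → ∀ a b →
  ∑ₛ (λ A → (a + ∣ A ∣) ! * (b + ∁-size A) ! * ind (fits inn out A))
    ≡ patternWt (a + # inn) (b + # out) (# (λ i → not (inn i ∨ out i)))
fits-weight {zero} inn out disj a b = refl
fits-weight {suc n} inn out disj a b with inn zero | out zero | disj zero
... | true  | true  | d = case d refl of λ ()
... | true  | false | _ = trans (cong₂ _+_ (∑ₛ-zero zeros)
        (∑ₛ-cong (λ A → cong (λ m → m ! * (b + ∁-size A) ! * ind (fits (inn ∘ suc) (out ∘ suc) A)) (+-suc a ∣ A ∣))))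
      (trans (fits-weight (inn ∘ suc) (out ∘ suc) (disj ∘ suc) (suc a) b)
        (cong (λ m → patternWt m (b + # (out ∘ suc)) (# (λ i → not (inn (suc i) ∨ out (suc i))))) (sym (+-suc a (# (inn ∘ suc))))))
  where
  zeros : ∀ (A : Subset n) → (a + ∣ A ∣) ! * (b + suc (∁-size A)) ! * 0 ≡ 0
  zeros A = *-zeroʳ ((a + ∣ A ∣) ! * (b + suc (∁-size A)) !)
... | false | true  | _ = trans (cong₂ _+_
        (∑ₛ-cong (λ A → cong (λ m → (a + ∣ A ∣) ! * m ! * ind (fits (inn ∘ suc) (out ∘ suc) A)) (+-suc b (∁-size A))))
        (∑ₛ-zero zeros))
      (trans (+-identityʳ _) (trans (fits-weight (inn ∘ suc) (out ∘ suc) (disj ∘ suc) a (suc b))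
        (cong (λ m → patternWt (a + # (inn ∘ suc)) m (# (λ i → not (inn (suc i) ∨ out (suc i))))) (sym (+-suc b (# (out ∘ suc)))))))
  where
  zeros : ∀ (A : Subset n) → (a + suc ∣ A ∣) ! * (b + ∁-size A) ! * 0 ≡ 0
  zeros A = *-zeroʳ ((a + suc ∣ A ∣) ! * (b + ∁-size A) !)
... | false | false | _ = trans (cong₂ _+_
        (trans (∑ₛ-cong (λ A → cong (λ m → (a + ∣ A ∣) ! * m ! * ind (fits (inn ∘ suc) (out ∘ suc) A)) (+-suc b (∁-size A))))
               (fits-weight (inn ∘ suc) (out ∘ suc) (disj ∘ suc) a (suc b)))
        (trans (∑ₛ-cong (λ A → cong (λ m → m ! * (b + ∁-size A) ! * ind (fits (inn ∘ suc) (out ∘ suc) A)) (+-suc a ∣ A ∣)))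
               (fits-weight (inn ∘ suc) (out ∘ suc) (disj ∘ suc) (suc a) b)))
      (trans (+-comm (patternWt (a + # (inn ∘ suc)) (suc b + # (out ∘ suc)) free) (patternWt (suc a + # (inn ∘ suc)) (b + # (out ∘ suc)) free))
        (sym (patternWt-split (a + # (inn ∘ suc)) (b + # (out ∘ suc)) free)))
  where
  free = # (λ i → not (inn (suc i) ∨ out (suc i)))

E-fits : (inn out : Fin n → Bool) → (∀ i → inn i ≡ true → out i ≡ false) →
  E (λ A → ind (fits inn out A)) ≡ patternWt (# inn) (# out) (# (λ i → not (inn i ∨ out i)))
E-fits inn out disj = fits-weight inn out disj 0 0

#-split₃ : (P Q : Fin n → Bool) → (∀ i → P i ≡ true → Q i ≡ false) →
  # P + # Q + # (λ i → not (P i ∨ Q i)) ≡ n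
#-split₃ {zero} P Q disj = refl
#-split₃ {suc n} P Q disj with P zero | Q zero | disj zero | #-split₃ (P ∘ suc) (Q ∘ suc) (disj ∘ suc)
... | true  | true  | d | _ = case d refl of λ ()
... | true  | false | _ | h = cong suc h
... | false | true  | _ | h = trans (cong (_+ # (λ i → not (P (suc i) ∨ Q (suc i)))) (+-suc _ _)) (cong suc h)
... | false | false | _ | h = trans (+-suc _ _) (cong suc h)

-- The cut is equally likely to fall in each of the q + 1 gaps left by the q avoided elements, and
-- it has to fall in the first.
E-avoid : (out : Fin n → Bool) → suc (# out) * E (λ A → ind (fits (λ _ → false) out A)) ≡ suc n !
E-avoid {n} out = trans (cong (suc (# out) *_) (E-fits (λ _ → false) out (λ _ ())))
  (trans (cong (λ m → suc q * patternWt m q r) none)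
  (trans (lemma q (q !) (rising (q + 2) r))
  (trans (cong (λ m → suc q ! * rising m r) (+-comm q 2))
  (trans (rising-! (suc q) r) (cong (λ m → suc m !) total)))))
  where
  q = # out
  r = # (λ i → not (false ∨ out i))
  none : # {n} (λ _ → false) ≡ 0
  none = ∑-zero (λ (_ : Fin n) → refl)
  total : q + r ≡ n
  total = trans (cong (λ m → m + q + r) (sym none)) (#-split₃ (λ _ → false) out (λ _ ()))
  lemma : ∀ q x r → (1 + q) * ((x + 0) * r) ≡ (x + q * x) * r
  lemma = solve-∀

-- Among the q + 2 items consisting of y, the cut and the q avoided elements, y has to come first
-- and the cut second.
E-in-avoid : (y : Fin n) (out : Fin n → Bool) → out y ≡ false →
  suc (# out) * suc (suc (# out)) * E (λ A → ind (fits (_== y) out A)) ≡ suc n !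
E-in-avoid {n} y out ¬outy = trans (cong (suc q * suc (suc q) *_) (E-fits (_== y) out disj))
  (trans (cong (λ m → suc q * suc (suc q) * patternWt m q r) (#-== y))
  (trans (lemma q (q !) (rising (1 + q + 2) r))
  (trans (cong (λ m → suc (suc q) ! * rising (suc m) r) (+-comm q 2))
  (trans (rising-! (suc (suc q)) r) (cong (λ m → suc m !) total)))))
  where
  q = # out
  r = # (λ i → not (i == y ∨ out i))
  disj : ∀ i → (i == y) ≡ true → out i ≡ false
  disj i h = subst (λ x → out x ≡ false) (sym (==⇒≡ h)) ¬outy
  total : 1 + q + r ≡ n
  total = trans (cong (λ m → m + q + r) (sym (#-== y))) (#-split₃ (_== y) out disj)
  lemma : ∀ q x r → (1 + q) * (2 + q) * ((x + 0) * r) ≡ (x + q * x + (1 + q) * (x + q * x)) * r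
  lemma = solve-∀

-- Subsets are grouped in fours by their trace outside y and w. The sets B ⊞ y and B ⊞ w have the
-- same size, hence the same weight, so it suffices to compare the sums of the values on these two.
E-quad : (y w : Fin n) → y ≢ w → (f g : Subset n → ℕ) →
  (∀ B → lookup B y ≡ false → lookup B w ≡ false →
     f B ≤ g B × f (B ⊞ y ⊞ w) ≤ g (B ⊞ y ⊞ w) × f (B ⊞ w) + f (B ⊞ y) ≤ g (B ⊞ w) + g (B ⊞ y)) →
  E f ≤ E g
E-quad y w y≢w f g h = subst₂ _≤_ (sym (quad f)) (sym (quad g)) (∑ₛ-mono pointwise)
  where
  paired : (Subset _ → ℕ) → Subset _ → ℕ
  paired f B = ind (not (lookup B y)) * (wt B * f B + wt (B ⊞ y) * f (B ⊞ y))
  quad : ∀ f → E f ≡ ∑ₛ (λ B → ind (not (lookup B w)) * (paired f B + paired f (B ⊞ w)))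
  quad f = trans (∑ₛ-pair y _) (∑ₛ-pair w (paired f))
  rearrange : ∀ α β γ a b c d → 1 * (1 * (α * a + β * b) + 1 * (β * c + γ * d)) ≡ α * a + γ * d + β * (c + b)
  rearrange = solve-∀
  pointwise : ∀ B → ind (not (lookup B w)) * (paired f B + paired f (B ⊞ w))
                  ≤ ind (not (lookup B w)) * (paired g B + paired g (B ⊞ w))
  pointwise B with lookup B w in Bw | lookup B y in By
  ... | true  | _    = z≤n
  ... | false | true rewrite ⊞-other B y≢w | By = z≤n
  ... | false | false rewrite ⊞-other B y≢w | By | ⊞-comm B w y
    with h B By Bw
  ... | h₁ , h₂ , h₃ = subst₂ _≤_ (sym (expand f)) (sym (expand g))
        (+-mono-≤ (+-mono-≤ (*-monoʳ-≤ (wt B) h₁) (*-monoʳ-≤ (wt (B ⊞ y ⊞ w)) h₂)) (*-monoʳ-≤ (wt (B ⊞ w)) h₃))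
    where
    wt-y : wt (B ⊞ y) ≡ wt (B ⊞ w)
    wt-y = cong₂ (λ a b → a ! * b !) (trans (size-⊞ B y By) (sym (size-⊞ B w Bw)))
      (suc-injective (trans (∁-size-⊞ B y By) (sym (∁-size-⊞ B w Bw))))
    expand : ∀ f → 1 * (1 * (wt B * f B + wt (B ⊞ y) * f (B ⊞ y)) + 1 * (wt (B ⊞ w) * f (B ⊞ w) + wt (B ⊞ y ⊞ w) * f (B ⊞ y ⊞ w)))
      ≡ wt B * f B + wt (B ⊞ y ⊞ w) * f (B ⊞ y ⊞ w) + wt (B ⊞ w) * (f (B ⊞ w) + f (B ⊞ y))
    expand f rewrite wt-y = rearrange (wt B) (wt (B ⊞ w)) (wt (B ⊞ y ⊞ w)) (f B) (f (B ⊞ y)) (f (B ⊞ w)) (f (B ⊞ y ⊞ w))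

-- Connected components of induced subgraphs

Graph : ℕ → Set
Graph n = Fin n → Fin n → Bool

Symmetric : Graph n → Set
Symmetric adj = ∀ a b → adj a b ≡ true → adj b a ≡ true

-- D is a union of components of the subgraph induced on S.
Closed : Graph n → (Fin n → Bool) → Subset n → Set
Closed adj S D = (∀ a → lookup D a ≡ true → S a ≡ true)
               × (∀ a b → lookup D a ≡ true → S b ≡ true → adj a b ≡ true → lookup D b ≡ true)

closed? : (adj : Graph n) (S : Fin n → Bool) (D : Subset n) → Dec (Closed adj S D)
closed? adj S D =
  all? (λ a → (lookup D a ≟ᵇ true) →-dec (S a ≟ᵇ true))
  ×-dec all? (λ a → all? (λ b → (lookup D a ≟ᵇ true) →-dec ((S b ≟ᵇ true) →-dec ((adj a b ≟ᵇ true) →-dec (lookup D b ≟ᵇ true)))))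

Separating : Graph n → (Fin n → Bool) → Fin n → Fin n → Subset n → Set
Separating adj S v u D = Closed adj S D × lookup D v ≡ true × lookup D u ≡ false

separated? : (adj : Graph n) (S : Fin n → Bool) (v u : Fin n) → Dec (∃ (Separating adj S v u))
separated? adj S v u = anySubset? (λ D → closed? adj S D ×-dec ((lookup D v ≟ᵇ true) ×-dec (lookup D u ≟ᵇ false)))

-- Paths are avoided: u is connected to v when every closed set containing v contains u. This is
-- decided by a search over subsets, and it is eliminated by exhibiting a suitable closed set. For v
-- outside S it holds vacuously, whence the hypothesis on v in `comp-closed`.
conn : Graph n → (Fin n → Bool) → Fin n → Fin n → Bool
conn adj S v u = not (does (separated? adj S v u))

conn-elim : (adj : Graph n) (S : Fin n → Bool) {v u : Fin n} → conn adj S v u ≡ true →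
  ∀ D → Closed adj S D → lookup D v ≡ true → lookup D u ≡ true
conn-elim adj S {v} {u} h D cl Dv with lookup D u in Du
... | true  = refl
... | false = ⊥-elim (does-false (separated? adj S v u) (not-true⁻¹ h) (D , cl , Dv , Du))

conn-intro : (adj : Graph n) (S : Fin n → Bool) {v u : Fin n} →
  (∀ D → Closed adj S D → lookup D v ≡ true → lookup D u ≡ true) → conn adj S v u ≡ true
conn-intro adj S {v} {u} h = not-true (dec-false (separated? adj S v u)
  λ { (D , cl , Dv , Du) → true≢false (h D cl Dv) Du })

conn-refl : (adj : Graph n) (S : Fin n → Bool) (v : Fin n) → conn adj S v v ≡ true
conn-refl adj S v = conn-intro adj S (λ D cl Dv → Dv)

comp : Graph n → (Fin n → Bool) → Fin n → Subset n
comp adj S v = tabulate (conn adj S v)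

comp-lookup : (adj : Graph n) (S : Fin n → Bool) (v u : Fin n) → lookup (comp adj S v) u ≡ conn adj S v u
comp-lookup adj S v u = lookup∘tabulate (conn adj S v) u

comp-self : (adj : Graph n) (S : Fin n → Bool) (v : Fin n) → lookup (comp adj S v) v ≡ true
comp-self adj S v = trans (comp-lookup adj S v v) (conn-refl adj S v)

comp-closed : (adj : Graph n) (S : Fin n → Bool) (v : Fin n) → S v ≡ true → Closed adj S (comp adj S v)
comp-closed adj S v Sv = inS , spread
  where
  all-closed : Closed adj S (tabulate S)
  all-closed = (λ a h → trans (sym (lookup∘tabulate S a)) h) , (λ a b _ Sb _ → trans (lookup∘tabulate S b) Sb)
  inS : ∀ a → lookup (comp adj S v) a ≡ true → S a ≡ true
  inS a h = trans (sym (lookup∘tabulate S a))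
    (conn-elim adj S (trans (sym (comp-lookup adj S v a)) h) (tabulate S) all-closed (trans (lookup∘tabulate S v) Sv))
  spread : ∀ a b → lookup (comp adj S v) a ≡ true → S b ≡ true → adj a b ≡ true → lookup (comp adj S v) b ≡ true
  spread a b h Sb ab = trans (comp-lookup adj S v b) (conn-intro adj S λ D cl Dv →
    proj₂ cl a b (conn-elim adj S (trans (sym (comp-lookup adj S v a)) h) D cl Dv) Sb ab)

-- By symmetry of adjacency the complement within S of a closed set is closed, so a set separating u
-- from v yields one separating v from u.
conn-sym : (adj : Graph n) → Symmetric adj → (S : Fin n → Bool) {v u : Fin n} → S v ≡ true →
  conn adj S v u ≡ true → conn adj S u v ≡ true
conn-sym {n} adj adj-sym S {v} {u} Sv h = conn-intro adj S closed⇒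
  where
  closed⇒ : ∀ D → Closed adj S D → lookup D u ≡ true → lookup D v ≡ true
  closed⇒ D cl Du with lookup D v in Dv
  ... | true  = refl
  ... | false = ⊥-elim (true≢false Du (not-true⁻¹ (proj₂ (∧-true {S u} (trans (sym (look u))
          (conn-elim adj S h D′ D′-closed (trans (look v) (∧-intro Sv (not-true Dv)))))))))
    where
    D′ : Subset n
    D′ = tabulate (λ i → S i ∧ not (lookup D i))
    look : ∀ i → lookup D′ i ≡ S i ∧ not (lookup D i)
    look i = lookup∘tabulate _ i
    D′-closed : Closed adj S D′
    D′-closed = (λ a p → proj₁ (∧-true (trans (sym (look a)) p)))
      , λ a b p Sb ab → trans (look b) (∧-intro Sb (not-true (¬true⇒false λ Db →
          true≢false (proj₂ cl b a Db (proj₁ (∧-true (trans (sym (look a)) p))) (adj-sym a b ab))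
                     (not-true⁻¹ (proj₂ (∧-true {S a} (trans (sym (look a)) p)))))))

Rep : Graph n → (S U₀ : Fin n → Bool) → Fin n → Set
Rep adj S U₀ v = S v ≡ true × (∀ u → conn adj S v u ≡ true → v Fin.≤ u × U₀ u ≡ false)

rep? : (adj : Graph n) (S U₀ : Fin n → Bool) (v : Fin n) → Dec (Rep adj S U₀ v)
rep? adj S U₀ v = (S v ≟ᵇ true) ×-dec all? (λ u → (conn adj S v u ≟ᵇ true) →-dec ((v Fin.≤? u) ×-dec (U₀ u ≟ᵇ false)))

rep : Graph n → (S U₀ : Fin n → Bool) → Fin n → Bool
rep adj S U₀ v = does (rep? adj S U₀ v)

-- The number of components of the subgraph induced on S that are disjoint from U₀,
-- counted through their least vertices.
comps : Graph n → (S U₀ : Fin n → Bool) → ℕ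
comps adj S U₀ = # (rep adj S U₀)

Misses : (Fin n → Bool) → Subset n → Set
Misses U₀ D = ∀ u → lookup D u ≡ true → U₀ u ≡ false

-- The component of the least vertex of D stays inside D, so this vertex is also the least of its
-- component.
closed-has-rep : (adj : Graph n) (S U₀ : Fin n → Bool) (D : Subset n) → Closed adj S D → Misses U₀ D →
  ∀ v → lookup D v ≡ true → ∃ λ r → lookup D r ≡ true × rep adj S U₀ r ≡ true
closed-has-rep adj S U₀ D cl miss v Dv with least (lookup D) v Dv
... | r , Dr , min = r , Dr , dec-true (rep? adj S U₀ r) (proj₁ cl r Dr , λ u ru →
        let Du = conn-elim adj S ru D cl Dr in min u Du , miss u Du)

-- Each counted component is itself a closed set, hence contains a point of Q. Different
-- representatives have disjoint components, so no point of Q serves two of them.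
comps≤ : (adj : Graph n) → Symmetric adj → (S U₀ Q : Fin n → Bool) →
  (∀ D → Closed adj S D → Misses U₀ D → ∀ v → lookup D v ≡ true → ∃ λ q → Q q ≡ true × lookup D q ≡ true) →
  comps adj S U₀ ≤ # Q
comps≤ adj adj-sym S U₀ Q hits = #-transversal (rep adj S U₀) Q (conn adj S) total unique
  where
  R = λ i (h : rep adj S U₀ i ≡ true) → does-true (rep? adj S U₀ i) h
  total : ∀ i → rep adj S U₀ i ≡ true → ∃ λ j → Q j ≡ true × conn adj S i j ≡ true
  total i h with hits (comp adj S i) (comp-closed adj S i (proj₁ (R i h)))
                  (λ u p → proj₂ (proj₂ (R i h) u (trans (sym (comp-lookup adj S i u)) p))) i (comp-self adj S i)
  ... | q , Qq , p = q , Qq , trans (sym (comp-lookup adj S i q)) p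
  unique : ∀ i i′ j → rep adj S U₀ i ≡ true → rep adj S U₀ i′ ≡ true →
    conn adj S i j ≡ true → conn adj S i′ j ≡ true → i ≡ i′
  unique i i′ j h h′ ij i′j = Finₚ.≤-antisym
    (proj₁ (proj₂ (R i h) i′ (trans-conn ij (conn-sym adj adj-sym S (proj₁ (R i′ h′)) i′j))))
    (proj₁ (proj₂ (R i′ h′) i (trans-conn i′j (conn-sym adj adj-sym S (proj₁ (R i h)) ij))))
    where
    trans-conn : ∀ {a b c} → conn adj S a b ≡ true → conn adj S b c ≡ true → conn adj S a c ≡ true
    trans-conn ab bc = conn-intro adj S λ D cl Da → conn-elim adj S bc D cl (conn-elim adj S ab D cl Da)

-- Compares two different graphs: once every closed set of the first contains a nonempty closed set
-- of the second, the representatives of the second form a hitting set for the first.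
comps-mono : (adj adj′ : Graph n) → Symmetric adj → (S S′ U₀ U₀′ : Fin n → Bool) →
  (∀ D → Closed adj S D → Misses U₀ D → ∀ v → lookup D v ≡ true →
     ∃ λ D′ → (∀ u → lookup D′ u ≡ true → lookup D u ≡ true) × Closed adj′ S′ D′ × Misses U₀′ D′ × (∃ λ v′ → lookup D′ v′ ≡ true)) →
  comps adj S U₀ ≤ comps adj′ S′ U₀′
comps-mono adj adj′ adj-sym S S′ U₀ U₀′ h = comps≤ adj adj-sym S U₀ (rep adj′ S′ U₀′) hits
  where
  hits : ∀ D → Closed adj S D → Misses U₀ D → ∀ v → lookup D v ≡ true →
    ∃ λ q → rep adj′ S′ U₀′ q ≡ true × lookup D q ≡ true
  hits D cl miss v Dv with h D cl miss v Dv
  ... | D′ , D′⊆D , cl′ , miss′ , v′ , D′v′ with closed-has-rep adj′ S′ U₀′ D′ cl′ miss′ v′ D′v′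
  ...   | r , D′r , isRep = r , isRep , D′⊆D r D′r

infixl 6 _∩ᵇ_
_∩ᵇ_ : Subset n → (Fin n → Bool) → Fin n → Bool
(A ∩ᵇ U) i = lookup A i ∧ U i

-- Processing the vertices of U₁ before those of U₂: a component missing U₀ either meets U₁ or misses it.
comps-glue : (adj : Graph n) → Symmetric adj → (U₀ U₁ U₂ : Fin n → Bool) (A : Subset n) →
  (∀ x → U₁ x ≡ true → U₂ x ≡ true) →
  comps adj (A ∩ᵇ U₂) U₀ ≤ comps adj (A ∩ᵇ U₁) U₀ + comps adj (A ∩ᵇ U₂) U₁
comps-glue {n} adj adj-sym U₀ U₁ U₂ A U₁⊆U₂ = ≤-trans (comps≤ adj adj-sym (A ∩ᵇ U₂) U₀ Q hits)
  (≤-trans (∑-mono pointwise) (≤-reflexive (∑-+ (λ i → ind (r₁ i)) (λ i → ind (r₂ i)))))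
  where
  r₁ = rep adj (A ∩ᵇ U₁) U₀
  r₂ = rep adj (A ∩ᵇ U₂) U₁
  Q : Fin n → Bool
  Q i = r₁ i ∨ r₂ i
  pointwise : ∀ i → ind (r₁ i ∨ r₂ i) ≤ ind (r₁ i) + ind (r₂ i)
  pointwise i with r₁ i
  ... | true  = s≤s z≤n
  ... | false = ≤-refl
  hits : ∀ D → Closed adj (A ∩ᵇ U₂) D → Misses U₀ D → ∀ v → lookup D v ≡ true → ∃ λ q → Q q ≡ true × lookup D q ≡ true
  hits D cl miss v Dv with any? (λ i → (lookup D i ∧ U₁ i) ≟ᵇ true)
  ... | no none with closed-has-rep adj (A ∩ᵇ U₂) U₁ D cl (λ u Du → ¬true⇒false λ U₁u → none (u , ∧-intro Du U₁u)) v Dv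
  ...   | r , Dr , h = r , ∨-introʳ {r₁ r} h , Dr
  hits D cl miss v Dv | yes (i , h) = found (closed-has-rep adj (A ∩ᵇ U₁) U₀ D′ cl′ miss′ i (trans (look i) h))
    where
    D′ : Subset n
    D′ = tabulate (λ i → lookup D i ∧ U₁ i)
    look : ∀ i → lookup D′ i ≡ lookup D i ∧ U₁ i
    look i = lookup∘tabulate _ i
    inD : ∀ i → lookup D′ i ≡ true → lookup D i ≡ true × U₁ i ≡ true
    inD i p = ∧-true (trans (sym (look i)) p)
    cl′ : Closed adj (A ∩ᵇ U₁) D′
    cl′ = (λ a p → ∧-intro (proj₁ (∧-true (proj₁ cl a (proj₁ (inD a p))))) (proj₂ (inD a p)))
      , λ a b p Sb ab → let Ab , U₁b = ∧-true {lookup A b} Sb in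
          trans (look b) (∧-intro (proj₂ cl a b (proj₁ (inD a p)) (∧-intro Ab (U₁⊆U₂ b U₁b)) ab) U₁b)
    miss′ : Misses U₀ D′
    miss′ u p = miss u (proj₁ (inD u p))
    found : (∃ λ r → lookup D′ r ≡ true × r₁ r ≡ true) → ∃ λ q → Q q ≡ true × lookup D q ≡ true
    found (r , D′r , p) = r , ∨-introˡ p , proj₁ (inD r D′r)

-- Contracting an edge

Irreflexive : Graph n → Set
Irreflexive adj = ∀ a → adj a a ≡ false

adjoin : (Fin n → Bool) → Fin n → Fin n → Bool
adjoin U y x = U x ∨ x == y

adjoin-true : (U : Fin n → Bool) (y x : Fin n) → adjoin U y x ≡ true → U x ≡ true ⊎ x ≡ y
adjoin-true U y x h with ∨-true {U x} h
... | inj₁ p = inj₁ p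
... | inj₂ p = inj₂ (==⇒≡ p)

∩ᵇ-true : (A : Subset n) (U : Fin n → Bool) (x : Fin n) → (A ∩ᵇ U) x ≡ true → lookup A x ≡ true × U x ≡ true
∩ᵇ-true A U x h = ∧-true h

-- The vertex type is kept and w inherits the neighbours of y; y disappears because later vertex
-- sets omit it. The test on a == b suppresses the loop at w that the edge from y to w would create.
contraction : Graph n → (y w : Fin n) → Graph n
contraction adj y w a b = not (a == b) ∧ (adj a b ∨ (a == w ∧ adj y b) ∨ (b == w ∧ adj a y))

commonNbr : Graph n → (Fin n → Bool) → (y w : Fin n) → Fin n → Bool
commonNbr adj U y w b = U b ∧ adj y b ∧ (b == w ∨ adj w b)

==-sym : (a b : Fin n) → (a == b) ≡ (b == a)
==-sym a b = ⇔⇒≡ (λ h → trans (cong (b ==_) (==⇒≡ h)) (==-refl b)) (λ h → trans (cong (a ==_) (==⇒≡ h)) (==-refl a))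

contraction-sym : (adj : Graph n) → Symmetric adj → (y w : Fin n) → Symmetric (contraction adj y w)
contraction-sym adj adj-sym y w a b h with ∧-true {not (a == b)} h
... | ne , h′ = ∧-intro (trans (cong not (==-sym b a)) ne) (flip (∨-true {adj a b} h′))
  where
  flip : adj a b ≡ true ⊎ (a == w ∧ adj y b) ∨ (b == w ∧ adj a y) ≡ true →
    adj b a ∨ (b == w ∧ adj y a) ∨ (a == w ∧ adj b y) ≡ true
  flip (inj₁ ab) = ∨-introˡ (adj-sym a b ab)
  flip (inj₂ h″) with ∨-true {a == w ∧ adj y b} h″
  ... | inj₁ p = ∨-introʳ {adj b a} (∨-introʳ {b == w ∧ adj y a} (∧-intro (proj₁ (∧-true p)) (adj-sym y b (proj₂ (∧-true {a == w} p)))))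
  ... | inj₂ p = ∨-introʳ {adj b a} (∨-introˡ {b == w ∧ adj y a} (∧-intro (proj₁ (∧-true {b == w} p)) (adj-sym a y (proj₂ (∧-true {b == w} p)))))

contraction-irrefl : (adj : Graph n) (y w : Fin n) → Irreflexive (contraction adj y w)
contraction-irrefl adj y w a rewrite ==-refl a = refl

module Contraction {n} (adj : Graph n) (adj-sym : Symmetric adj) (adj-irrefl : Irreflexive adj)
  (U U₀ : Fin n → Bool) (U₀⊆U : ∀ x → U₀ x ≡ true → U x ≡ true)
  (y w : Fin n) (y∉U : U y ≡ false) (w∈U₀ : U₀ w ≡ true) (yw : adj y w ≡ true) where

  adj′ : Graph n
  adj′ = contraction adj y w

  y≢w : y ≢ w
  y≢w refl = true≢false (U₀⊆U w w∈U₀) y∉U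

  common : Fin n → Bool
  common = commonNbr adj U y w

  data Edge′ (a b : Fin n) : Set where
    old  : adj a b ≡ true → Edge′ a b
    newˡ : a ≡ w → adj y b ≡ true → Edge′ a b
    newʳ : b ≡ w → adj a y ≡ true → Edge′ a b

  edge′ : ∀ {a b} → adj′ a b ≡ true → Edge′ a b
  edge′ {a} {b} h with ∨-true {adj a b} (proj₂ (∧-true {not (a == b)} h))
  ... | inj₁ ab = old ab
  ... | inj₂ h′ with ∨-true {a == w ∧ adj y b} h′
  ...   | inj₁ p = newˡ (==⇒≡ (proj₁ (∧-true p))) (proj₂ (∧-true {a == w} p))
  ...   | inj₂ p = newʳ (==⇒≡ (proj₁ (∧-true p))) (proj₂ (∧-true {b == w} p))

  before after : Subset n → ℕ
  before A = comps adj (A ∩ᵇ adjoin U y) U₀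
  after A = comps adj′ (A ∩ᵇ U) U₀

  module Split (B : Subset n) (y∉B : lookup B y ≡ false) (w∉B : lookup B w ≡ false) where

    S : Fin n → Bool
    S = B ∩ᵇ U

    S⇒≢w : ∀ {a} → S a ≡ true → a ≢ w
    S⇒≢w {a} h refl = true≢false (proj₁ (∧-true h)) w∉B

    S⇒≢y : ∀ {a} → S a ≡ true → a ≢ y
    S⇒≢y {a} h refl = true≢false (proj₁ (∧-true h)) y∉B

    S-in : (A : Subset n) → (∀ i → lookup B i ≡ true → lookup A i ≡ true) → ∀ b → S b ≡ true → (A ∩ᵇ adjoin U y) b ≡ true
    S-in A B⊆A b h = ∧-intro (B⊆A b (proj₁ (∧-true h))) (∨-introˡ (proj₂ (∧-true {lookup B b} h)))

    misses-w : ∀ {D} → Misses U₀ D → ∀ {a} → lookup D a ≡ true → a ≢ w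
    misses-w miss Da refl = true≢false w∈U₀ (miss _ Da)

    -- With both ends absent, no edge between present vertices is changed: every new edge has w as
    -- an end.
    none : before B ≤ after B
    none = comps-mono adj adj′ adj-sym (B ∩ᵇ adjoin U y) S U₀ U₀ λ D cl miss v Dv →
      D , (λ u p → p) , (inS D cl , spread D cl) , miss , v , Dv
      where
      inS : ∀ D → Closed adj (B ∩ᵇ adjoin U y) D → ∀ a → lookup D a ≡ true → S a ≡ true
      inS D cl a Da with ∩ᵇ-true B (adjoin U y) a (proj₁ cl a Da)
      ... | Ba , Ua with adjoin-true U y a Ua
      ...   | inj₁ p = ∧-intro Ba p
      ...   | inj₂ refl = ⊥-elim (true≢false Ba y∉B)
      spread : ∀ D → Closed adj (B ∩ᵇ adjoin U y) D → ∀ a b → lookup D a ≡ true → S b ≡ true → adj′ a b ≡ true → lookup D b ≡ true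
      spread D cl a b Da Sb e with edge′ e
      ... | old ab    = proj₂ cl a b Da (S-in B (λ _ p → p) b Sb) ab
      ... | newˡ p _  = ⊥-elim (S⇒≢w (inS D cl a Da) p)
      ... | newʳ p _  = ⊥-elim (S⇒≢w Sb p)

    w∈A∩U : ∀ A → lookup A w ≡ true → (A ∩ᵇ adjoin U y) w ≡ true
    w∈A∩U A Aw = ∧-intro Aw (∨-introˡ (U₀⊆U w w∈U₀))

    -- When both ends are present, a component missing U₀ contains neither w nor its neighbour y.
    both : before (B ⊞ y ⊞ w) ≤ after (B ⊞ y ⊞ w)
    both = comps-mono adj adj′ adj-sym (A ∩ᵇ adjoin U y) (A ∩ᵇ U) U₀ U₀ λ D cl miss v Dv →
      D , (λ u p → p) , (inS D cl miss , spread D cl miss) , miss , v , Dv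
      where
      A = B ⊞ y ⊞ w
      y∉D : ∀ D → Closed adj (A ∩ᵇ adjoin U y) D → Misses U₀ D → lookup D y ≡ true → ⊥
      y∉D D cl miss Dy = misses-w {D} miss (proj₂ cl y w Dy (w∈A∩U A (∈-⊞ (B ⊞ y) w)) yw) refl
      inS : ∀ D → Closed adj (A ∩ᵇ adjoin U y) D → Misses U₀ D → ∀ a → lookup D a ≡ true → (A ∩ᵇ U) a ≡ true
      inS D cl miss a Da with ∩ᵇ-true A (adjoin U y) a (proj₁ cl a Da)
      ... | Aa , Ua with adjoin-true U y a Ua
      ...   | inj₁ p = ∧-intro Aa p
      ...   | inj₂ refl = ⊥-elim (y∉D D cl miss Da)
      spread : ∀ D → Closed adj (A ∩ᵇ adjoin U y) D → Misses U₀ D →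
        ∀ a b → lookup D a ≡ true → (A ∩ᵇ U) b ≡ true → adj′ a b ≡ true → lookup D b ≡ true
      spread D cl miss a b Da Sb e with edge′ e
      ... | old ab    = proj₂ cl a b Da (∧-intro (proj₁ (∧-true Sb)) (∨-introˡ (proj₂ (∧-true {lookup A b} Sb)))) ab
      ... | newˡ p _  = ⊥-elim (misses-w {D} miss Da p)
      ... | newʳ _ ay = ⊥-elim (y∉D D cl miss (proj₂ cl a y Da
              (∧-intro (⊞-mono (B ⊞ y) w (∈-⊞ B y)) (∨-introʳ {U y} (==-refl y))) ay))

    touch? : (z r : Fin n) → Dec (∃ λ u → (conn adj S r u ∧ adj u z) ≡ true)
    touch? z r = any? (λ u → (conn adj S r u ∧ adj u z) ≟ᵇ true)

    touch : Fin n → Fin n → Bool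
    touch z r = does (touch? z r)

    -- The components of S missing U₀, and those among them that stay untouched when w, respectively
    -- y, is added.
    reps away-w away-y : Fin n → Bool
    reps = rep adj S U₀
    away-w r = reps r ∧ not (touch w r)
    away-y r = reps r ∧ not (touch y r)

    no-touch : ∀ {z r} → (∀ u → conn adj S r u ≡ true → adj u z ≡ true → ⊥) → not (touch z r) ≡ true
    no-touch {z} {r} h = not-true (dec-false (touch? z r) λ { (u , p) → h u (proj₁ (∧-true p)) (proj₂ (∧-true {conn adj S r u} p)) })

    no-touch⁻¹ : ∀ {z r} → not (touch z r) ≡ true → ∀ u → conn adj S r u ≡ true → adj u z ≡ true → ⊥
    no-touch⁻¹ {z} {r} h u p q = does-false (touch? z r) (not-true⁻¹ h) (u , ∧-intro p q)

    closed-without : ∀ z D → (B ⊞ z ∩ᵇ adjoin U y) z ≡ true → Closed adj (B ⊞ z ∩ᵇ adjoin U y) D → lookup D z ≡ false →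
      Closed adj S D × (∀ u → lookup D u ≡ true → adj u z ≡ true → ⊥)
    closed-without z D Sz cl Dz = (inS , λ a b Da Sb ab → proj₂ cl a b Da (S-in (B ⊞ z) (λ i → ⊞-mono B z) b Sb) ab)
      , λ u Du uz → true≢false (proj₂ cl u z Du Sz uz) Dz
      where
      inS : ∀ a → lookup D a ≡ true → S a ≡ true
      inS a Da with a ≟ z
      ... | yes refl = ⊥-elim (true≢false Da Dz)
      ... | no a≢z with ∩ᵇ-true (B ⊞ z) (adjoin U y) a (proj₁ cl a Da)
      ...   | Aa , Ua with trans (sym (⊞-other B a≢z)) Aa | adjoin-true U y a Ua
      ...     | Ba | inj₁ p = ∧-intro Ba p
      ...     | Ba | inj₂ refl = ⊥-elim (true≢false Ba y∉B)

    rep-away : ∀ z D → Closed adj S D → Misses U₀ D → (∀ u → lookup D u ≡ true → adj u z ≡ true → ⊥) →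
      ∀ v → lookup D v ≡ true → ∃ λ r → (reps r ∧ not (touch z r)) ≡ true × lookup D r ≡ true
    rep-away z D cl miss far v Dv with closed-has-rep adj S U₀ D cl miss v Dv
    ... | r , Dr , isRep = r , ∧-intro isRep (no-touch λ u ru → far u (conn-elim adj S ru D cl Dr)) , Dr

    -- The component of w meets U₀ and is not counted; any other one already lies in S and has no
    -- neighbour w.
    only-w : before (B ⊞ w) ≤ # away-w
    only-w = comps≤ adj adj-sym _ U₀ away-w λ D cl miss v Dv →
      let cl′ , far = closed-without w D (w∈A∩U (B ⊞ w) (∈-⊞ B w)) cl (¬true⇒false λ Dw → misses-w {D} miss Dw refl)
      in rep-away w D cl′ miss far v Dv

    Sy : (B ⊞ y ∩ᵇ adjoin U y) y ≡ true
    Sy = ∧-intro (∈-⊞ B y) (∨-introʳ {U y} (==-refl y))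

    -- All components touching y merge into the component of y, which accounts for the additional 1.
    only-y : before (B ⊞ y) ≤ suc (# away-y)
    only-y = ≤-trans (comps≤ adj adj-sym _ U₀ (adjoin away-y y) hits)
      (≤-reflexive (#-adjoin y (¬true⇒false λ p → S⇒≢y (proj₁ (does-true (rep? adj S U₀ y) (proj₁ (∧-true p)))) refl) (λ x → refl)))
      where
      hits : ∀ D → Closed adj (B ⊞ y ∩ᵇ adjoin U y) D → Misses U₀ D → ∀ v → lookup D v ≡ true →
        ∃ λ q → adjoin away-y y q ≡ true × lookup D q ≡ true
      hits D cl miss v Dv with lookup D y in Dy
      ... | true  = y , ∨-introʳ {away-y y} (==-refl y) , Dy
      ... | false = let cl′ , far = closed-without y D Sy cl Dy
                        r , h , Dr = rep-away y D cl′ miss far v Dv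
                    in r , ∨-introˡ h , Dr

    -- The component of a common neighbour a of y and w meets U₀, so no component containing y can miss U₀.
    only-y-blocked : ∀ a → S a ≡ true → adj y a ≡ true → (∃ λ u → conn adj S a u ≡ true × U₀ u ≡ true) →
      before (B ⊞ y) ≤ # away-y
    only-y-blocked a Sa ya (u , au , U₀u) = comps≤ adj adj-sym _ U₀ away-y λ D cl miss v Dv →
      let cl′ , far = closed-without y D Sy cl (y∉D D cl miss) in rep-away y D cl′ miss far v Dv
      where
      y∉D : ∀ D → Closed adj (B ⊞ y ∩ᵇ adjoin U y) D → Misses U₀ D → lookup D y ≡ false
      y∉D D cl miss = ¬true⇒false λ Dy → true≢false U₀u (miss u (proj₁ (∧-true (trans (sym (look u))
          (conn-elim adj S au D′ D′-closed (trans (look a) (∧-intro (proj₂ cl y a Dy (S-in (B ⊞ y) (λ i → ⊞-mono B y) a Sa) ya) Sa)))))))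
        where
        D′ : Subset n
        D′ = tabulate (λ i → lookup D i ∧ S i)
        look : ∀ i → lookup D′ i ≡ lookup D i ∧ S i
        look i = lookup∘tabulate _ i
        D′-closed : Closed adj S D′
        D′-closed = (λ b p → proj₂ (∧-true {lookup D b} (trans (sym (look b)) p)))
          , λ b c p Sc bc → trans (look c) (∧-intro (proj₂ cl b c (proj₁ (∧-true (trans (sym (look b)) p)))
              (S-in (B ⊞ y) (λ i → ⊞-mono B y) c Sc) bc) Sc)

    -- In the contracted problem y is no vertex of U, and w is absent, so B ⊞ y induces the old
    -- graph on S.
    reps≤after : # reps ≤ after (B ⊞ y)
    reps≤after = comps-mono adj adj′ adj-sym S (B ⊞ y ∩ᵇ U) U₀ U₀ λ D cl miss v Dv →
      D , (λ u p → p) , (grow D cl , spread D cl) , miss , v , Dv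
      where
      grow : ∀ D → Closed adj S D → ∀ a → lookup D a ≡ true → (B ⊞ y ∩ᵇ U) a ≡ true
      grow D cl a Da = ∧-intro (⊞-mono B y (proj₁ (∧-true (proj₁ cl a Da)))) (proj₂ (∧-true {lookup B a} (proj₁ cl a Da)))
      shrink : ∀ b → (B ⊞ y ∩ᵇ U) b ≡ true → S b ≡ true
      shrink b h with b ≟ y
      ... | yes refl = ⊥-elim (true≢false (proj₂ (∧-true {lookup (B ⊞ y) b} h)) y∉U)
      ... | no b≢y = ∧-intro (trans (sym (⊞-other B b≢y)) (proj₁ (∧-true h))) (proj₂ (∧-true {lookup (B ⊞ y) b} h))
      spread : ∀ D → Closed adj S D → ∀ a b → lookup D a ≡ true → (B ⊞ y ∩ᵇ U) b ≡ true → adj′ a b ≡ true → lookup D b ≡ true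
      spread D cl a b Da h e with edge′ e
      ... | old ab   = proj₂ cl a b Da (shrink b h) ab
      ... | newˡ p _ = ⊥-elim (S⇒≢w (proj₁ cl a Da) p)
      ... | newʳ p _ = ⊥-elim (S⇒≢w (shrink b h) p)

    -- After the contraction w has the neighbours of y as well as its own, so a component survives
    -- next to w if it touches neither.
    away-both≤after : # (λ r → away-w r ∧ away-y r) ≤ after (B ⊞ w)
    away-both≤after = #-mono isRep′
      where
      S′ : Fin n → Bool
      S′ = B ⊞ w ∩ᵇ U
      isRep′ : ∀ r → (away-w r ∧ away-y r) ≡ true → rep adj′ S′ U₀ r ≡ true
      isRep′ r h = dec-true (rep? adj′ S′ U₀ r) (proj₁ cl′ r (comp-self adj S r) , λ u p → proj₂ isRep u
          (trans (sym (comp-lookup adj S r u)) (conn-elim adj′ S′ p (comp adj S r) cl′ (comp-self adj S r))))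
        where
        hw = proj₁ (∧-true h)
        hy = proj₂ (∧-true {away-w r} h)
        isRep = does-true (rep? adj S U₀ r) (proj₁ (∧-true hw))
        far-w = no-touch⁻¹ {w} {r} (proj₂ (∧-true {reps r} hw))
        far-y = no-touch⁻¹ {y} {r} (proj₂ (∧-true {reps r} hy))
        cl = comp-closed adj S r (proj₁ isRep)
        to-conn : ∀ {u} → lookup (comp adj S r) u ≡ true → conn adj S r u ≡ true
        to-conn {u} p = trans (sym (comp-lookup adj S r u)) p
        cl′ : Closed adj′ S′ (comp adj S r)
        cl′ = (λ a p → ∧-intro (⊞-mono B w (proj₁ (∧-true (proj₁ cl a p)))) (proj₂ (∧-true {lookup B a} (proj₁ cl a p)))) , spread
          where
          spread : ∀ a b → lookup (comp adj S r) a ≡ true → S′ b ≡ true → adj′ a b ≡ true → lookup (comp adj S r) b ≡ true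
          spread a b p Sb e with edge′ e
          ... | newˡ q _  = ⊥-elim (S⇒≢w (proj₁ cl a p) q)
          ... | newʳ _ ay = ⊥-elim (far-y a (to-conn p) ay)
          ... | old ab with b ≟ w
          ...   | yes refl = ⊥-elim (far-w a (to-conn p) ab)
          ...   | no b≢w = proj₂ cl a b p (∧-intro (trans (sym (⊞-other B b≢w)) (proj₁ (∧-true Sb))) (proj₂ (∧-true {lookup (B ⊞ w) b} Sb))) ab

    -- Inclusion and exclusion: both sets consist of members of `reps`.
    counts : # away-w + # away-y ≤ # reps + # (λ r → away-w r ∧ away-y r)
    counts = subst₂ _≤_ (∑-+ (ind ∘ away-w) (ind ∘ away-y)) (∑-+ (ind ∘ reps) (λ r → ind (away-w r ∧ away-y r)))
      (∑-mono λ r → lemma (reps r) (touch w r) (touch y r))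
      where
      lemma : ∀ a b c → ind (a ∧ not b) + ind (a ∧ not c) ≤ ind a + ind ((a ∧ not b) ∧ (a ∧ not c))
      lemma false b c = z≤n
      lemma true true  true  = z≤n
      lemma true true  false = s≤s z≤n
      lemma true false true  = s≤s z≤n
      lemma true false false = ≤-refl

    -- A component touching both ends belongs to neither set and leaves one unit to spare, which
    -- pays for the component of y.
    counts-strict : ∀ r → reps r ≡ true → touch w r ≡ true → touch y r ≡ true →
      # away-w + suc (# away-y) ≤ # reps + # (λ r → away-w r ∧ away-y r)
    counts-strict r isRep tw ty = subst₂ _≤_ eq (∑-+ (ind ∘ reps) (λ r → ind (away-w r ∧ away-y r)))
      (∑-mono pointwise)
      where
      eq : ∑ (λ x → (ind (away-w x) + ind (away-y x)) + ind (x == r)) ≡ # away-w + suc (# away-y)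
      eq = trans (∑-+ (λ x → ind (away-w x) + ind (away-y x)) (λ x → ind (x == r)))
        (trans (cong₂ _+_ (∑-+ (ind ∘ away-w) (ind ∘ away-y)) (#-== r)) (trans (+-comm _ 1) (sym (+-suc _ _))))
      lemma : ∀ a b c → ind (a ∧ not b) + ind (a ∧ not c) + 0 ≤ ind a + ind ((a ∧ not b) ∧ (a ∧ not c))
      lemma false b c = z≤n
      lemma true true  true  = z≤n
      lemma true true  false = s≤s z≤n
      lemma true false true  = s≤s z≤n
      lemma true false false = ≤-refl
      pointwise : ∀ x → ind (away-w x) + ind (away-y x) + ind (x == r) ≤ ind (reps x) + ind (away-w x ∧ away-y x)
      pointwise x with x ≟ r
      ... | yes refl rewrite isRep | tw | ty = ≤-refl
      ... | no _ = lemma (reps x) (touch w x) (touch y x)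

    -- The possible excess of 1 is the component of y in B ⊞ y. If B contains no common neighbour,
    -- it is charged to the event `fits`. If B contains a common neighbour a, the component of a in
    -- S either meets U₀, and then the component of y is not counted (`only-y-blocked`), or it
    -- touches both y and w, and then `counts-strict` pays.
    one : before (B ⊞ w) + before (B ⊞ y) ≤ (after (B ⊞ w) + ind (fits (_== y) common (B ⊞ w))) + (after (B ⊞ y) + ind (fits (_== y) common (B ⊞ y)))
    one = by-cases (any? (λ a → (lookup B a ∧ common a) ≟ᵇ true))
      where
      open ≤-Reasoning
      i₁ = ind (fits (_== y) common (B ⊞ w))
      i₂ = ind (fits (_== y) common (B ⊞ y))
      finish : ∀ {k} → before (B ⊞ w) + before (B ⊞ y) ≤ (# reps + # (λ r → away-w r ∧ away-y r)) + k → k ≤ i₂ →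
        before (B ⊞ w) + before (B ⊞ y) ≤ (after (B ⊞ w) + i₁) + (after (B ⊞ y) + i₂)
      finish {k} p q = begin
        before (B ⊞ w) + before (B ⊞ y)                       ≤⟨ p ⟩
        (# reps + # (λ r → away-w r ∧ away-y r)) + k          ≤⟨ +-mono-≤ (+-mono-≤ reps≤after away-both≤after) q ⟩
        (after (B ⊞ y) + after (B ⊞ w)) + i₂                  ≤⟨ m≤m+n _ i₁ ⟩
        (after (B ⊞ y) + after (B ⊞ w)) + i₂ + i₁             ≡⟨ lemma (after (B ⊞ y)) (after (B ⊞ w)) i₂ i₁ ⟩
        (after (B ⊞ w) + i₁) + (after (B ⊞ y) + i₂)           ∎
        where
        lemma : ∀ a b c d → a + b + c + d ≡ (b + d) + (a + c)
        lemma = solve-∀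
      by-cases : Dec (∃ λ a → (lookup B a ∧ common a) ≡ true) →
        before (B ⊞ w) + before (B ⊞ y) ≤ (after (B ⊞ w) + i₁) + (after (B ⊞ y) + i₂)
      by-cases (no none) = finish {1} (begin
        before (B ⊞ w) + before (B ⊞ y)  ≤⟨ +-mono-≤ only-w only-y ⟩
        # away-w + suc (# away-y)        ≡⟨ trans (+-suc _ _) (+-comm 1 _) ⟩
        # away-w + # away-y + 1          ≤⟨ +-monoˡ-≤ 1 counts ⟩
        (# reps + # (λ r → away-w r ∧ away-y r)) + 1 ∎)
        (≤-reflexive (sym (cong ind (fits-intro (_== y) common (B ⊞ y)
          (λ i p → subst (λ z → lookup (B ⊞ y) z ≡ true) (sym (==⇒≡ p)) (∈-⊞ B y))
          λ i p → outside i p))))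
        where
        outside : ∀ i → common i ≡ true → lookup (B ⊞ y) i ≡ false
        outside i p with i ≟ y
        ... | yes refl = ⊥-elim (true≢false (proj₁ (∧-true p)) y∉U)
        ... | no i≢y = trans (⊞-other B i≢y) (¬true⇒false λ Bi → none (i , ∧-intro Bi p))
      by-cases (yes (a , h)) = finish {0} (≤-trans bound (≤-reflexive (sym (+-identityʳ _)))) z≤n
        where
        Ba = proj₁ (∧-true {lookup B a} h)
        ca = proj₂ (∧-true {lookup B a} h)
        Ua = proj₁ (∧-true {U a} ca)
        Sa : S a ≡ true
        Sa = ∧-intro Ba Ua
        ya : adj y a ≡ true
        ya = proj₁ (∧-true {adj y a} (proj₂ (∧-true {U a} ca)))
        aw : adj a w ≡ true
        aw with ∨-true {a == w} (proj₂ (∧-true {adj y a} (proj₂ (∧-true {U a} ca))))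
        ... | inj₁ p = ⊥-elim (S⇒≢w Sa (==⇒≡ p))
        ... | inj₂ p = adj-sym w a p
        bound : before (B ⊞ w) + before (B ⊞ y) ≤ # reps + # (λ r → away-w r ∧ away-y r)
        bound with any? (λ u → (conn adj S a u ∧ U₀ u) ≟ᵇ true)
        ... | yes (u , p) = ≤-trans (+-mono-≤ only-w
                (only-y-blocked a Sa ya (u , proj₁ (∧-true p) , proj₂ (∧-true {conn adj S a u} p)))) counts
        ... | no free with closed-has-rep adj S U₀ (comp adj S a) (comp-closed adj S a Sa)
                (λ u p → ¬true⇒false λ q → free (u , ∧-intro (trans (sym (comp-lookup adj S a u)) p) q)) a (comp-self adj S a)
        ...   | r , ar , isRep = ≤-trans (+-mono-≤ only-w only-y) (counts-strict r isRep (touches aw) (touches (adj-sym y a ya)))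
          where
          touches : ∀ {z} → adj a z ≡ true → touch z r ≡ true
          touches {z} az = dec-true (touch? z r) (a , ∧-intro (conn-sym adj adj-sym S Sa (trans (sym (comp-lookup adj S a r)) ar)) az)

  E-before≤ : E before ≤ E after + E (λ A → ind (fits (_== y) common A))
  E-before≤ = ≤-trans (E-quad y w y≢w before (λ A → after A + ind (fits (_== y) common A)) λ B By Bw →
      let open Split B By Bw in ≤-trans none (m≤m+n _ _) , ≤-trans both (m≤m+n _ _) , one)
    (≤-reflexive (E-+ after (λ A → ind (fits (_== y) common A))))

-- Bounds for vertex sets obtained by undoing edge contractions

-- U₁ arises from U₀ in m steps, each undoing the contraction of an edge whose ends have q - 1 common neighbours.
data Buildable (q : ℕ) {n : ℕ} : Graph n → (U₁ U₀ : Fin n → Bool) → ℕ → Set where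
  done : ∀ {adj U} → Buildable q adj U U 0
  glue : ∀ {adj U₂ U₁ U₀ m m′} → Buildable q adj U₁ U₀ m → Buildable q adj U₂ U₁ m′ → Buildable q adj U₂ U₀ (m + m′)
  expand : ∀ {adj U U₀ m} (y w : Fin n) → U y ≡ false → U₀ w ≡ true → adj y w ≡ true →
    q ≤ # (commonNbr adj U y w) →
    Buildable q (contraction adj y w) U U₀ m → Buildable q adj (adjoin U y) U₀ (suc m)

buildable-⊇ : ∀ {q} {adj : Graph n} {U₁ U₀ m} → Buildable q adj U₁ U₀ m → ∀ x → U₀ x ≡ true → U₁ x ≡ true
buildable-⊇ done x h = h
buildable-⊇ (glue b b′) x h = buildable-⊇ b′ x (buildable-⊇ b x h)
buildable-⊇ (expand y w _ _ _ _ b) x h = ∨-introˡ (buildable-⊇ b x h)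

buildable-# : ∀ {q} {adj : Graph n} {U₁ U₀ m} → Buildable q adj U₁ U₀ m → # U₁ ≡ m + # U₀
buildable-# done = refl
buildable-# (glue {U₀ = U₀} {m} {m′} b b′) = trans (buildable-# b′) (trans (cong (m′ +_) (buildable-# b))
  (trans (sym (+-assoc m′ m (# U₀))) (cong (_+ # U₀) (+-comm m′ m))))
buildable-# (expand y w y∉U _ _ _ b) = trans (#-adjoin y y∉U (λ _ → refl)) (cong suc (buildable-# b))

-- Induction on the construction. Gluing is subadditive by `comps-glue`; undoing a contraction adds
-- the weight computed in `E-in-avoid`, at most (n + 1)! / ((q + 1) (q + 2)) since at least q
-- elements are avoided. The denominator is kept as a factor on the left.
E-comps≤ : ∀ {q} {adj : Graph n} {U₁ U₀ m} → Symmetric adj → Irreflexive adj → Buildable q adj U₁ U₀ m →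
  suc q * suc (suc q) * E (λ A → comps adj (A ∩ᵇ U₁) U₀) ≤ m * suc n !
E-comps≤ {n = n} {q = q} {adj} {U₁ = U} adj-sym irr done = ≤-reflexive
  (trans (cong (suc q * suc (suc q) *_) (∑ₛ-zero {n} λ A → trans (cong (wt A *_) (none A)) (*-zeroʳ (wt A)))) (*-zeroʳ (suc q * suc (suc q))))
  where
  none : (A : Subset n) → comps adj (A ∩ᵇ U) U ≡ 0
  none A = ∑-zero λ v → cong ind (¬true⇒false λ h → let Sv , r = does-true (rep? adj (A ∩ᵇ U) U v) h in
    true≢false (proj₂ (∧-true {lookup A v} Sv)) (proj₂ (r v (conn-refl adj (A ∩ᵇ U) v))))
E-comps≤ {n = n} {q = q} {adj} adj-sym irr (glue {U₂ = U₂} {U₁} {U₀} {m} {m′} b b′) = begin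
  c * E (λ A → comps adj (A ∩ᵇ U₂) U₀)
    ≤⟨ *-monoʳ-≤ c (E-mono λ A → comps-glue adj adj-sym U₀ U₁ U₂ A (buildable-⊇ b′)) ⟩
  c * E (λ A → comps adj (A ∩ᵇ U₁) U₀ + comps adj (A ∩ᵇ U₂) U₁)
    ≡⟨ trans (cong (c *_) (E-+ (λ A → comps adj (A ∩ᵇ U₁) U₀) (λ A → comps adj (A ∩ᵇ U₂) U₁))) (*-distribˡ-+ c (E (λ A → comps adj (A ∩ᵇ U₁) U₀)) (E (λ A → comps adj (A ∩ᵇ U₂) U₁))) ⟩
  c * E (λ A → comps adj (A ∩ᵇ U₁) U₀) + c * E (λ A → comps adj (A ∩ᵇ U₂) U₁)
    ≤⟨ +-mono-≤ (E-comps≤ adj-sym irr b) (E-comps≤ adj-sym irr b′) ⟩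
  m * suc n ! + m′ * suc n !
    ≡⟨ sym (*-distribʳ-+ (suc n !) m m′) ⟩
  (m + m′) * suc n ! ∎
  where
  open ≤-Reasoning
  c = suc q * suc (suc q)
E-comps≤ {n = n} {q = q} {adj} adj-sym irr (expand {U = U} {U₀} {m} y w y∉U w∈U₀ yw enough b) = begin
  c * E (λ A → comps adj (A ∩ᵇ adjoin U y) U₀)
    ≤⟨ *-monoʳ-≤ c E-before≤ ⟩
  c * (E after + E (λ A → ind (fits (_== y) common A)))
    ≡⟨ *-distribˡ-+ c (E after) (E (λ A → ind (fits (_== y) common A))) ⟩
  c * E after + c * E (λ A → ind (fits (_== y) common A))
    ≤⟨ +-mono-≤ (E-comps≤ (contraction-sym adj adj-sym y w) (contraction-irrefl adj y w) b)
         (*-monoˡ-≤ (E (λ A → ind (fits (_== y) common A))) (*-mono-≤ (s≤s enough) (s≤s (s≤s enough)))) ⟩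
  m * suc n ! + suc (# common) * suc (suc (# common)) * E (λ A → ind (fits (_== y) common A))
    ≡⟨ cong (m * suc n ! +_) (E-in-avoid y common (cong (_∧ (adj y y ∧ (y == w ∨ adj w y))) y∉U)) ⟩
  m * suc n ! + suc n !
    ≡⟨ +-comm (m * suc n !) (suc n !) ⟩
  suc m * suc n ! ∎
  where
  open ≤-Reasoning
  c = suc q * suc (suc q)
  open Contraction adj adj-sym irr U U₀ (buildable-⊇ b) y w y∉U w∈U₀ yw

∑² : (Fin n → Fin n → ℕ) → ℕ
∑² f = ∑ (λ a → ∑ (f a))

∑²-mono : {f g : Fin n → Fin n → ℕ} → (∀ a b → f a b ≤ g a b) → ∑² f ≤ ∑² g
∑²-mono h = ∑-mono (λ a → ∑-mono (h a))

∑²-+ : (f g : Fin n → Fin n → ℕ) → ∑² (λ a b → f a b + g a b) ≡ ∑² f + ∑² g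
∑²-+ f g = trans (∑-cong λ a → ∑-+ (f a) (g a)) (∑-+ (λ a → ∑ (f a)) (λ a → ∑ (g a)))

∑-select : (y : Fin n) (f : Fin n → ℕ) → ∑ (λ x → ind (x == y) * f x) ≡ f y
∑-select y f = trans (∑-single y λ j j≢y → cong (λ b → ind b * f j) (==-≢ j≢y))
  (trans (cong (λ b → ind b * f y) (==-refl y)) (*-identityˡ (f y)))

∑²-row : (y : Fin n) (g : Fin n → ℕ) → ∑² (λ a b → ind (a == y) * g b) ≡ ∑ g
∑²-row y g = trans (∑-cong λ a → ∑-* (ind (a == y)) g) (∑-select y (λ _ → ∑ g))

∑²-column : (y : Fin n) (g : Fin n → ℕ) → ∑² (λ a b → ind (b == y) * g a) ≡ ∑ g
∑²-column y g = ∑-cong λ a → ∑-select y (λ _ → g a)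

-- Pairs are ordered, so each edge inside U₁ that does not lie inside U₀ is counted twice in
-- `pairs`.
adjacentPair : Graph n → (U₁ U₀ : Fin n → Bool) → Fin n → Fin n → Bool
adjacentPair adj U₁ U₀ a b = U₁ a ∧ U₁ b ∧ adj a b ∧ not (U₀ a ∧ U₀ b)

pairs : Graph n → (U₁ U₀ : Fin n → Bool) → ℕ
pairs adj U₁ U₀ = ∑² (λ a b → ind (adjacentPair adj U₁ U₀ a b))

-- The pairs on the left are disjoint: those of the first kind lie inside U₁, those of the second
-- kind do not.
pairs-glue : (adj : Graph n) (U₀ U₁ U₂ : Fin n → Bool) →
  (∀ x → U₀ x ≡ true → U₁ x ≡ true) → (∀ x → U₁ x ≡ true → U₂ x ≡ true) →
  pairs adj U₁ U₀ + pairs adj U₂ U₁ ≤ pairs adj U₂ U₀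
pairs-glue adj U₀ U₁ U₂ h k = ≤-trans (≤-reflexive (sym (∑²-+ (λ a b → ind (adjacentPair adj U₁ U₀ a b)) (λ a b → ind (adjacentPair adj U₂ U₁ a b)))))
  (∑²-mono λ a b → lemma (U₁ a) (U₁ b) (adj a b) (U₀ a) (U₀ b) (U₂ a) (U₂ b) (h a) (h b) (k a) (k b))
  where
  lemma : ∀ p q e u v s t → (u ≡ true → p ≡ true) → (v ≡ true → q ≡ true) → (p ≡ true → s ≡ true) → (q ≡ true → t ≡ true) →
    ind (p ∧ q ∧ e ∧ not (u ∧ v)) + ind (s ∧ t ∧ e ∧ not (p ∧ q)) ≤ ind (s ∧ t ∧ e ∧ not (u ∧ v))
  lemma true true e u v s t _ _ f g rewrite f refl | g refl with e | u ∧ v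
  ... | true  | true  = z≤n
  ... | true  | false = ≤-refl
  ... | false | _     = z≤n
  lemma true false e u true  s t _ g _ _ = case g refl of λ ()
  lemma true false e true false s true  _ _ f g rewrite f refl = ≤-refl
  lemma true false e false false s true _ _ f g rewrite f refl = ≤-refl
  lemma true false e u false s false _ _ f g rewrite f refl = z≤n
  lemma false q e true v s t f _ _ _ = case f refl of λ ()
  lemma false q e false v s t _ _ _ _ = ≤-refl

module ContractionPairs {n} (adj : Graph n) (adj-sym : Symmetric adj) (adj-irrefl : Irreflexive adj)
  (U U₀ : Fin n → Bool) (U₀⊆U : ∀ x → U₀ x ≡ true → U x ≡ true)
  (y w : Fin n) (y∉U : U y ≡ false) (w∈U₀ : U₀ w ≡ true) (yw : adj y w ≡ true) where

  open Contraction adj adj-sym adj-irrefl U U₀ U₀⊆U y w y∉U w∈U₀ yw using (adj′; common; edge′; old; newˡ; newʳ)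

  nbr private-nbr : Fin n → Bool
  nbr b = U b ∧ adj y b
  private-nbr b = U b ∧ adj y b ∧ not (b == w ∨ adj w b)

  y∉U₀ : U₀ y ≡ false
  y∉U₀ = ¬true⇒false λ h → true≢false (U₀⊆U y h) y∉U

  inner : Fin n → Fin n → ℕ
  inner a b = ind (adjacentPair adj U U₀ a b)

  -- An edge that the contraction creates inside U joins w to a neighbour of y that was not yet a
  -- neighbour of w.
  upper : pairs adj′ U U₀ ≤ ∑² inner + (# private-nbr + # private-nbr)
  upper = ≤-trans (∑²-mono bound) (≤-reflexive
    (trans (∑²-+ inner (λ a b → ind (a == w) * ind (private-nbr b) + ind (b == w) * ind (private-nbr a)))
      (cong (∑² inner +_) (trans (∑²-+ (λ a b → ind (a == w) * ind (private-nbr b)) (λ a b → ind (b == w) * ind (private-nbr a)))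
        (cong₂ _+_ (∑²-row w (ind ∘ private-nbr)) (∑²-column w (ind ∘ private-nbr)))))))
    where
    target : Fin n → Fin n → ℕ
    target a b = inner a b + (ind (a == w) * ind (private-nbr b) + ind (b == w) * ind (private-nbr a))
    bound : ∀ a b → ind (adjacentPair adj′ U U₀ a b) ≤ target a b
    bound a b with adjacentPair adj′ U U₀ a b in eq
    ... | false = z≤n
    ... | true = by-edge (edge′ e) (≡-dec (adj a b))
      where
      Ua = proj₁ (∧-true {U a} eq)
      eq₁ = proj₂ (∧-true {U a} eq)
      Ub = proj₁ (∧-true {U b} eq₁)
      eq₂ = proj₂ (∧-true {U b} eq₁)
      e = proj₁ (∧-true {adj′ a b} eq₂)
      outside = proj₂ (∧-true {adj′ a b} eq₂)
      a≢b : a ≢ b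
      a≢b refl = true≢false e (contraction-irrefl adj y w a)
      ≡-dec : ∀ c → c ≡ true ⊎ c ≡ false
      ≡-dec true  = inj₁ refl
      ≡-dec false = inj₂ refl
      old-case : adj a b ≡ true → 1 ≤ target a b
      old-case ab = ≤-trans (≤-reflexive (sym (cong ind (∧-intro Ua (∧-intro Ub (∧-intro ab outside)))))) (m≤m+n _ _)
      by-edge : Contraction.Edge′ adj adj-sym adj-irrefl U U₀ U₀⊆U y w y∉U w∈U₀ yw a b → adj a b ≡ true ⊎ adj a b ≡ false → 1 ≤ target a b
      by-edge _ (inj₁ ab) = old-case ab
      by-edge (old ab) (inj₂ _) = old-case ab
      by-edge (newˡ refl yb) (inj₂ ¬ab) = ≤-trans (≤-trans
        (≤-reflexive (sym (cong₂ (λ p q → ind p * ind q) (==-refl w)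
          (∧-intro Ub (∧-intro yb (not-true (cong₂ _∨_ (==-≢ (λ p → a≢b (sym p))) ¬ab)))))))
        (m≤m+n _ _)) (m≤n+m _ (inner w b))
      by-edge (newʳ refl ay) (inj₂ ¬ab) = ≤-trans (≤-trans
        (≤-reflexive (sym (cong₂ (λ p q → ind p * ind q) (==-refl w)
          (∧-intro Ua (∧-intro (adj-sym a y ay) (not-true (cong₂ _∨_ (==-≢ a≢b)
            (¬true⇒false λ wa → true≢false (adj-sym w a wa) ¬ab)))))))) (m≤n+m _ (ind (a == w) * ind (private-nbr w))))
        (m≤n+m _ (inner a w))

  lower : ∑² inner + (# nbr + # nbr) ≤ pairs adj (adjoin U y) U₀
  lower = ≤-trans (≤-reflexive (sym
    (trans (∑²-+ inner (λ a b → ind (a == y) * ind (nbr b) + ind (b == y) * ind (nbr a)))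
      (cong (∑² inner +_) (trans (∑²-+ (λ a b → ind (a == y) * ind (nbr b)) (λ a b → ind (b == y) * ind (nbr a)))
        (cong₂ _+_ (∑²-row y (ind ∘ nbr)) (∑²-column y (ind ∘ nbr)))))))) (∑²-mono bound)
    where
    bound : ∀ a b → inner a b + (ind (a == y) * ind (nbr b) + ind (b == y) * ind (nbr a)) ≤ ind (adjacentPair adj (adjoin U y) U₀ a b)
    bound a b with a ≟ y | b ≟ y
    ... | yes refl | yes refl rewrite y∉U = z≤n
    ... | yes refl | no _ rewrite y∉U | y∉U₀ = lemma (U b) (adj y b)
      where
      lemma : ∀ u e → 1 * ind (u ∧ e) + 0 ≤ ind ((u ∨ false) ∧ e ∧ true)
      lemma true true = ≤-refl
      lemma true false = z≤n
      lemma false e = z≤n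
    ... | no _ | yes refl rewrite y∉U | y∉U₀ = lemma (U a) (U₀ a) (adj a y) (adj y a) (adj-sym y a)
      where
      lemma : ∀ u z e e′ → (e′ ≡ true → e ≡ true) → ind (u ∧ false) + 1 * ind (u ∧ e′) ≤ ind ((u ∨ false) ∧ true ∧ e ∧ not (z ∧ false))
      lemma true true e true h rewrite h refl = ≤-refl
      lemma true false e true h rewrite h refl = ≤-refl
      lemma true z e false h = z≤n
      lemma false z e e′ h = z≤n
    ... | no _ | no _ = lemma (U a) (U b) (adj a b ∧ not (U₀ a ∧ U₀ b))
      where
      lemma : ∀ u v e → ind (u ∧ v ∧ e) + 0 ≤ ind ((u ∨ false) ∧ (v ∨ false) ∧ e)
      lemma true true true = ≤-refl
      lemma true true false = z≤n
      lemma true false e = z≤n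
      lemma false v e = z≤n

  nbr-split : # common + # private-nbr ≤ # nbr
  nbr-split = ≤-trans (≤-reflexive (sym (∑-+ (ind ∘ common) (ind ∘ private-nbr))))
    (∑-mono λ b → lemma (U b) (adj y b) (b == w ∨ adj w b))
    where
    lemma : ∀ u e c → ind (u ∧ e ∧ c) + ind (u ∧ e ∧ not c) ≤ ind (u ∧ e)
    lemma true true true = ≤-refl
    lemma true true false = ≤-refl
    lemma true false c = z≤n
    lemma false e c = z≤n

  -- Contracting deletes all edges at y and recreates those to private neighbours at w. The loss is
  -- one edge for every element of `common`: the edge to w, and one of the two edges to each common
  -- neighbour.
  pairs-expand : (# common + # common) + pairs adj′ U U₀ ≤ pairs adj (adjoin U y) U₀
  pairs-expand = begin
    (# common + # common) + pairs adj′ U U₀                                ≤⟨ +-monoʳ-≤ (# common + # common) upper ⟩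
    (# common + # common) + (∑² inner + (# private-nbr + # private-nbr))   ≡⟨ lemma (# common) (∑² inner) (# private-nbr) ⟩
    ∑² inner + ((# common + # private-nbr) + (# common + # private-nbr))   ≤⟨ +-monoʳ-≤ (∑² inner) (+-mono-≤ nbr-split nbr-split) ⟩
    ∑² inner + (# nbr + # nbr)                                             ≤⟨ lower ⟩
    pairs adj (adjoin U y) U₀ ∎
    where
    open ≤-Reasoning
    lemma : ∀ c i p → (c + c) + (i + (p + p)) ≡ i + ((c + p) + (c + p))
    lemma = solve-∀

pairs≥ : ∀ {q} {adj : Graph n} {U₁ U₀ m} → Symmetric adj → Irreflexive adj → Buildable q adj U₁ U₀ m →
  m * (q + q) ≤ pairs adj U₁ U₀
pairs≥ adj-sym irr done = z≤n
pairs≥ {q = q} {adj} adj-sym irr (glue {U₂ = U₂} {U₁} {U₀} {m} {m′} b b′) =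
  ≤-trans (≤-reflexive (*-distribʳ-+ (q + q) m m′))
  (≤-trans (+-mono-≤ (pairs≥ adj-sym irr b) (pairs≥ adj-sym irr b′)) (pairs-glue adj U₀ U₁ U₂ (buildable-⊇ b) (buildable-⊇ b′)))
pairs≥ {q = q} {adj} adj-sym irr (expand {U = U} {U₀} {m} y w y∉U w∈U₀ yw enough b) =
  ≤-trans (+-mono-≤ (+-mono-≤ enough enough) (pairs≥ (contraction-sym adj adj-sym y w) (contraction-irrefl adj y w) b))
    (ContractionPairs.pairs-expand adj adj-sym irr U U₀ (buildable-⊇ b) y w y∉U w∈U₀ yw)

-- Cycles modulo 2

⨁ : (Fin n → Bool) → Bool
⨁ {zero}  f = false
⨁ {suc n} f = f zero xor ⨁ (f ∘ suc)

⨁-cong : {f g : Fin n → Bool} → (∀ i → f i ≡ g i) → ⨁ f ≡ ⨁ g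
⨁-cong {zero}  h = refl
⨁-cong {suc n} h = cong₂ _xor_ (h zero) (⨁-cong (h ∘ suc))

⨁-false : {f : Fin n → Bool} → (∀ i → f i ≡ false) → ⨁ f ≡ false
⨁-false {zero}  h = refl
⨁-false {suc n} h = cong₂ _xor_ (h zero) (⨁-false (h ∘ suc))

xor-interchange : ∀ a b c d → (a xor b) xor (c xor d) ≡ (a xor c) xor (b xor d)
xor-interchange true  true  true  d = refl
xor-interchange true  true  false d = sym (not-involutive d)
xor-interchange true  false true  d = not-involutive d
xor-interchange true  false false d = refl
xor-interchange false true  true  d = refl
xor-interchange false true  false d = refl
xor-interchange false false true  d = refl
xor-interchange false false false d = refl

⨁-xor : (f g : Fin n → Bool) → ⨁ (λ i → f i xor g i) ≡ ⨁ f xor ⨁ g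
⨁-xor {zero}  f g = refl
⨁-xor {suc n} f g = trans (cong ((f zero xor g zero) xor_) (⨁-xor (f ∘ suc) (g ∘ suc)))
  (xor-interchange (f zero) (g zero) (⨁ (f ∘ suc)) (⨁ (g ∘ suc)))

⨁-∧ : (b : Bool) (f : Fin n → Bool) → b ∧ ⨁ f ≡ ⨁ (λ i → b ∧ f i)
⨁-∧ true  f = refl
⨁-∧ {n} false f = sym (⨁-false {n} λ _ → refl)

xor-≡ : ∀ {a b} → a xor b ≡ false → a ≡ b
xor-≡ {true}  {true}  _ = refl
xor-≡ {false} {false} _ = refl

⨁-single : {f : Fin n → Bool} (i : Fin n) → (∀ j → j ≢ i → f j ≡ false) → ⨁ f ≡ f i
⨁-single {f = f} zero h = trans (cong (f zero xor_) (⨁-false (λ j → h (suc j) λ ()))) (xor-identityʳ (f zero))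
⨁-single {f = f} (suc i) h = cong₂ _xor_ (h zero λ ()) (⨁-single i λ j j≢i → h (suc j) (j≢i ∘ Finₚ.suc-injective))

⨁-true : {f : Fin n → Bool} → ⨁ f ≡ true → ∃ λ i → f i ≡ true
⨁-true {suc n} {f} h with f zero in f₀
... | true = zero , f₀
... | false with ⨁-true h
...   | i , p = suc i , p

⨁-other : {f : Fin n → Bool} → ⨁ f ≡ false → (i : Fin n) → f i ≡ true → ∃ λ j → j ≢ i × f j ≡ true
⨁-other {f = f} h i fi with any? (λ j → ¬? (j ≟ i) ×-dec (f j ≟ᵇ true))
... | yes p = p
... | no none = ⊥-elim (true≢false (trans (⨁-single i λ j j≢i → ¬true⇒false λ p → none (j , j≢i , p)) fi) h)

-- Moving the value at y onto w does not change the parity. This is the effect of a contraction on a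
-- coefficient of the boundary.
⨁-merge : {f g : Fin n → Bool} (y w : Fin n) → y ≢ w → g y ≡ false → g w ≡ f w xor f y →
  (∀ x → x ≢ y → x ≢ w → g x ≡ f x) → ⨁ g ≡ ⨁ f
⨁-merge {n} {f} {g} y w y≢w gy gw other = sym (xor-≡ (trans (sym (⨁-xor f g)) (trans (⨁-cong pointwise)
  (trans (⨁-xor (λ x → x == y ∧ f y) (λ x → x == w ∧ f y))
    (trans (cong₂ _xor_ (select y) (select w)) (xor-same (f y)))))))
  where
  select : ∀ z → ⨁ (λ x → x == z ∧ f y) ≡ f y
  select z = trans (⨁-single z λ j j≢z → cong (_∧ f y) (==-≢ j≢z)) (cong (_∧ f y) (==-refl z))
  lemma : ∀ a b → a xor (a xor b) ≡ b
  lemma true  true  = refl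
  lemma true  false = refl
  lemma false b     = refl
  pointwise : ∀ x → f x xor g x ≡ (x == y ∧ f y) xor (x == w ∧ f y)
  pointwise x with x ≟ y | x ≟ w
  ... | yes refl | yes refl = ⊥-elim (y≢w refl)
  ... | yes refl | no _     = cong (f x xor_) gy
  ... | no _     | yes refl = trans (cong (f x xor_) gw) (lemma (f x) (f y))
  ... | no x≢y   | no x≢w   = trans (cong (f x xor_) (other x x≢y x≢w)) (xor-same (f x))

⨁-symmetric : (g : Fin n → Fin n → Bool) → (∀ a b → g a b ≡ g b a) → (∀ a → g a a ≡ false) →
  ⨁ (λ a → ⨁ (g a)) ≡ false
⨁-symmetric {zero}  g s d = refl
⨁-symmetric {suc n} g s d = trans (cong₂ _xor_ (cong (_xor ⨁ (λ b → g zero (suc b))) (d zero))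
    (trans (⨁-xor (λ a → g (suc a) zero) (λ a → ⨁ (λ b → g (suc a) (suc b))))
      (cong₂ _xor_ (⨁-cong (λ a → s (suc a) zero)) (⨁-symmetric (λ a b → g (suc a) (suc b)) (λ a b → s (suc a) (suc b)) (d ∘ suc)))))
  (lemma (⨁ (λ b → g zero (suc b))))
  where
  lemma : ∀ a → a xor (a xor false) ≡ false
  lemma true  = refl
  lemma false = refl

Family : ℕ → Set
Family n = Subset n → Bool

∂₂ : Family n → Family n
∂₂ Z η = ⨁ (λ x → not (lookup η x) ∧ Z (η ⊞ x))

record Cycle₂ (e : ℕ) (Z : Family n) : Set where
  field
    size     : ∀ σ → Z σ ≡ true → ∣ σ ∣ ≡ e
    boundary : ∀ η → ∂₂ Z η ≡ false

_⊆ᶠ_ : Family n → Family n → Set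
Y ⊆ᶠ Z = ∀ σ → Y σ ≡ true → Z σ ≡ true

-- For a cycle Z containing F this is minimality among all nonempty subcycles, because the
-- complement in Z of a subcycle is again a cycle. The form with F tells which part of a
-- decomposable image is to be followed.
MinimalAt : ℕ → Family n → Subset n → Set
MinimalAt e Z F = ∀ Y → Cycle₂ e Y → Y ⊆ᶠ Z → Y F ≡ true → Z ⊆ᶠ Y

∂₂∂₂ : (Z : Family n) (η : Subset n) → ∂₂ (∂₂ Z) η ≡ false
∂₂∂₂ Z η = trans (⨁-cong λ x → ⨁-∧ (not (lookup η x)) (λ u → not (lookup (η ⊞ x) u) ∧ Z (η ⊞ x ⊞ u)))
  (⨁-symmetric g g-sym g-diag)
  where
  g : Fin _ → Fin _ → Bool
  g x u = not (lookup η x) ∧ (not (lookup (η ⊞ x) u) ∧ Z (η ⊞ x ⊞ u))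
  g-diag : ∀ x → g x x ≡ false
  g-diag x rewrite ∈-⊞ η x with lookup η x
  ... | true  = refl
  ... | false = refl
  g-sym : ∀ x u → g x u ≡ g u x
  g-sym x u with x ≟ u
  ... | yes refl = refl
  ... | no x≢u rewrite ⊞-other η {x} {u} (x≢u ∘ sym) | ⊞-other η {u} {x} x≢u | ⊞-comm η x u
    with lookup η x | lookup η u
  ... | true  | true  = refl
  ... | true  | false = refl
  ... | false | true  = refl
  ... | false | false = refl

∑ₛ-mono-< : {f g : Subset n → ℕ} → (∀ A → f A ≤ g A) → (B : Subset n) → f B < g B → ∑ₛ f < ∑ₛ g
∑ₛ-mono-< h []          p = p
∑ₛ-mono-< h (false ∷ B) p = +-mono-<-≤ (∑ₛ-mono-< (h ∘ (false ∷_)) B p) (∑ₛ-mono (h ∘ (true ∷_)))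
∑ₛ-mono-< h (true  ∷ B) p = +-mono-≤-< (∑ₛ-mono (h ∘ (false ∷_))) (∑ₛ-mono-< (h ∘ (true ∷_)) B p)

-- Descent on the number of members. Whether a smaller subcycle exists is a question about functions
-- on subsets, which is settled by excluded middle; hence the double negation.
minimal-subcycle : (e : ℕ) (F : Subset n) (k : ℕ) (Z : Family n) → ∑ₛ (ind ∘ Z) < k → Cycle₂ e Z → Z F ≡ true →
  ¬ ¬ (Σ (Family n) λ Y → Cycle₂ e Y × Y ⊆ᶠ Z × Y F ≡ true × MinimalAt e Y F)
minimal-subcycle {n} e F (suc k) Z (s≤s bound) cyc ZF = ¬¬-bind ¬¬-excluded-middle descend
  where
  Smaller : Set
  Smaller = Σ (Family n) λ Y → Cycle₂ e Y × Y ⊆ᶠ Z × Y F ≡ true × (∃ λ σ → Z σ ≡ true × Y σ ≡ false)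
  descend : Dec Smaller → ¬ ¬ (Σ (Family n) λ Y → Cycle₂ e Y × Y ⊆ᶠ Z × Y F ≡ true × MinimalAt e Y F)
  descend (no none) = ¬¬-return (Z , cyc , (λ σ p → p) , ZF , minimal)
    where
    minimal : MinimalAt e Z F
    minimal Y cY Y⊆Z YF σ Zσ with Y σ in Yσ
    ... | true  = refl
    ... | false = ⊥-elim (none (Y , cY , Y⊆Z , YF , σ , Zσ , Yσ))
  descend (yes (Y , cY , Y⊆Z , YF , σ , Zσ , Yσ)) =
    ¬¬-bind (minimal-subcycle e F k Y (<-≤-trans smaller bound) cY YF) λ { (X , cX , X⊆Y , XF , m) →
      ¬¬-return (X , cX , (λ σ p → Y⊆Z σ (X⊆Y σ p)) , XF , m) }
    where
    smaller : ∑ₛ (ind ∘ Y) < ∑ₛ (ind ∘ Z)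
    smaller = ∑ₛ-mono-< (λ A → ind-mono (Y⊆Z A)) σ (subst₂ (λ a b → ind a < ind b) (sym Yσ) (sym Zσ) (s≤s z≤n))

-- Contracting an edge of a family of facets

module FamilyContraction {n} (e : ℕ) (Z : Family n) (cZ : Cycle₂ e Z) (y w : Fin n) (y≢w : y ≢ w) where

  w≢y : w ≢ y
  w≢y = y≢w ∘ sym

  -- The image of Z under y ↦ w.
  Z′ : Family n
  Z′ τ = if lookup τ y then false else (if lookup τ w then Z τ xor Z (τ ⊟ w ⊞ y) else Z τ)

  Z′-y : ∀ τ → lookup τ y ≡ true → Z′ τ ≡ false
  Z′-y τ h rewrite h = refl

  Z′-w : ∀ τ → lookup τ y ≡ false → lookup τ w ≡ true → Z′ τ ≡ Z τ xor Z (τ ⊟ w ⊞ y)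
  Z′-w τ h k rewrite h | k = refl

  Z′-neither : ∀ τ → lookup τ y ≡ false → lookup τ w ≡ false → Z′ τ ≡ Z τ
  Z′-neither τ h k rewrite h | k = refl

  ⊞-false : (η : Subset n) {x i : Fin n} → i ≢ x → lookup η i ≡ false → lookup (η ⊞ x) i ≡ false
  ⊞-false η i≢x h = trans (⊞-other η i≢x) h

  -- The substitution of w for y commutes with the boundary. A face containing w but not y receives
  -- the boundary at itself and at the face with y in place of w; members containing both y and w
  -- contribute to each of these and cancel.
  Z′-boundary : ∀ η → ∂₂ Z′ η ≡ false
  Z′-boundary η = by-cases (lookup η y) (lookup η w) refl refl
    where
    f g : Fin n → Bool
    f x = not (lookup η x) ∧ Z (η ⊞ x)
    g x = not (lookup η x) ∧ Z′ (η ⊞ x)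
    g-y : g y ≡ false
    g-y = trans (cong (not (lookup η y) ∧_) (Z′-y (η ⊞ y) (∈-⊞ η y))) (∧-zeroʳ _)
    by-cases : ∀ a b → lookup η y ≡ a → lookup η w ≡ b → ⨁ g ≡ false
    by-cases true b ηy ηw = ⨁-false λ x →
      trans (cong (not (lookup η x) ∧_) (Z′-y (η ⊞ x) (⊞-mono η x ηy))) (∧-zeroʳ _)
    by-cases false false ηy ηw = trans (⨁-merge y w y≢w g-y g-w other) (Cycle₂.boundary cZ η)
      where
      g-w : g w ≡ f w xor f y
      g-w rewrite ηw | ηy = trans (Z′-w (η ⊞ w) (⊞-false η y≢w ηy) (∈-⊞ η w))
        (cong (λ τ → Z (η ⊞ w) xor Z (τ ⊞ y)) (⊞-⊟ η w ηw))
      other : ∀ x → x ≢ y → x ≢ w → g x ≡ f x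
      other x x≢y x≢w = cong (not (lookup η x) ∧_)
        (Z′-neither (η ⊞ x) (⊞-false η (x≢y ∘ sym) ηy) (⊞-false η (x≢w ∘ sym) ηw))
    by-cases false true ηy ηw = trans (⨁-merge {f = λ x → f x xor f₂ x} y w y≢w g-y g-w other)
      (trans (⨁-xor f f₂) (cong₂ _xor_ (Cycle₂.boundary cZ η) (Cycle₂.boundary cZ η₂)))
      where
      η₂ : Subset n
      η₂ = η ⊟ w ⊞ y
      f₂ : Fin n → Bool
      f₂ x = not (lookup η₂ x) ∧ Z (η₂ ⊞ x)
      η₂w : lookup η₂ w ≡ false
      η₂w = ⊞-false (η ⊟ w) w≢y (∉-⊟ η w)
      η₂⊞w : η₂ ⊞ w ≡ η ⊞ y
      η₂⊞w = trans (⊞-comm (η ⊟ w) y w) (cong (_⊞ y) (⊟-⊞ η w ηw))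
      g-w : g w ≡ (f w xor f₂ w) xor (f y xor f₂ y)
      g-w rewrite ηw | ηy | η₂w | ∈-⊞ (η ⊟ w) y | η₂⊞w = sym (trans (cong (Z (η ⊞ y) xor_) (xor-identityʳ (Z (η ⊞ y)))) (xor-same (Z (η ⊞ y))))
      other : ∀ x → x ≢ y → x ≢ w → g x ≡ f x xor f₂ x
      other x x≢y x≢w rewrite ⊞-other (η ⊟ w) {y} {x} x≢y | ⊟-other η {w} {x} x≢w =
        trans (cong (not (lookup η x) ∧_) (trans (Z′-w (η ⊞ x) (⊞-false η (x≢y ∘ sym) ηy) (⊞-mono η x ηw))
            (cong (λ τ → Z (η ⊞ x) xor Z τ) (trans (cong (_⊞ y) (⊞-⊟-comm η x≢w)) (⊞-comm (η ⊟ w) x y)))))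
          (∧-distribˡ-xor (not (lookup η x)) (Z (η ⊞ x)) (Z (η₂ ⊞ x)))

  Z′-source : ∀ τ → Z′ τ ≡ true → lookup τ y ≡ false × (Z τ ≡ true ⊎ (lookup τ w ≡ true × Z (τ ⊟ w ⊞ y) ≡ true))
  Z′-source τ h with lookup τ y | lookup τ w | Z τ in Zτ | Z (τ ⊟ w ⊞ y) in Z₂
  ... | true  | _     | _     | _     = case h of λ ()
  ... | false | false | _     | _     = refl , inj₁ h
  ... | false | true  | true  | _     = refl , inj₁ refl
  ... | false | true  | false | _     = refl , inj₂ (refl , h)

  Z′-cycle : Cycle₂ e Z′
  Z′-cycle = record { size = size ; boundary = Z′-boundary }
    where
    size : ∀ τ → Z′ τ ≡ true → ∣ τ ∣ ≡ e
    size τ h with Z′-source τ h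
    ... | _  , inj₁ Zτ = Cycle₂.size cZ τ Zτ
    ... | τy , inj₂ (τw , Z₂) = trans (sym (size-⊟ τ w τw))
      (trans (sym (size-⊞ (τ ⊟ w) y (trans (⊟-other τ y≢w) τy))) (Cycle₂.size cZ _ Z₂))

  module Lift (Y : Family n) (cY : Cycle₂ e Y) (Y⊆Z′ : Y ⊆ᶠ Z′) where

    fold : Subset n → Subset n
    fold σ = if lookup σ y then σ ⊟ y ⊞ w else σ

    -- The members of Z whose image lies in Y. Those containing both y and w collapse under the
    -- contraction and are left out, so `over` need not be a cycle; its boundary is what produces
    -- the common neighbours of y and w.
    over : Family n
    over σ = not (lookup σ y ∧ lookup σ w) ∧ (Z σ ∧ Y (fold σ))

    over⊆Z : over ⊆ᶠ Z
    over⊆Z σ h = proj₁ (∧-true (proj₂ (∧-true {not (lookup σ y ∧ lookup σ w)} h)))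

    over-both : ∀ σ → lookup σ y ≡ true → lookup σ w ≡ true → over σ ≡ false
    over-both σ h k rewrite h | k = refl

    Y-y : ∀ τ → lookup τ y ≡ true → Y τ ≡ false
    Y-y τ h = ¬true⇒false λ p → true≢false (Y⊆Z′ τ p) (Z′-y τ h)

    over-without-y : ∀ τ → lookup τ y ≡ false → over τ ≡ Z τ ∧ Y τ
    over-without-y τ h rewrite h = refl

    over-neither : ∀ τ → lookup τ y ≡ false → lookup τ w ≡ false → over τ ≡ Y τ
    over-neither τ h k = trans (over-without-y τ h) (⇔⇒≡ (λ p → proj₂ (∧-true {Z τ} p))
      λ p → ∧-intro (trans (sym (Z′-neither τ h k)) (Y⊆Z′ τ p)) p)

    over-with-y : ∀ τ → lookup τ y ≡ false → lookup τ w ≡ false → over (τ ⊞ y) ≡ Z (τ ⊞ y) ∧ Y (τ ⊞ w)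
    over-with-y τ h k rewrite ∈-⊞ τ y | ⊞-other τ {y} {w} w≢y | k | ⊞-⊟ τ y h = refl

    -- A member τ ⊞ w of the image comes from exactly one of τ ⊞ y and τ ⊞ w in Z, as two preimages
    -- would cancel.
    over-sum : ∀ τ → lookup τ y ≡ false → lookup τ w ≡ false → over (τ ⊞ y) xor over (τ ⊞ w) ≡ Y (τ ⊞ w)
    over-sum τ h k = trans (cong₂ _xor_ (over-with-y τ h k) (over-without-y (τ ⊞ w) (⊞-false τ y≢w h)))
      (lemma (Z (τ ⊞ y)) (Z (τ ⊞ w)) (Y (τ ⊞ w)) λ p →
        trans (sym (trans (Z′-w (τ ⊞ w) (⊞-false τ y≢w h) (∈-⊞ τ w))
          (cong (λ ρ → Z (τ ⊞ w) xor Z (ρ ⊞ y)) (⊞-⊟ τ w k)))) (Y⊆Z′ (τ ⊞ w) p))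
      where
      lemma : ∀ a b c → (c ≡ true → b xor a ≡ true) → (a ∧ c) xor (b ∧ c) ≡ c
      lemma true  true  true  h = h refl
      lemma true  false true  h = refl
      lemma false true  true  h = refl
      lemma false false true  h = h refl
      lemma true  true  false h = refl
      lemma true  false false h = refl
      lemma false true  false h = refl
      lemma false false false h = refl

    ∂over-both : ∀ η → lookup η y ≡ true → lookup η w ≡ true → ∂₂ over η ≡ false
    ∂over-both η h k = ⨁-false λ x →
      trans (cong (not (lookup η x) ∧_) (over-both (η ⊞ x) (⊞-mono η x h) (⊞-mono η x k))) (∧-zeroʳ _)

    ∂over-neither : ∀ η → lookup η y ≡ false → lookup η w ≡ false → ∂₂ over η ≡ false
    ∂over-neither η h k = trans (sym (⨁-merge y w y≢w g-y g-w other)) (Cycle₂.boundary cY η)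
      where
      f g : Fin n → Bool
      f x = not (lookup η x) ∧ over (η ⊞ x)
      g x = not (lookup η x) ∧ Y (η ⊞ x)
      g-y : g y ≡ false
      g-y = trans (cong (not (lookup η y) ∧_) (Y-y (η ⊞ y) (∈-⊞ η y))) (∧-zeroʳ _)
      g-w : g w ≡ f w xor f y
      g-w rewrite h | k = trans (sym (over-sum η h k)) (xor-comm (over (η ⊞ y)) _)
      other : ∀ x → x ≢ y → x ≢ w → g x ≡ f x
      other x x≢y x≢w = cong (not (lookup η x) ∧_)
        (sym (over-neither (η ⊞ x) (⊞-false η (x≢y ∘ sym) h) (⊞-false η (x≢w ∘ sym) k)))

    -- The contraction carries `over` to Y and its boundary to that of Y, which vanishes. Since θ ⊞
    -- y and θ ⊞ w have the same image, their coefficients must agree.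
    ∂over-swap : ∀ θ → lookup θ y ≡ false → lookup θ w ≡ false → ∂₂ over (θ ⊞ y) ≡ ∂₂ over (θ ⊞ w)
    ∂over-swap θ θy θw = xor-≡ (trans (sym (⨁-xor fy fw)) (trans (⨁-cong pointwise) (Cycle₂.boundary cY (θ ⊞ w))))
      where
      fy fw : Fin n → Bool
      fy x = not (lookup (θ ⊞ y) x) ∧ over (θ ⊞ y ⊞ x)
      fw x = not (lookup (θ ⊞ w) x) ∧ over (θ ⊞ w ⊞ x)
      pointwise : ∀ x → fy x xor fw x ≡ not (lookup (θ ⊞ w) x) ∧ Y (θ ⊞ w ⊞ x)
      pointwise x with x ≟ y | x ≟ w
      ... | yes refl | _ rewrite ∈-⊞ θ y | over-both (θ ⊞ w ⊞ y) (∈-⊞ (θ ⊞ w) y) (⊞-mono (θ ⊞ w) y (∈-⊞ θ w)) | Y-y (θ ⊞ w ⊞ y) (∈-⊞ (θ ⊞ w) y) = refl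
      ... | no _ | yes refl rewrite ∈-⊞ θ w | over-both (θ ⊞ y ⊞ w) (⊞-mono (θ ⊞ y) w (∈-⊞ θ y)) (∈-⊞ (θ ⊞ y) w) = trans (xor-identityʳ _) (∧-zeroʳ (not (lookup (θ ⊞ y) x)))
      ... | no x≢y | no x≢w rewrite ⊞-other θ {y} {x} x≢y | ⊞-other θ {w} {x} x≢w | ⊞-comm θ y x | ⊞-comm θ w x =
        trans (sym (∧-distribˡ-xor (not (lookup θ x)) (over (θ ⊞ x ⊞ y)) (over (θ ⊞ x ⊞ w))))
          (cong (not (lookup θ x) ∧_) (over-sum (θ ⊞ x) (⊞-false θ (x≢y ∘ sym) θy) (⊞-false θ (x≢w ∘ sym) θw)))

    -- The face θ then lies together with y in a member of Z and together with w in another, so each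
    -- of its vertices is adjacent to both. The member at w is also kept in Y, because membership in
    -- Y is what guarantees that its vertices have been built when this is applied.
    facet-over : ∀ θ → lookup θ y ≡ false → lookup θ w ≡ false → ∂₂ over (θ ⊞ y) ≡ true → ∀ t → lookup θ t ≡ true →
      (∃ λ σ → Z σ ≡ true × lookup σ y ≡ true × lookup σ t ≡ true) × (∃ λ τ → (Z τ ≡ true × Y τ ≡ true) × lookup τ w ≡ true × lookup τ t ≡ true)
    facet-over θ θy θw h t θt with ⨁-true h | ⨁-true (trans (sym (∂over-swap θ θy θw)) h)
    ... | x , p | x′ , p′ =
      (θ ⊞ y ⊞ x , over⊆Z _ (proj₂ (∧-true {not (lookup (θ ⊞ y) x)} p)) , ⊞-mono (θ ⊞ y) x (∈-⊞ θ y) , ⊞-mono (θ ⊞ y) x (⊞-mono θ y θt))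
      , (τ , ∧-true {Z τ} (trans (sym (over-without-y τ τy)) Cτ) , ⊞-mono (θ ⊞ w) x′ (∈-⊞ θ w) , ⊞-mono (θ ⊞ w) x′ (⊞-mono θ w θt))
      where
      τ : Subset n
      τ = θ ⊞ w ⊞ x′
      Cτ : over τ ≡ true
      Cτ = proj₂ (∧-true {not (lookup (θ ⊞ w) x′)} p′)
      τy : lookup τ y ≡ false
      τy = ¬true⇒false λ q → true≢false Cτ (over-both τ q (⊞-mono (θ ⊞ w) x′ (∈-⊞ θ w)))

    Common : Subset n → Set
    Common κ = ∣ κ ∣ ≡ e × lookup κ w ≡ true × (∀ t → lookup κ t ≡ true → t ≢ w →
      t ≢ y × (∃ λ σ → Z σ ≡ true × lookup σ y ≡ true × lookup σ t ≡ true) × (∃ λ τ → (Z τ ≡ true × Y τ ≡ true) × lookup τ w ≡ true × lookup τ t ≡ true))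

    -- The boundary of over is y * H + w * H for a nonempty cycle H; a face θ of H together with the apex of a face
    -- of H adjacent to θ consists of common neighbours of y and w.
    common-from : 3 ≤ e → ∀ θ → lookup θ y ≡ false → lookup θ w ≡ false → ∂₂ over (θ ⊞ y) ≡ true → ∃ Common
    common-from e≥3 θ θy θw h = found (⨁-other (∂₂∂₂ over η) x (∧-intro (not-true ηx) (subst (λ ρ → ∂₂ over ρ ≡ true) (sym η⊞x) h)))
      where
      sizeθ : suc (suc ∣ θ ∣) ≡ e
      sizeθ with ⨁-true h
      ... | z , p = trans (sym (trans (size-⊞ (θ ⊞ y) z (not-true⁻¹ (proj₁ (∧-true p)))) (cong suc (size-⊞ θ y θy))))
                          (Cycle₂.size cZ (θ ⊞ y ⊞ z) (over⊆Z (θ ⊞ y ⊞ z) (proj₂ (∧-true {not (lookup (θ ⊞ y) z)} p))))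
      -- As θ has e - 2 vertices, e ≥ 3 provides a vertex x to exchange for another vertex z; z
      -- exists because the boundary of a boundary vanishes at θ ⊟ x ⊞ y.
      θ≥1 : 1 ≤ ∣ θ ∣
      θ≥1 = s≤s⁻¹ (s≤s⁻¹ (subst (3 ≤_) (sym sizeθ) e≥3))
      x = proj₁ (size≥1⇒∈ θ θ≥1)
      θx = proj₂ (size≥1⇒∈ θ θ≥1)
      x≢y : x ≢ y
      x≢y p = true≢false θx (subst (λ z → lookup θ z ≡ false) (sym p) θy)
      x≢w : x ≢ w
      x≢w p = true≢false θx (subst (λ z → lookup θ z ≡ false) (sym p) θw)
      η : Subset n
      η = θ ⊟ x ⊞ y
      ηx : lookup η x ≡ false
      ηx = ⊞-false (θ ⊟ x) x≢y (∉-⊟ θ x)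
      η⊞x : η ⊞ x ≡ θ ⊞ y
      η⊞x = trans (⊞-comm (θ ⊟ x) y x) (cong (_⊞ y) (⊟-⊞ θ x θx))
      found : (∃ λ z → z ≢ x × not (lookup η z) ∧ ∂₂ over (η ⊞ z) ≡ true) → ∃ Common
      found (z , z≢x , p) = κ , trans (trans (size-⊞ (θ ⊞ z) w (⊞-false θ (z≢w ∘ sym) θw)) (cong suc (size-⊞ θ z θz))) sizeθ , ∈-⊞ (θ ⊞ z) w , each
        where
        ηz = not-true⁻¹ (proj₁ (∧-true p))
        q = proj₂ (∧-true {not (lookup η z)} p)
        z≢y : z ≢ y
        z≢y refl = true≢false (∈-⊞ (θ ⊟ x) z) ηz
        z≢w : z ≢ w
        z≢w refl = true≢false q (∂over-both (η ⊞ z) (⊞-mono η z (∈-⊞ (θ ⊟ x) y)) (∈-⊞ η z))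
        θz : lookup θ z ≡ false
        θz = trans (sym (trans (⊞-other (θ ⊟ x) z≢y) (⊟-other θ z≢x))) ηz
        θ′ : Subset n
        θ′ = θ ⊟ x ⊞ z
        θ′y : lookup θ′ y ≡ false
        θ′y = ⊞-false (θ ⊟ x) (z≢y ∘ sym) (trans (⊟-other θ (x≢y ∘ sym)) θy)
        θ′w : lookup θ′ w ≡ false
        θ′w = ⊞-false (θ ⊟ x) (z≢w ∘ sym) (trans (⊟-other θ (x≢w ∘ sym)) θw)
        q′ : ∂₂ over (θ′ ⊞ y) ≡ true
        q′ = subst (λ ρ → ∂₂ over ρ ≡ true) (⊞-comm (θ ⊟ x) y z) q
        κ : Subset n
        κ = θ ⊞ z ⊞ w
        each : ∀ t → lookup κ t ≡ true → t ≢ w → t ≢ y × (∃ λ σ → Z σ ≡ true × lookup σ y ≡ true × lookup σ t ≡ true) × (∃ λ τ → (Z τ ≡ true × Y τ ≡ true) × lookup τ w ≡ true × lookup τ t ≡ true)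
        each t κt t≢w with t ≟ z
        ... | yes refl = z≢y , facet-over θ′ θ′y θ′w q′ z (∈-⊞ (θ ⊟ x) z)
        ... | no t≢z = (λ { refl → true≢false θt θy }) , facet-over θ θy θw h t θt
          where
          θt : lookup θ t ≡ true
          θt = trans (sym (trans (⊞-other (θ ⊞ z) t≢w) (⊞-other θ t≢z))) κt

    over-cycle : (∀ η → ∂₂ over η ≡ false) → Cycle₂ e over
    over-cycle h = record { size = λ σ p → Cycle₂.size cZ σ (over⊆Z σ p) ; boundary = h }

    -- If the boundary of `over` vanished, `over` would be a subcycle of Z through F, hence all of
    -- Z; but it omits σ, which contains both y and w.
    many-common : 3 ≤ e → (F : Subset n) → Z F ≡ true → lookup F y ≡ false → Y F ≡ true → MinimalAt e Z F →
      (∃ λ σ → Z σ ≡ true × lookup σ y ≡ true × lookup σ w ≡ true) → ∃ Common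
    many-common e≥3 F ZF Fy YF min (σ , Zσ , σy , σw) with anySubset? (λ η → ∂₂ over η ≟ᵇ true)
    ... | no none = ⊥-elim (true≢false
          (min over (over-cycle λ η → ¬true⇒false λ p → none (η , p)) over⊆Z (trans (over-without-y F Fy) (∧-intro ZF YF)) σ Zσ) (over-both σ σy σw))
    ... | yes (η , p) with lookup η y in ηy | lookup η w in ηw
    ...   | true  | true  = ⊥-elim (true≢false p (∂over-both η ηy ηw))
    ...   | false | false = ⊥-elim (true≢false p (∂over-neither η ηy ηw))
    ...   | true  | false = common-from e≥3 (η ⊟ y) (∉-⊟ η y) (trans (⊟-other η w≢y) ηw)
              (subst (λ ρ → ∂₂ over ρ ≡ true) (sym (⊟-⊞ η y ηy)) p)
    ...   | false | true  = common-from e≥3 (η ⊟ w) (trans (⊟-other η y≢w) ηy) (∉-⊟ η w)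
              (trans (∂over-swap (η ⊟ w) (trans (⊟-other η y≢w) ηy) (∉-⊟ η w)) (subst (λ ρ → ∂₂ over ρ ≡ true) (sym (⊟-⊞ η w ηw)) p))

-- Minimal cycles are buildable from a facet

-- The field `within` keeps a contracted vertex from being built again: in the contracted problem L
-- no longer contains y.
record Spans (e : ℕ) (Z : Family n) (L : Fin n → Bool) (adj : Graph n) (U : Fin n → Bool) : Set where
  constructor spans
  field
    {vertices}  : Fin n → Bool
    {steps}     : ℕ
    building    : Buildable e adj vertices U steps
    covers      : ∀ σ a → Z σ ≡ true → lookup σ a ≡ true → vertices a ≡ true
    within      : ∀ a → vertices a ≡ true → L a ≡ true ⊎ U a ≡ true

record Carries (Z : Family n) (L : Fin n → Bool) (adj : Graph n) : Set where
  field
    edges  : ∀ σ a b → Z σ ≡ true → lookup σ a ≡ true → lookup σ b ≡ true → a ≢ b → adj a b ≡ true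
    inside : ∀ σ a → Z σ ≡ true → lookup σ a ≡ true → L a ≡ true

outside : (L U : Fin n → Bool) → Fin n → Bool
outside L U x = L x ∧ not (U x)

Crossing : Family n → (Fin n → Bool) → Subset n → Fin n → Fin n → Set
Crossing Z U σ y w = Z σ ≡ true × lookup σ y ≡ true × lookup σ w ≡ true × U y ≡ false × U w ≡ true

crossing? : (Z : Family n) (U : Fin n → Bool) → Dec (∃ λ σ → ∃ λ y → ∃ λ w → Crossing Z U σ y w)
crossing? Z U = anySubset? λ σ → any? λ y → any? λ w →
  (Z σ ≟ᵇ true) ×-dec ((lookup σ y ≟ᵇ true) ×-dec ((lookup σ w ≟ᵇ true) ×-dec ((U y ≟ᵇ false) ×-dec (U w ≟ᵇ true))))

-- The members of Z inside U form a subcycle through F, hence all of Z. Indeed a nonempty ridge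
-- decides whether the members above it lie inside U, as none of them crosses; e ≥ 2 excludes the
-- empty ridge.
no-crossing : (e : ℕ) → 2 ≤ e → (Z : Family n) → Cycle₂ e Z → (F : Subset n) → Z F ≡ true → MinimalAt e Z F →
  (U : Fin n → Bool) → (∀ a → lookup F a ≡ true → U a ≡ true) →
  ¬ (∃ λ σ → ∃ λ y → ∃ λ w → Crossing Z U σ y w) → ∀ σ a → Z σ ≡ true → lookup σ a ≡ true → U a ≡ true
no-crossing {n} e e≥2 Z cZ F ZF min U F⊆U none σ a Zσ σa =
  inU σ (proj₂ (∧-true {Z σ} (min Y Y-cycle (λ τ p → proj₁ (∧-true p)) (∧-intro ZF (dec-true (inU? F) F⊆U)) σ Zσ))) a σa
  where
  inU? : ∀ τ → Dec (∀ a → lookup τ a ≡ true → U a ≡ true)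
  inU? τ = all? (λ a → (lookup τ a ≟ᵇ true) →-dec (U a ≟ᵇ true))
  Y : Family n
  Y τ = Z τ ∧ does (inU? τ)
  inU : ∀ τ → does (inU? τ) ≡ true → ∀ a → lookup τ a ≡ true → U a ≡ true
  inU τ = does-true (inU? τ)
  Y-boundary : ∀ η → ∂₂ Y η ≡ false
  Y-boundary η with any? (λ t → lookup η t ≟ᵇ true)
  ... | no empty = ⨁-false λ x → trans (cong (not (lookup η x) ∧_) (cong (_∧ does (inU? (η ⊞ x))) (tooSmall x))) (∧-zeroʳ _)
    where
    tooSmall : ∀ x → Z (η ⊞ x) ≡ false
    tooSmall x = ¬true⇒false λ p → <-irrefl refl (≤-trans e≥2 (≤-reflexive (trans (sym (Cycle₂.size cZ (η ⊞ x) p))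
      (trans (size-⊞ η x (¬true⇒false λ q → empty (x , q)))
        (cong suc (trans (size≡# η) (∑-zero λ i → cong ind (¬true⇒false λ q → empty (i , q)))))))))
  ... | yes (t , ηt) with U t in Ut
  ...   | true = trans (⨁-cong λ x → cong (not (lookup η x) ∧_) (same x)) (Cycle₂.boundary cZ η)
    where
    same : ∀ x → Y (η ⊞ x) ≡ Z (η ⊞ x)
    same x = ⇔⇒≡ (λ p → proj₁ (∧-true p)) λ p → ∧-intro p (dec-true (inU? (η ⊞ x))
      λ b q → ¬false⇒true λ Ub → none (η ⊞ x , b , t , p , q , ⊞-mono η x ηt , Ub , Ut))
  ...   | false = ⨁-false λ x → trans (cong (not (lookup η x) ∧_)
            (¬true⇒false λ p → true≢false (inU (η ⊞ x) (proj₂ (∧-true {Z (η ⊞ x)} p)) t (⊞-mono η x ηt)) Ut)) (∧-zeroʳ _)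
  Y-cycle : Cycle₂ e Y
  Y-cycle = record { size = λ τ p → Cycle₂.size cZ τ (proj₁ (∧-true p)) ; boundary = Y-boundary }

-- Fogelsanger's contraction argument, by induction on the number of vertices outside U. An edge yw with y ∉ U and w ∈ U
-- is contracted; by induction the minimal cycle through F in the image is spanned, and undoing the contraction adds y.
minimal-spans : (k e : ℕ) → 3 ≤ e → (Z : Family n) → Cycle₂ e Z → (F : Subset n) → Z F ≡ true → MinimalAt e Z F →
  (L U : Fin n → Bool) → (∀ a → lookup F a ≡ true → U a ≡ true) → (adj : Graph n) → Symmetric adj →
  Carries Z L adj → # (outside L U) < k → ¬ ¬ Spans e Z L adj U
minimal-spans {n} (suc k) e e≥3 Z cZ F ZF min L U F⊆U adj adj-sym car (s≤s bound) with crossing? Z U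
... | no none = ¬¬-return (spans done (no-crossing e (≤-trans (n≤1+n 2) e≥3) Z cZ F ZF min U F⊆U none) (λ a → inj₂))
... | yes (σ , y , w , Zσ , σy , σw , Uy , Uw) = contract-at (Z′ F) refl
  where
  open Carries car
  y≢w : y ≢ w
  y≢w refl = true≢false Uw Uy
  open FamilyContraction e Z cZ y w y≢w
  yw : adj y w ≡ true
  yw = edges σ y w Zσ σy σw y≢w
  Fy : lookup F y ≡ false
  Fy = ¬true⇒false λ p → true≢false (F⊆U y p) Uy
  outside-y : outside L U y ≡ true
  outside-y = ∧-intro (inside σ y Zσ σy) (not-true Uy)

  -- The cycle followed after the contraction may be smaller than the image of Z, so some vertices
  -- of Z can still be missing. The argument resumes for Z itself with the larger starting set,
  -- which has gained at least y.
  restart : ∀ {U₂ m} → Buildable e adj (adjoin U₂ y) U m → (∀ x → U x ≡ true → U₂ x ≡ true) →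
    (∀ a → U₂ a ≡ true → L a ≡ true ⊎ U a ≡ true) → ¬ ¬ Spans e Z L adj U
  restart {U₂} b U⊆U₂ U₂⊆ = ¬¬-bind (minimal-spans k e e≥3 Z cZ F ZF min L (adjoin U₂ y) (λ a p → ∨-introˡ (U⊆U₂ a (F⊆U a p))) adj adj-sym car
      (<-≤-trans (#-mono-< y (trans (cong (λ c → L y ∧ not c) (∨-introʳ {U₂ y} (==-refl y))) (∧-zeroʳ (L y))) outside-y
        (λ x p → ∧-intro (proj₁ (∧-true p)) (not-true (¬true⇒false λ Ux →
          true≢false (∨-introˡ (U⊆U₂ x Ux)) (not-true⁻¹ (proj₂ (∧-true {L x} p))))))) bound))
    λ { (spans b′ cov wit) → ¬¬-return (spans (glue b b′) cov λ a p → widen a (wit a p)) }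
    where
    widen : ∀ a → L a ≡ true ⊎ adjoin U₂ y a ≡ true → L a ≡ true ⊎ U a ≡ true
    widen a (inj₁ p) = inj₁ p
    widen a (inj₂ p) with adjoin-true U₂ y a p
    ... | inj₁ q = U₂⊆ a q
    ... | inj₂ refl = inj₁ (inside σ y Zσ σy)

  contract-at : ∀ b → Z′ F ≡ b → ¬ ¬ Spans e Z L adj U
  -- The facet F vanishes from the image by cancelling against F with w replaced by y. Then F itself
  -- consists of w and common neighbours of y and w, and y can be added at once.
  contract-at false Z′F = restart (expand y w Uy Uw yw enough done) (λ x p → p) (λ a → inj₂)
    where
    Fw : lookup F w ≡ true
    Fw = ¬false⇒true λ eq → true≢false (trans (Z′-neither F Fy eq) ZF) Z′F
    F₂ : Z (F ⊟ w ⊞ y) ≡ true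
    F₂ = trans (sym (xor-≡ (trans (sym (Z′-w F Fy Fw)) Z′F))) ZF
    enough : e ≤ # (commonNbr adj U y w)
    enough = ≤-trans (≤-reflexive (trans (sym (Cycle₂.size cZ F ZF)) (size≡# F))) (#-mono common-nbr)
      where
      common-nbr : ∀ t → lookup F t ≡ true → commonNbr adj U y w t ≡ true
      common-nbr t Ft with t ≟ w
      ... | yes refl = ∧-intro Uw (∧-intro yw refl)
      ... | no t≢w = ∧-intro (F⊆U t Ft) (∧-intro
              (edges (F ⊟ w ⊞ y) y t F₂ (∈-⊞ (F ⊟ w) y) (⊞-mono (F ⊟ w) y (trans (⊟-other F t≢w) Ft)) λ { refl → true≢false Ft Fy })
              (edges F w t ZF Fw Ft (t≢w ∘ sym)))
  contract-at true Z′F = ¬¬-bind (minimal-subcycle e F (suc (∑ₛ (ind ∘ Z′))) Z′ ≤-refl Z′-cycle Z′F) lifted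
    where
    L′ : Fin n → Bool
    L′ x = L x ∧ not (x == y)
    lifted : (Σ (Family n) λ Y → Cycle₂ e Y × Y ⊆ᶠ Z′ × Y F ≡ true × MinimalAt e Y F) → ¬ ¬ Spans e Z L adj U
    lifted (Y , cY , Y⊆Z′ , YF , minY) = ¬¬-bind
      (minimal-spans k e e≥3 Y cY F YF minY L′ U F⊆U (contraction adj y w) (contraction-sym adj adj-sym y w)
        (record { edges = edges′ ; inside = inside′ }) fewer) undo
      where
      open Lift Y cY Y⊆Z′
      fewer : # (outside L′ U) < k
      fewer = <-≤-trans (#-mono-< y (cong (_∧ not (U y)) (trans (cong (λ c → L y ∧ not c) (==-refl y)) (∧-zeroʳ (L y)))) outside-y
        (λ x p → ∧-intro (proj₁ (∧-true (proj₁ (∧-true {L′ x} p)))) (proj₂ (∧-true {L′ x} p)))) bound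
      edges′ : ∀ τ a b → Y τ ≡ true → lookup τ a ≡ true → lookup τ b ≡ true → a ≢ b → contraction adj y w a b ≡ true
      edges′ τ a b Yτ τa τb a≢b = ∧-intro (not-true (==-≢ a≢b)) (from (Z′-source τ (Y⊆Z′ τ Yτ)))
        where
        keep : ∀ {t} → t ≢ w → lookup τ t ≡ true → lookup (τ ⊟ w ⊞ y) t ≡ true
        keep t≢w p = ⊞-mono (τ ⊟ w) y (trans (⊟-other τ t≢w) p)
        from : lookup τ y ≡ false × (Z τ ≡ true ⊎ (lookup τ w ≡ true × Z (τ ⊟ w ⊞ y) ≡ true)) →
          adj a b ∨ (a == w ∧ adj y b) ∨ (b == w ∧ adj a y) ≡ true
        from (_ , inj₁ Zτ) = ∨-introˡ (edges τ a b Zτ τa τb a≢b)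
        from (τy , inj₂ (_ , Z₂)) with a ≟ w | b ≟ w
        ... | yes refl | yes refl = ⊥-elim (a≢b refl)
        ... | yes refl | no b≢w = ∨-introʳ {adj a b} (∨-introˡ (edges (τ ⊟ w ⊞ y) y b Z₂ (∈-⊞ (τ ⊟ w) y) (keep b≢w τb)
                λ { refl → true≢false τb τy }))
        ... | no a≢w | yes refl = ∨-introʳ {adj a b} (edges (τ ⊟ w ⊞ y) a y Z₂ (keep a≢w τa) (∈-⊞ (τ ⊟ w) y)
                λ { refl → true≢false τa τy })
        ... | no a≢w | no b≢w = ∨-introˡ (edges (τ ⊟ w ⊞ y) a b Z₂ (keep a≢w τa) (keep b≢w τb) a≢b)
      inside′ : ∀ τ a → Y τ ≡ true → lookup τ a ≡ true → L′ a ≡ true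
      inside′ τ a Yτ τa with Z′-source τ (Y⊆Z′ τ Yτ)
      ... | τy , src = ∧-intro (inL src) (not-true (==-≢ {x = a} {y} λ { refl → true≢false τa τy }))
        where
        inL : Z τ ≡ true ⊎ (lookup τ w ≡ true × Z (τ ⊟ w ⊞ y) ≡ true) → L a ≡ true
        inL (inj₁ Zτ) = inside τ a Zτ τa
        inL (inj₂ (_ , Z₂)) with a ≟ w
        ... | yes refl = inside σ w Zσ σw
        ... | no a≢w = inside (τ ⊟ w ⊞ y) a Z₂ (⊞-mono (τ ⊟ w) y (trans (⊟-other τ a≢w) τa))
      undo : Spans e Y L′ (contraction adj y w) U → ¬ ¬ Spans e Z L adj U
      undo (spans {U₂} b cov wit) = restart (expand y w U₂y Uw yw enough b) U⊆U₂ λ a p → narrow a (wit a p)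
        where
        U⊆U₂ = buildable-⊇ b
        narrow : ∀ a → L′ a ≡ true ⊎ U a ≡ true → L a ≡ true ⊎ U a ≡ true
        narrow a (inj₁ p) = inj₁ (proj₁ (∧-true p))
        narrow a (inj₂ p) = inj₂ p
        U₂y : U₂ y ≡ false
        U₂y = ¬true⇒false λ p → case wit y p of λ
          { (inj₁ q) → true≢false (proj₂ (∧-true {L y} q)) (cong not (==-refl y))
          ; (inj₂ q) → true≢false q Uy }
        enough : e ≤ # (commonNbr adj U₂ y w)
        enough with many-common e≥3 F ZF Fy YF min (σ , Zσ , σy , σw)
        ... | κ , size , _ , each = ≤-trans (≤-reflexive (trans (sym size) (size≡# κ))) (#-mono common-nbr)
          where
          common-nbr : ∀ t → lookup κ t ≡ true → commonNbr adj U₂ y w t ≡ true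
          common-nbr t κt with t ≟ w
          ... | yes refl = ∧-intro (U⊆U₂ t Uw) (∧-intro yw refl)
          ... | no t≢w with each t κt t≢w
          ...   | t≢y , (σ₁ , Zσ₁ , σ₁y , σ₁t) , (τ , (Zτ , Yτ) , τw , τt) = ∧-intro (cov τ t Yτ τt)
                    (∧-intro (edges σ₁ y t Zσ₁ σ₁y σ₁t (t≢y ∘ sym)) (edges τ w t Zτ τw τt (t≢w ∘ sym)))

-- Chains over a field

_≟ₛ_ : (σ τ : Subset n) → Dec (σ ≡ τ)
_≟ₛ_ = Vecₚ.≡-dec _≟ᵇ_

_<ᵇ′_ : Fin n → Fin n → Bool
a <ᵇ′ b = does (a Fin.<? b)

below-∅ : (v : Fin n) → below v ∅ ≡ 0
below-∅ zero    = refl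
below-∅ (suc v) = below-∅ v

below-⊞-< : (τ : Subset n) {u v : Fin n} → u Fin.< v → lookup τ u ≡ false → below v (τ ⊞ u) ≡ suc (below v τ)
below-⊞-< (false ∷ τ) {zero}  {suc v} _ h = refl
below-⊞-< (b ∷ τ)     {suc u} {suc v} (s≤s p) h = trans (cong ((if b then 1 else 0) +_) (below-⊞-< τ p h)) (+-suc _ _)

below-⊞-≥ : (τ : Subset n) {u v : Fin n} → v Fin.≤ u → below v (τ ⊞ u) ≡ below v τ
below-⊞-≥ (b ∷ τ) {u}     {zero}  _ = refl
below-⊞-≥ (b ∷ τ) {suc u} {suc v} (s≤s p) = cong ((if b then 1 else 0) +_) (below-⊞-≥ τ p)

≢⇒<⊎> : {a b : Fin n} → a ≢ b → a Fin.< b ⊎ b Fin.< a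
≢⇒<⊎> {a = a} {b} a≢b with <-cmp (toℕ a) (toℕ b)
... | tri< p _ _ = inj₁ p
... | tri≈ _ p _ = ⊥-elim (a≢b (Finₚ.toℕ-injective p))
... | tri> _ _ p = inj₂ p

size-⁅⁆ : (x : Fin n) → ∣ ⁅ x ⁆ ∣ ≡ 1
size-⁅⁆ {n} x = trans (cong ∣_∣ (⁅⁆≡∅⊞ x)) (trans (size-⊞ ∅ x (∅-lookup x)) (cong suc (∅-size n)))

size≡1⇒⁅⁆ : (σ : Subset n) → ∣ σ ∣ ≡ 1 → ∃ λ x → σ ≡ ⁅ x ⁆
size≡1⇒⁅⁆ σ h with size≥1⇒∈ σ (≤-reflexive (sym h))
... | x , σx = x , trans (sym (⊟-⊞ σ x σx)) (trans (cong (_⊞ x) (size≡0⇒∅ (σ ⊟ x) (suc-injective (trans (size-⊟ σ x σx) h)))) (sym (⁅⁆≡∅⊞ x)))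

⁅⁆-injective : {x u : Fin n} → ⁅ x ⁆ ≡ ⁅ u ⁆ → x ≡ u
⁅⁆-injective {x = x} {u} h = ==⇒≡ (trans (sym (⁅⁆-lookup u x)) (trans (cong (λ σ → lookup σ x) (sym h)) (trans (⁅⁆-lookup x x) (==-refl x))))

record Two {n} (P : Fin n → Bool) : Set where
  field
    first second : Fin n
    distinct     : first ≢ second
    first∈       : P first ≡ true
    second∈      : P second ≡ true
    only         : ∀ x → P x ≡ true → x ≡ first ⊎ x ≡ second

trues : (Fin n → Bool) → List (Fin n)
trues {zero}  P = []
trues {suc n} P = if P zero then zero ∷ List.map suc (trues (P ∘ suc)) else List.map suc (trues (P ∘ suc))

length-trues : (P : Fin n → Bool) → length (trues P) ≡ # P
length-trues {zero}  P = refl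
length-trues {suc n} P with P zero
... | true  = cong suc (trans (Listₚ.length-map suc (trues (P ∘ suc))) (length-trues (P ∘ suc)))
... | false = trans (Listₚ.length-map suc (trues (P ∘ suc))) (length-trues (P ∘ suc))

∈-trues : (P : Fin n → Bool) (x : Fin n) → P x ≡ true → x ∈ trues P
∈-trues {suc n} P zero    h rewrite h = Any.here refl
∈-trues {suc n} P (suc x) h with P zero
... | true  = Any.there (∈-map⁺ suc (∈-trues (P ∘ suc) x h))
... | false = ∈-map⁺ suc (∈-trues (P ∘ suc) x h)

-- Fewer than #V - 1 edges do not connect V: identify the ends of one edge and recurse.
two-colouring : (k : ℕ) (ends : Fin k → Fin n × Fin n) (V : Fin n → Bool) → 2 + k ≤ # V →
  Σ (Fin n → Bool) λ D → (∀ j → D (proj₁ (ends j)) ≡ D (proj₂ (ends j))) ×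
    (∃ λ x → ∃ λ x′ → V x ≡ true × V x′ ≡ true × D x ≡ true × D x′ ≡ false)
two-colouring {n} zero ends V V≥2 with any? (λ x → V x ≟ᵇ true)
... | no none = ⊥-elim (<⇒≱ V≥2 (≤-trans (≤-reflexive (∑-zero λ i → cong ind (¬true⇒false λ h → none (i , h)))) z≤n))
... | yes (x , Vx) with any? (λ x′ → ¬? (x′ ≟ x) ×-dec (V x′ ≟ᵇ true))
...   | yes (x′ , x′≢x , Vx′) = (_== x) , (λ ()) , x , x′ , Vx , Vx′ , ==-refl x , ==-≢ x′≢x
...   | no none = ⊥-elim (<⇒≱ V≥2 (≤-trans (#-mono λ i Vi → is-x i Vi) (≤-reflexive (#-== x))))
  where
  is-x : ∀ i → V i ≡ true → (i == x) ≡ true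
  is-x i Vi with i ≟ x
  ... | yes _ = refl
  ... | no i≢x = ⊥-elim (none (i , i≢x , Vi))
two-colouring {n} (suc k) ends V V≥ = extend (two-colouring k (λ j → relabel (proj₁ (ends (suc j))) , relabel (proj₂ (ends (suc j)))) V′ V′≥)
  where
  a b : Fin n
  a = proj₁ (ends zero)
  b = proj₂ (ends zero)
  relabel : Fin n → Fin n
  relabel x = if x == a then b else x
  V′ : Fin n → Bool
  V′ x = V x ∧ not (x == a)
  V′≥ : 2 + k ≤ # V′
  V′≥ = s≤s⁻¹ (≤-trans V≥ (≤-trans (∑-mono bound) (≤-reflexive (trans (∑-+ (λ x → ind (x == a)) (ind ∘ V′)) (cong (_+ # V′) (#-== a))))))
    where
    bound : ∀ x → ind (V x) ≤ ind (x == a) + ind (V′ x)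
    bound x with V x | x == a
    ... | true  | true  = ≤-refl
    ... | true  | false = ≤-refl
    ... | false | _     = z≤n
  Colouring : ∀ {k} → (Fin k → Fin n × Fin n) → (Fin n → Bool) → Set
  Colouring ends V = Σ (Fin n → Bool) λ D → (∀ j → D (proj₁ (ends j)) ≡ D (proj₂ (ends j))) ×
    (∃ λ x → ∃ λ x′ → V x ≡ true × V x′ ≡ true × D x ≡ true × D x′ ≡ false)
  extend : Colouring (λ j → relabel (proj₁ (ends (suc j))) , relabel (proj₂ (ends (suc j)))) V′ → Colouring ends V
  extend (D , closed , x , x′ , Vx , Vx′ , Dx , Dx′) = D ∘ relabel , all-closed , x , x′ , proj₁ (∧-true Vx) , proj₁ (∧-true Vx′)
    , trans (cong D (fixed x Vx)) Dx , trans (cong D (fixed x′ Vx′)) Dx′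
    where
    fixed : ∀ x → V′ x ≡ true → relabel x ≡ x
    fixed x h rewrite not-true⁻¹ (proj₂ (∧-true {V x} h)) = refl
    relabel-a : relabel a ≡ b
    relabel-a rewrite ==-refl a = refl
    relabel-b : relabel b ≡ b
    relabel-b with b == a
    ... | true  = refl
    ... | false = refl
    all-closed : ∀ j → D (relabel (proj₁ (ends j))) ≡ D (relabel (proj₂ (ends j)))
    all-closed zero    = cong D (trans relabel-a (sym relabel-b))
    all-closed (suc j) = closed j

pair-≡ : (x y a b : Fin n) → x ≢ y → ∅ ⊞ x ⊞ y ≡ ∅ ⊞ a ⊞ b → (x ≡ a × y ≡ b) ⊎ (x ≡ b × y ≡ a)
pair-≡ x y a b x≢y h = resolve (member x (⊞-mono (∅ ⊞ x) y (∈-⊞ ∅ x))) (member y (∈-⊞ (∅ ⊞ x) y))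
  where
  member : ∀ z → lookup (∅ ⊞ x ⊞ y) z ≡ true → z ≡ a ⊎ z ≡ b
  member z p with ∨-true {z == b} (trans (sym (lookup-⊞ (∅ ⊞ a) b z)) (trans (cong (λ σ → lookup σ z) (sym h)) p))
  ... | inj₁ q = inj₂ (==⇒≡ q)
  ... | inj₂ q with ∨-true {z == a} (trans (sym (lookup-⊞ ∅ a z)) q)
  ...   | inj₁ r = inj₁ (==⇒≡ r)
  ...   | inj₂ r = ⊥-elim (true≢false r (∅-lookup z))
  resolve : x ≡ a ⊎ x ≡ b → y ≡ a ⊎ y ≡ b → (x ≡ a × y ≡ b) ⊎ (x ≡ b × y ≡ a)
  resolve (inj₁ p) (inj₁ q) = ⊥-elim (x≢y (trans p (sym q)))
  resolve (inj₁ p) (inj₂ q) = inj₁ (p , q)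
  resolve (inj₂ p) (inj₁ q) = inj₂ (p , q)
  resolve (inj₂ p) (inj₂ q) = ⊥-elim (x≢y (trans p (sym q)))

size-pair : (a b : Fin n) → a ≢ b → ∣ ∅ ⊞ a ⊞ b ∣ ≡ 2
size-pair {n} a b a≢b = trans (size-⊞ (∅ ⊞ a) b (trans (⊞-other ∅ (a≢b ∘ sym)) (∅-lookup b)))
  (cong suc (trans (size-⊞ ∅ a (∅-lookup a)) (cong suc (∅-size n))))

-- Without edge i there remain k - 1 edges, few enough for `two-colouring`. The colouring isolates
-- the coefficient of edge i in a cycle.
separating-colouring : ∀ {k} (ends : Fin k → Fin n × Fin n) (V : Fin n → Bool) → suc k ≤ # V → (i : Fin k) →
  Σ (Fin n → Bool) λ D → (∀ j → j ≢ i → D (proj₁ (ends j)) ≡ D (proj₂ (ends j))) ×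
    (∃ λ x → ∃ λ x′ → V x ≡ true × V x′ ≡ true × D x ≡ true × D x′ ≡ false)
separating-colouring {k = suc k} ends V V≥ i with two-colouring k (ends ∘ Fin.punchIn i) V V≥
... | D , closed , rest = D , (λ j j≢i → subst (λ j′ → D (proj₁ (ends j′)) ≡ D (proj₂ (ends j′)))
        (Finₚ.punchIn-punchOut (j≢i ∘ sym)) (closed (Fin.punchOut (j≢i ∘ sym)))) , rest

size≡2⇒pair : (σ : Subset n) → ∣ σ ∣ ≡ 2 → ∃ λ a → ∃ λ b → a Fin.< b × σ ≡ ∅ ⊞ a ⊞ b
size≡2⇒pair σ h with size≥1⇒∈ σ (≤-trans (s≤s z≤n) (≤-reflexive (sym h)))
... | x , σx with size≡1⇒⁅⁆ (σ ⊟ x) (suc-injective (trans (size-⊟ σ x σx) h))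
...   | y , p = order (≢⇒<⊎> {a = y} {x} λ { refl → true≢false (trans (cong (λ τ → lookup τ y) p) (trans (⁅⁆-lookup y y) (==-refl y))) (∉-⊟ σ y) })
  where
  σ≡ : σ ≡ ∅ ⊞ y ⊞ x
  σ≡ = trans (sym (⊟-⊞ σ x σx)) (cong (_⊞ x) (trans p (⁅⁆≡∅⊞ y)))
  order : y Fin.< x ⊎ x Fin.< y → ∃ λ a → ∃ λ b → a Fin.< b × σ ≡ ∅ ⊞ a ⊞ b
  order (inj₁ y<x) = y , x , y<x , σ≡
  order (inj₂ x<y) = x , y , x<y , trans σ≡ (⊞-comm ∅ y x)

module FieldChains {c ℓ} (K : Field c ℓ) where

  open Field K
    using (Carrier; _≈_; 0#; 1#; 0≉1; ring; semiring; setoid; *-cong; -‿cong; zeroˡ; zeroʳ; -‿inverseʳ)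
    renaming (_+_ to _⊕_; _*_ to _⊛_; -_ to ⊖_; refl to ≈-refl; sym to ≈-sym; trans to ≈-trans; reflexive to ≈-reflexive;
      +-cong to ⊕-cong; +-identityˡ to ⊕-identityˡ; +-identityʳ to ⊕-identityʳ; +-assoc to ⊕-assoc; +-comm to ⊕-comm;
      *-identityˡ to ⊛-identityˡ; *-identityʳ to ⊛-identityʳ; *-comm to ⊛-comm; *-assoc to ⊛-assoc)
  open Homology K
  open RingProperties ring using (-0#≈0#; -‿involutive; -‿+-comm; -‿distribʳ-*; x∙y⁻¹≈ε⇒x≈y; -1*x≈-x; x[y-z]≈xy-xz)
  open SemiringSum semiring using (sum; sum-cong-≋; ∑-distrib-+; *-distribˡ-sum; sum-replicate-zero)
  import Relation.Binary.Reasoning.Setoid as SetoidReasoning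

  Chain : ℕ → Set c
  Chain n = Subset n → Carrier

  Σᶠ≡sum : ∀ {m} (g : Fin m → Carrier) → Σᶠ g ≡ sum g
  Σᶠ≡sum g = over-tabulate id
    where
    over-tabulate : ∀ {k} (f : Fin k → Fin _) → foldr (λ i acc → g i ⊕ acc) 0# (List.tabulate f) ≡ sum (g ∘ f)
    over-tabulate {zero}  f = refl
    over-tabulate {suc k} f = cong (g (f zero) ⊕_) (over-tabulate (f ∘ suc))

  sum-zero : ∀ {m} {f : Fin m → Carrier} → (∀ i → f i ≈ 0#) → sum f ≈ 0#
  sum-zero {m} h = ≈-trans (sum-cong-≋ h) (sum-replicate-zero m)

  sum-single : ∀ {m} {f : Fin m → Carrier} (i : Fin m) → (∀ j → j ≢ i → f j ≈ 0#) → sum f ≈ f i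
  sum-single {suc m} zero h = ≈-trans (⊕-cong ≈-refl (sum-zero (λ j → h (suc j) λ ()))) (⊕-identityʳ _)
  sum-single {suc m} (suc i) h = ≈-trans (⊕-cong (h zero λ ()) (sum-single i λ j j≢i → h (suc j) (j≢i ∘ Finₚ.suc-injective))) (⊕-identityˡ _)

  sum-neg : ∀ {m} (f : Fin m → Carrier) → sum (λ i → ⊖ f i) ≈ ⊖ sum f
  sum-neg {zero}  f = ≈-sym -0#≈0#
  sum-neg {suc m} f = ≈-trans (⊕-cong ≈-refl (sum-neg (f ∘ suc))) (-‿+-comm (f zero) (sum (f ∘ suc)))

  -- The diagonal is a separate hypothesis because antisymmetry does not make it vanish in
  -- characteristic 2.
  sum-antisymmetric : ∀ {m} (g : Fin m → Fin m → Carrier) → (∀ a b → a ≢ b → g a b ≈ ⊖ g b a) → (∀ a → g a a ≈ 0#) →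
    sum (λ a → sum (g a)) ≈ 0#
  sum-antisymmetric {zero}  g s d = ≈-refl
  sum-antisymmetric {suc m} g s d = begin
    (g zero zero ⊕ row) ⊕ sum (λ a → g (suc a) zero ⊕ sum (λ b → g (suc a) (suc b)))
      ≈⟨ ⊕-cong (≈-trans (⊕-cong (d zero) ≈-refl) (⊕-identityˡ row)) (∑-distrib-+ (λ a → g (suc a) zero) (λ a → sum (λ b → g (suc a) (suc b)))) ⟩
    row ⊕ (sum (λ a → g (suc a) zero) ⊕ sum (λ a → sum (λ b → g (suc a) (suc b))))
      ≈⟨ ⊕-cong ≈-refl (⊕-cong (≈-trans (sum-cong-≋ (λ a → s (suc a) zero λ ())) (sum-neg (λ b → g zero (suc b))))
           (sum-antisymmetric (λ a b → g (suc a) (suc b)) (λ a b a≢b → s (suc a) (suc b) (a≢b ∘ Finₚ.suc-injective)) (d ∘ suc))) ⟩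
    row ⊕ (⊖ row ⊕ 0#)
      ≈⟨ ⊕-cong ≈-refl (⊕-identityʳ (⊖ row)) ⟩
    row ⊕ ⊖ row
      ≈⟨ -‿inverseʳ row ⟩
    0# ∎
    where
    open SetoidReasoning setoid
    row = sum (λ b → g zero (suc b))

  signed : Bool → Carrier → Carrier
  signed b x = if b then x else ⊖ x

  signed-cong : ∀ b {x y} → x ≈ y → signed b x ≈ signed b y
  signed-cong true  h = h
  signed-cong false h = -‿cong h

  signed-0 : ∀ b → signed b 0# ≈ 0#
  signed-0 true  = ≈-refl
  signed-0 false = -0#≈0#

  signed-sum : ∀ {m} b (f : Fin m → Carrier) → signed b (sum f) ≈ sum (λ i → signed b (f i))
  signed-sum true  f = ≈-refl
  signed-sum false f = ≈-sym (sum-neg f)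

  signed-swap : ∀ a b x → signed a (signed (not b) x) ≈ ⊖ signed b (signed a x)
  signed-swap true  true  x = ≈-refl
  signed-swap true  false x = ≈-sym (-‿involutive x)
  signed-swap false true  x = ≈-refl
  signed-swap false false x = -‿cong (≈-sym (-‿involutive x))

  bd : ∀ {n} → Chain n → Subset n → Fin n → Carrier
  bd x τ v = if lookup τ v then 0# else signed (even (below v τ)) (x (τ ⊞ v))

  bd-∈ : ∀ {n} (x : Chain n) (τ : Subset n) v → lookup τ v ≡ true → bd x τ v ≈ 0#
  bd-∈ x τ v h rewrite h = ≈-refl

  bd-∉ : ∀ {n} (x : Chain n) (τ : Subset n) v → lookup τ v ≡ false → bd x τ v ≡ signed (even (below v τ)) (x (τ ⊞ v))
  bd-∉ x τ v h rewrite h = refl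

  ∂≈ : ∀ {n} (x : Chain n) τ → ∂ x τ ≈ sum (bd x τ)
  ∂≈ x τ = ≈-trans (≈-reflexive (Σᶠ≡sum (λ v → if lookup τ v then 0# else (if even (below v τ) then x (τ ∪ ⁅ v ⁆) else ⊖ x (τ ∪ ⁅ v ⁆))))) (sum-cong-≋ λ v → ≈-reflexive
    (cong (λ σ → if lookup τ v then 0# else (if even (below v τ) then x σ else ⊖ x σ)) (∪⁅⁆ τ v)))

  bd-zero : ∀ {n} (x : Chain n) τ v → x (τ ⊞ v) ≈ 0# → bd x τ v ≈ 0#
  bd-zero x τ v h with lookup τ v
  ... | true  = ≈-refl
  ... | false = ≈-trans (signed-cong (even (below v τ)) h) (signed-0 (even (below v τ)))

  ∂-cong : ∀ {n} {x x′ : Chain n} → (∀ σ → x σ ≈ x′ σ) → ∀ τ → ∂ x τ ≈ ∂ x′ τ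
  ∂-cong {x = x} {x′} h τ = ≈-trans (∂≈ x τ) (≈-trans (sum-cong-≋ pointwise) (≈-sym (∂≈ x′ τ)))
    where
    pointwise : ∀ v → bd x τ v ≈ bd x′ τ v
    pointwise v with lookup τ v
    ... | true  = ≈-refl
    ... | false = signed-cong (even (below v τ)) (h (τ ⊞ v))

  ∂-zero : ∀ {n} {x : Chain n} → (∀ σ → x σ ≈ 0#) → ∀ τ → ∂ x τ ≈ 0#
  ∂-zero {x = x} h τ = ≈-trans (∂≈ x τ) (sum-zero λ v → bd-zero x τ v (h (τ ⊞ v)))

  ∂-+ : ∀ {n} (x x′ : Chain n) τ → ∂ (λ σ → x σ ⊕ x′ σ) τ ≈ ∂ x τ ⊕ ∂ x′ τ
  ∂-+ x x′ τ = ≈-trans (∂≈ (λ σ → x σ ⊕ x′ σ) τ) (≈-trans (sum-cong-≋ pointwise)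
    (≈-trans (∑-distrib-+ (bd x τ) (bd x′ τ)) (⊕-cong (≈-sym (∂≈ x τ)) (≈-sym (∂≈ x′ τ)))))
    where
    pointwise : ∀ v → bd (λ σ → x σ ⊕ x′ σ) τ v ≈ bd x τ v ⊕ bd x′ τ v
    pointwise v with lookup τ v | even (below v τ)
    ... | true  | _     = ≈-sym (⊕-identityˡ 0#)
    ... | false | true  = ≈-refl
    ... | false | false = ≈-sym (-‿+-comm (x (τ ⊞ v)) (x′ (τ ⊞ v)))

  ∂-* : ∀ {n} k (x : Chain n) τ → ∂ (λ σ → k ⊛ x σ) τ ≈ k ⊛ ∂ x τ
  ∂-* k x τ = ≈-trans (∂≈ (λ σ → k ⊛ x σ) τ) (≈-trans (sum-cong-≋ pointwise)
    (≈-trans (≈-sym (*-distribˡ-sum k (bd x τ))) (*-cong ≈-refl (≈-sym (∂≈ x τ)))))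
    where
    pointwise : ∀ v → bd (λ σ → k ⊛ x σ) τ v ≈ k ⊛ bd x τ v
    pointwise v with lookup τ v | even (below v τ)
    ... | true  | _     = ≈-sym (zeroʳ k)
    ... | false | true  = ≈-refl
    ... | false | false = -‿distribʳ-* k (x (τ ⊞ v))

  -- The contribution to ∂∂ of first adding u to τ and then v.
  bd² : ∀ {n} → Chain n → Subset n → Fin n → Fin n → Carrier
  bd² x τ u v = if lookup τ u then 0# else signed (even (below u τ)) (bd x (τ ⊞ u) v)

  bd²-diagonal : ∀ {n} (x : Chain n) τ u → bd² x τ u u ≈ 0#
  bd²-diagonal x τ u with lookup τ u
  ... | true  = ≈-refl
  ... | false = ≈-trans (signed-cong (even (below u τ)) (bd-∈ x (τ ⊞ u) u (∈-⊞ τ u))) (signed-0 (even (below u τ)))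

  -- Adding the smaller vertex first raises the position of the larger one by one, while adding the
  -- larger first does not move the smaller; the two signs therefore differ.
  bd²-ordered : ∀ {n} (x : Chain n) τ u v → u Fin.< v → bd² x τ u v ≈ ⊖ bd² x τ v u
  bd²-ordered x τ u v u<v rewrite ⊞-other τ {u} {v} (λ { refl → <-irrefl refl u<v }) | ⊞-other τ {v} {u} (λ { refl → <-irrefl refl u<v })
    with lookup τ u in τu | lookup τ v in τv
  ... | true  | true  = ≈-sym -0#≈0#
  ... | true  | false = ≈-sym (≈-trans (-‿cong (signed-0 (even (below v τ)))) -0#≈0#)
  ... | false | true  = ≈-trans (signed-0 (even (below u τ))) (≈-sym -0#≈0#)
  ... | false | false rewrite below-⊞-< τ u<v τu | below-⊞-≥ τ (<⇒≤ u<v) | ⊞-comm τ u v =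
    signed-swap (even (below u τ)) (even (below v τ)) (x (τ ⊞ v ⊞ u))

  bd²-antisym : ∀ {n} (x : Chain n) τ u v → u ≢ v → bd² x τ u v ≈ ⊖ bd² x τ v u
  bd²-antisym x τ u v u≢v with ≢⇒<⊎> u≢v
  ... | inj₁ u<v = bd²-ordered x τ u v u<v
  ... | inj₂ v<u = ≈-trans (≈-sym (-‿involutive _)) (-‿cong (≈-sym (bd²-ordered x τ v u v<u)))

  ∂∂≈0 : ∀ {n} (x : Chain n) τ → ∂ (∂ x) τ ≈ 0#
  ∂∂≈0 {n} x τ = ≈-trans (∂≈ (∂ x) τ) (≈-trans (sum-cong-≋ pointwise)
    (sum-antisymmetric (bd² x τ) (bd²-antisym x τ) (bd²-diagonal x τ)))
    where
    pointwise : ∀ u → bd (∂ x) τ u ≈ sum (bd² x τ u)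
    pointwise u with lookup τ u
    ... | true  = ≈-sym (sum-replicate-zero n)
    ... | false = ≈-trans (signed-cong (even (below u τ)) (∂≈ x (τ ⊞ u))) (signed-sum (even (below u τ)) (bd x (τ ⊞ u)))

  -- Cuts and reduced homology in degree 0

  δ : Bool → Carrier
  δ b = if b then 1# else 0#

  -- The pairing of the boundary of z with the indicator of D, that is, the net flow of z into D. It
  -- sees the edges with ends on different sides of D.
  cut : ∀ {n} → (Fin n → Bool) → Chain n → Carrier
  cut D z = sum (λ x → δ (D x) ⊛ ∂ z ⁅ x ⁆)

  ∂-vertex : ∀ {n} (z : Chain n) x → ∂ z ⁅ x ⁆ ≈ sum (bd² z ∅ x)
  ∂-vertex z x = ≈-trans (≈-reflexive (cong (∂ z) (⁅⁆≡∅⊞ x))) (≈-trans (∂≈ z (∅ ⊞ x)) (sum-cong-≋ pointwise))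
    where
    pointwise : ∀ v → bd z (∅ ⊞ x) v ≈ bd² z ∅ x v
    pointwise v rewrite ∅-lookup x | below-∅ x = ≈-refl

  cut-cong : ∀ {n} (D : Fin n → Bool) {z z′ : Chain n} → (∀ x → ∂ z ⁅ x ⁆ ≈ ∂ z′ ⁅ x ⁆) → cut D z ≈ cut D z′
  cut-cong D h = sum-cong-≋ λ x → *-cong ≈-refl (h x)

  cut-zero : ∀ {n} (D : Fin n → Bool) {z : Chain n} → (∀ x → ∂ z ⁅ x ⁆ ≈ 0#) → cut D z ≈ 0#
  cut-zero D h = sum-zero λ x → ≈-trans (*-cong ≈-refl (h x)) (zeroʳ _)

  -- Edges with both ends in D contribute opposite terms at their two ends, and edges leaving D are
  -- absent from z.
  cut-uncrossed : ∀ {n} (D : Fin n → Bool) (z : Chain n) → (∀ a b → a ≢ b → D a ≢ D b → z (∅ ⊞ a ⊞ b) ≈ 0#) → cut D z ≈ 0#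
  cut-uncrossed D z h = ≈-trans (sum-cong-≋ rows) (sum-antisymmetric k k-antisym k-diag)
    where
    k : _ → _ → Carrier
    k a b = δ (D a ∧ D b) ⊛ bd² z ∅ a b
    k-diag : ∀ a → k a a ≈ 0#
    k-diag a = ≈-trans (*-cong ≈-refl (bd²-diagonal z ∅ a)) (zeroʳ _)
    k-antisym : ∀ a b → a ≢ b → k a b ≈ ⊖ k b a
    k-antisym a b a≢b = ≈-trans (*-cong (≈-reflexive (cong δ (∧-comm (D a) (D b)))) (bd²-antisym z ∅ a b a≢b))
      (≈-sym (-‿distribʳ-* (δ (D b ∧ D a)) (bd² z ∅ b a)))
    bd²-uncrossed : ∀ a b → D a ≢ D b → bd² z ∅ a b ≈ 0#
    bd²-uncrossed a b Da≢Db rewrite ∅-lookup a =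
      ≈-trans (signed-cong (even (below a ∅)) (bd-zero z (∅ ⊞ a) b (h a b (λ { refl → Da≢Db refl }) Da≢Db))) (signed-0 (even (below a ∅)))
    entry : ∀ a b → δ (D a) ⊛ bd² z ∅ a b ≈ k a b
    entry a b with D a in Da | D b in Db
    ... | true  | true  = ≈-refl
    ... | false | _     = ≈-refl
    ... | true  | false = ≈-trans (*-cong ≈-refl zero-entry) (≈-trans (zeroʳ _) (≈-sym (zeroˡ _)))
      where
      zero-entry : bd² z ∅ a b ≈ 0#
      zero-entry = bd²-uncrossed a b λ p → true≢false (trans (sym p) Da) Db
    rows : ∀ a → δ (D a) ⊛ ∂ z ⁅ a ⁆ ≈ sum (k a)
    rows a = ≈-trans (*-cong ≈-refl (∂-vertex z a)) (≈-trans (*-distribˡ-sum (δ (D a)) (bd² z ∅ a)) (sum-cong-≋ (entry a)))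

  point : ∀ {n} → Fin n → Chain n
  point u σ = δ (does (σ ≟ₛ ⁅ u ⁆))

  point-⁅⁆ : ∀ {n} (u x : Fin n) → point u ⁅ x ⁆ ≡ δ (x == u)
  point-⁅⁆ u x = cong δ (⇔⇒≡ (λ h → trans (cong (_== u) (⁅⁆-injective (does-true (⁅ x ⁆ ≟ₛ ⁅ u ⁆) h))) (==-refl u))
    (λ h → dec-true (⁅ x ⁆ ≟ₛ ⁅ u ⁆) (cong ⁅_⁆ (==⇒≡ h))))

  point-≢ : ∀ {n} (u : Fin n) (σ : Subset n) → σ ≢ ⁅ u ⁆ → point u σ ≡ 0#
  point-≢ u σ h = cong δ (dec-false (σ ≟ₛ ⁅ u ⁆) h)

  sum-δ : ∀ {n} (D : Fin n → Carrier) (u : Fin n) → sum (λ x → D x ⊛ δ (x == u)) ≈ D u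
  sum-δ D u = ≈-trans (sum-single u λ x x≢u → ≈-trans (*-cong ≈-refl (≈-reflexive (cong δ (==-≢ x≢u)))) (zeroʳ (D x)))
    (≈-trans (*-cong ≈-refl (≈-reflexive (cong δ (==-refl u)))) (⊛-identityʳ (D u)))

  diff : ∀ {n} → Fin n → Fin n → Chain n
  diff u v σ = point u σ ⊕ ⊖ point v σ

  x-x : ∀ {x y} → x ≈ y → x ⊕ ⊖ y ≈ 0#
  x-x {x} {y} h = ≈-trans (⊕-cong h ≈-refl) (-‿inverseʳ y)

  x-0 : ∀ {x y} → y ≈ 0# → x ⊕ ⊖ y ≈ x
  x-0 h = ≈-trans (⊕-cong ≈-refl (≈-trans (-‿cong h) -0#≈0#)) (⊕-identityʳ _)

  bd-∅ : ∀ {n} (z : Chain n) v → bd z ∅ v ≈ z ⁅ v ⁆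
  bd-∅ z v rewrite ∅-lookup v | below-∅ v = ≈-reflexive (cong z (sym (⁅⁆≡∅⊞ v)))

  sum-point : ∀ {n} (u : Fin n) → sum (λ v → point u ⁅ v ⁆) ≈ 1#
  sum-point u = ≈-trans (sum-single u λ v v≢u → ≈-reflexive (trans (point-⁅⁆ u v) (cong δ (==-≢ v≢u))))
    (≈-reflexive (trans (point-⁅⁆ u u) (cong δ (==-refl u))))

  diff-cycle : ∀ {n} (F : Subset n → Bool) (u v : Fin n) → F ⁅ u ⁆ ≡ true → F ⁅ v ⁆ ≡ true → IsCycle F 1 (diff u v)
  diff-cycle {n} F u v Fu Fv = chain , closed
    where
    off : ∀ x σ → F ⁅ x ⁆ ≡ true → (F σ ≡ false ⊎ ¬ (∣ σ ∣ ≡ 1)) → point x σ ≡ 0#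
    off x σ Fx (inj₁ p) = point-≢ x σ λ { refl → true≢false Fx p }
    off x σ Fx (inj₂ p) = point-≢ x σ λ { refl → p (size-⁅⁆ x) }
    chain : IsChain F 1 (diff u v)
    chain σ h = x-x (≈-reflexive (trans (off u σ Fu h) (sym (off v σ Fv h))))
    closed : ∀ τ → ∂ (diff u v) τ ≈ 0#
    closed τ with ∣ τ ∣ ≟ₙ 0
    ... | no ≢0 = ≈-trans (∂≈ (diff u v) τ) (sum-zero term)
      where
      big : ∀ x t → lookup τ t ≡ false → point x (τ ⊞ t) ≡ 0#
      big x t τt = point-≢ x (τ ⊞ t) λ p → ≢0 (suc-injective (trans (sym (size-⊞ τ t τt)) (trans (cong ∣_∣ p) (size-⁅⁆ x))))
      term : ∀ t → bd (diff u v) τ t ≈ 0#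
      term t with lookup τ t in τt
      ... | true  = ≈-refl
      ... | false = ≈-trans (signed-cong (even (below t τ)) (x-x (≈-reflexive (trans (big u t τt) (sym (big v t τt))))))
                            (signed-0 (even (below t τ)))
    ... | yes ≡0 = ≈-trans (≈-reflexive (cong (∂ (diff u v)) (size≡0⇒∅ τ ≡0))) (≈-trans (∂≈ (diff u v) ∅)
        (≈-trans (sum-cong-≋ (bd-∅ (diff u v))) (≈-trans (∑-distrib-+ (λ x → point u ⁅ x ⁆) (λ x → ⊖ point v ⁅ x ⁆))
          (≈-trans (⊕-cong (sum-point u) (≈-trans (sum-neg (λ x → point v ⁅ x ⁆)) (-‿cong (sum-point v)))) (-‿inverseʳ 1#)))))

  δ-injective : ∀ a b → δ a ⊕ ⊖ δ b ≈ 0# → a ≡ b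
  δ-injective a b h = lemma a b (x∙y⁻¹≈ε⇒x≈y (δ a) (δ b) h)
    where
    lemma : ∀ a b → δ a ≈ δ b → a ≡ b
    lemma true  true  _ = refl
    lemma true  false h = ⊥-elim (0≉1 (≈-sym h))
    lemma false true  h = ⊥-elim (0≉1 h)
    lemma false false _ = refl

  -- The difference of the points u and v bounds a chain w. The cut of w by D is δ (D u) minus δ (D
  -- v), and it vanishes because no edge of the complex crosses D.
  connected-of-homology : ∀ {n} (F : Subset n → Bool) → HasBetti F 1 0 → (D : Fin n → Bool) →
    (∀ a b → a ≢ b → F (∅ ⊞ a ⊞ b) ≡ true → D a ≡ D b) → ∀ u v → F ⁅ u ⁆ ≡ true → F ⁅ v ⁆ ≡ true → D u ≡ D v
  connected-of-homology F (_ , _ , _ , generates) D uncrossed u v Fu Fv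
    with generates (diff u v) (diff-cycle F u v Fu Fv)
  ... | _ , w , w-chain , ∂w = δ-injective (D u) (D v) (≈-trans (≈-sym total) (cut-uncrossed D w none))
    where
    none : ∀ a b → a ≢ b → D a ≢ D b → w (∅ ⊞ a ⊞ b) ≈ 0#
    none a b a≢b Da≢Db = w-chain (∅ ⊞ a ⊞ b) (inj₁ (¬true⇒false λ p → Da≢Db (uncrossed a b a≢b p)))
    term : ∀ x → δ (D x) ⊛ ∂ w ⁅ x ⁆ ≈ δ (D x) ⊛ δ (x == u) ⊕ ⊖ (δ (D x) ⊛ δ (x == v))
    term x = ≈-trans (*-cong ≈-refl (≈-trans (∂w ⁅ x ⁆) (≈-trans (x-0 ≈-refl)
        (≈-reflexive (cong₂ (λ p q → p ⊕ ⊖ q) (point-⁅⁆ u x) (point-⁅⁆ v x))))))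
      (x[y-z]≈xy-xz (δ (D x)) (δ (x == u)) (δ (x == v)))
    total : cut D w ≈ δ (D u) ⊕ ⊖ δ (D v)
    total = ≈-trans (sum-cong-≋ term) (≈-trans (∑-distrib-+ (λ x → δ (D x) ⊛ δ (x == u)) (λ x → ⊖ (δ (D x) ⊛ δ (x == v))))
      (⊕-cong (sum-δ (δ ∘ D) u) (≈-trans (sum-neg (λ x → δ (D x) ⊛ δ (x == v))) (-‿cong (sum-δ (δ ∘ D) v)))))

  -- Without edges there are no boundaries, so the cycles themselves form a line. With at most one
  -- vertex the augmentation leaves the zero cycle alone, and three vertices would give two
  -- independent differences.
  two-points-of-homology : ∀ {n} (F : Subset n → Bool) → HasBetti F 1 1 → (∀ σ → ∣ σ ∣ ≡ 2 → F σ ≡ false) →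
    Two (λ x → F ⁅ x ⁆)
  two-points-of-homology {n} F (z , z-cycle , independent , generates) no-edges = search
    where
    z₀ : Chain n
    z₀ = z zero
    z₀-chain = proj₁ (z-cycle zero)
    nonzero : ¬ (∀ σ → z₀ σ ≈ 0#)
    nonzero h = 0≉1 (≈-sym (independent (λ _ → 1#) ((λ _ → 0#) , (λ _ _ → ≈-refl) , λ τ →
      ≈-trans (∂-zero (λ _ → ≈-refl) τ) (≈-sym (≈-trans (⊕-identityʳ _) (≈-trans (*-cong ≈-refl (h τ)) (zeroʳ 1#))))) zero))
    multiple : ∀ y → IsCycle F 1 y → ∃ λ a → ∀ σ → y σ ≈ a ⊛ z₀ σ
    multiple y cyc with generates y cyc
    ... | a , w , w-chain , ∂w = a zero , λ σ → x∙y⁻¹≈ε⇒x≈y (y σ) (a zero ⊛ z₀ σ)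
          (≈-trans (⊕-cong ≈-refl (-‿cong (≈-sym (⊕-identityʳ _)))) (≈-trans (≈-sym (∂w σ)) (∂-zero w≈0 σ)))
      where
      w≈0 : ∀ σ → w σ ≈ 0#
      w≈0 σ with ∣ σ ∣ ≟ₙ 2
      ... | yes p = w-chain σ (inj₁ (no-edges σ p))
      ... | no ¬p = w-chain σ (inj₂ ¬p)
    all-zero : (∀ x → F ⁅ x ⁆ ≡ true → z₀ ⁅ x ⁆ ≈ 0#) → ∀ σ → z₀ σ ≈ 0#
    all-zero h σ with ∣ σ ∣ ≟ₙ 1
    ... | no ¬p = z₀-chain σ (inj₂ ¬p)
    ... | yes p with size≡1⇒⁅⁆ σ p
    ...   | x , refl with F ⁅ x ⁆ in Fx
    ...     | true  = h x Fx
    ...     | false = z₀-chain ⁅ x ⁆ (inj₁ Fx)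
    three : ∀ x₁ x₂ x₃ → x₁ ≢ x₂ → x₁ ≢ x₃ → x₂ ≢ x₃ → F ⁅ x₁ ⁆ ≡ true → F ⁅ x₂ ⁆ ≡ true → F ⁅ x₃ ⁆ ≡ true → ⊥
    three x₁ x₂ x₃ ≢₁₂ ≢₁₃ ≢₂₃ F₁ F₂ F₃
      with multiple (diff x₂ x₁) (diff-cycle F x₂ x₁ F₂ F₁) | multiple (diff x₃ x₁) (diff-cycle F x₃ x₁ F₃ F₁)
    -- Two multiples of z₀, evaluated at x₂ and x₃, have determinant 0; for the two differences of
    -- points this determinant is 1.
    ... | a , ha | b , hb = 0≉1 (begin
      0#                              ≈⟨ ≈-sym (zeroˡ _) ⟩
      0# ⊛ (b ⊛ z₀ ⁅ x₂ ⁆)            ≈⟨ *-cong (≈-sym (≈-trans (≈-sym (ha ⁅ x₃ ⁆)) (value x₂ x₃ (≢₂₃ ∘ sym) (≢₁₃ ∘ sym)))) ≈-refl ⟩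
      (a ⊛ z₀ ⁅ x₃ ⁆) ⊛ (b ⊛ z₀ ⁅ x₂ ⁆) ≈⟨ interchange a (z₀ ⁅ x₃ ⁆) b (z₀ ⁅ x₂ ⁆) ⟩
      (a ⊛ z₀ ⁅ x₂ ⁆) ⊛ (b ⊛ z₀ ⁅ x₃ ⁆) ≈⟨ *-cong (≈-trans (≈-sym (ha ⁅ x₂ ⁆)) (own x₂ ≢₁₂)) (≈-trans (≈-sym (hb ⁅ x₃ ⁆)) (own x₃ ≢₁₃)) ⟩
      1# ⊛ 1#                         ≈⟨ ⊛-identityˡ 1# ⟩
      1#                              ∎)
      where
      open import Relation.Binary.Reasoning.Setoid setoid
      interchange : ∀ p q r s → (p ⊛ q) ⊛ (r ⊛ s) ≈ (p ⊛ s) ⊛ (r ⊛ q)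
      interchange p q r s = begin
        (p ⊛ q) ⊛ (r ⊛ s) ≈⟨ ⊛-assoc p q (r ⊛ s) ⟩
        p ⊛ (q ⊛ (r ⊛ s)) ≈⟨ *-cong ≈-refl (≈-trans (⊛-comm q (r ⊛ s)) (≈-trans (*-cong (⊛-comm r s) ≈-refl) (⊛-assoc s r q))) ⟩
        p ⊛ (s ⊛ (r ⊛ q)) ≈⟨ ≈-sym (⊛-assoc p s (r ⊛ q)) ⟩
        (p ⊛ s) ⊛ (r ⊛ q) ∎
      value : ∀ x t → t ≢ x → t ≢ x₁ → diff x x₁ ⁅ t ⁆ ≈ 0#
      value x t t≢x t≢x₁ = x-x (≈-reflexive (trans (trans (point-⁅⁆ x t) (cong δ (==-≢ t≢x))) (sym (trans (point-⁅⁆ x₁ t) (cong δ (==-≢ t≢x₁))))))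
      own : ∀ x → x₁ ≢ x → diff x x₁ ⁅ x ⁆ ≈ 1#
      own x x₁≢x = ≈-trans (x-0 (≈-reflexive (trans (point-⁅⁆ x₁ x) (cong δ (==-≢ (x₁≢x ∘ sym))))))
        (≈-reflexive (trans (point-⁅⁆ x x) (cong δ (==-refl x))))
    search : Two (λ x → F ⁅ x ⁆)
    search with any? (λ x → F ⁅ x ⁆ ≟ᵇ true)
    ... | no none = ⊥-elim (nonzero (all-zero λ x Fx → ⊥-elim (none (x , Fx))))
    ... | yes (x₁ , F₁) with any? (λ x → ¬? (x ≟ x₁) ×-dec (F ⁅ x ⁆ ≟ᵇ true))
    ...   | no none = ⊥-elim (nonzero (all-zero λ x Fx → single x Fx (x ≟ x₁)))
      where
      single : ∀ x → F ⁅ x ⁆ ≡ true → Dec (x ≡ x₁) → z₀ ⁅ x ⁆ ≈ 0#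
      single x Fx (no x≢x₁) = ⊥-elim (none (x , x≢x₁ , Fx))
      single x Fx (yes refl) = ≈-trans (≈-sym (≈-trans (∂≈ z₀ ∅) (≈-trans (sum-cong-≋ (bd-∅ z₀))
        (sum-single x λ t t≢x → z₀-chain ⁅ t ⁆ (inj₁ (¬true⇒false λ Ft → none (t , t≢x , Ft))))))) (proj₂ (z-cycle zero) ∅)
    ...   | yes (x₂ , x₂≢x₁ , F₂) with any? (λ x → ¬? (x ≟ x₁) ×-dec (¬? (x ≟ x₂) ×-dec (F ⁅ x ⁆ ≟ᵇ true)))
    ...     | yes (x₃ , x₃≢x₁ , x₃≢x₂ , F₃) = ⊥-elim (three x₁ x₂ x₃ (x₂≢x₁ ∘ sym) (x₃≢x₁ ∘ sym) (x₃≢x₂ ∘ sym) F₁ F₂ F₃)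
    ...     | no none = record { first = x₁ ; second = x₂ ; distinct = x₂≢x₁ ∘ sym ; first∈ = F₁ ; second∈ = F₂ ; only = only }
      where
      only : ∀ x → F ⁅ x ⁆ ≡ true → x ≡ x₁ ⊎ x ≡ x₂
      only x Fx with x ≟ x₁ | x ≟ x₂
      ... | yes p | _     = inj₁ p
      ... | no _  | yes p = inj₂ p
      ... | no p  | no q  = ⊥-elim (none (x , p , q , Fx))

  -- Oriented edges and boundaries of triangles

  edge : ∀ {n} → Fin n → Fin n → Chain n
  edge a b σ = signed (a <ᵇ′ b) (δ (does (σ ≟ₛ (∅ ⊞ a ⊞ b))))

  <ᵇ′-true : ∀ {n} {a b : Fin n} → a Fin.< b → (a <ᵇ′ b) ≡ true
  <ᵇ′-true {a = a} {b} p = dec-true (a Fin.<? b) p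

  <ᵇ′-false : ∀ {n} {a b : Fin n} → b Fin.≤ a → (a <ᵇ′ b) ≡ false
  <ᵇ′-false {a = a} {b} p = dec-false (a Fin.<? b) (≤⇒≯ p)

  edge-≢ : ∀ {n} (a b : Fin n) (σ : Subset n) → σ ≢ ∅ ⊞ a ⊞ b → edge a b σ ≈ 0#
  edge-≢ a b σ h = ≈-trans (signed-cong (a <ᵇ′ b) (≈-reflexive (cong δ (dec-false (σ ≟ₛ (∅ ⊞ a ⊞ b)) h)))) (signed-0 (a <ᵇ′ b))

  edge-self : ∀ {n} (a b : Fin n) → edge a b (∅ ⊞ a ⊞ b) ≡ signed (a <ᵇ′ b) 1#
  edge-self a b = cong (λ q → signed (a <ᵇ′ b) (δ q)) (dec-true ((∅ ⊞ a ⊞ b) ≟ₛ (∅ ⊞ a ⊞ b)) refl)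

  edge-flip : ∀ {n} (a b : Fin n) → a ≢ b → ∀ σ → edge b a σ ≈ ⊖ edge a b σ
  edge-flip a b a≢b σ with ≢⇒<⊎> a≢b
  ... | inj₁ a<b rewrite <ᵇ′-true a<b | <ᵇ′-false (<⇒≤ a<b) = -‿cong (≈-reflexive (cong (λ κ → δ (does (σ ≟ₛ κ))) (⊞-comm ∅ b a)))
  ... | inj₂ b<a rewrite <ᵇ′-true b<a | <ᵇ′-false (<⇒≤ b<a) =
    ≈-trans (≈-reflexive (cong (λ κ → δ (does (σ ≟ₛ κ))) (⊞-comm ∅ b a))) (≈-sym (-‿involutive _))

  bd²-edge : ∀ {n} (a b x y : Fin n) → bd² (edge a b) ∅ x y ≈ δ (x == b) ⊛ δ (y == a) ⊕ ⊖ (δ (x == a) ⊛ δ (y == b))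
  bd²-edge {n} a b x y = by-cases (x ≟ y)
    where
    other : x ≢ y → ∅ ⊞ x ⊞ y ≢ ∅ ⊞ a ⊞ b → bd² (edge a b) ∅ x y ≈ 0#
    other x≢y h rewrite ∅-lookup x = ≈-trans (signed-cong (even (below x ∅)) (bd-zero (edge a b) (∅ ⊞ x) y (edge-≢ a b (∅ ⊞ x ⊞ y) h))) (signed-0 (even (below x ∅)))
    straight : ∀ x y → x ≢ y → bd² (edge x y) ∅ x y ≈ ⊖ 1#
    straight x y x≢y rewrite ∅-lookup x | below-∅ x | bd-∉ (edge x y) (∅ ⊞ x) y (trans (⊞-other ∅ (x≢y ∘ sym)) (∅-lookup y)) | edge-self x y
      with ≢⇒<⊎> x≢y
    ... | inj₁ x<y rewrite below-⊞-< ∅ x<y (∅-lookup x) | below-∅ y | <ᵇ′-true x<y = ≈-refl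
    ... | inj₂ y<x rewrite below-⊞-≥ ∅ {x} {y} (<⇒≤ y<x) | below-∅ y | <ᵇ′-false (<⇒≤ y<x) = ≈-refl
    by-cases : Dec (x ≡ y) → bd² (edge a b) ∅ x y ≈ δ (x == b) ⊛ δ (y == a) ⊕ ⊖ (δ (x == a) ⊛ δ (y == b))
    by-cases (yes refl) = ≈-trans (bd²-diagonal (edge a b) ∅ x) (≈-sym (x-x (⊛-comm (δ (x == b)) (δ (x == a)))))
    by-cases (no x≢y) = by-pair ((∅ ⊞ x ⊞ y) ≟ₛ (∅ ⊞ a ⊞ b))
      where
      off : ∀ p q → ¬ (x ≡ p × y ≡ q) → δ (x == p) ⊛ δ (y == q) ≈ 0#
      off p q ne with x ≟ p | y ≟ q
      ... | yes r | yes s = ⊥-elim (ne (r , s))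
      ... | yes _ | no _  = zeroʳ 1#
      ... | no _  | _     = zeroˡ _
      on : δ (x == x) ⊛ δ (y == y) ≈ 1#
      on rewrite ==-refl x | ==-refl y = ⊛-identityˡ 1#
      by-pair : Dec (∅ ⊞ x ⊞ y ≡ ∅ ⊞ a ⊞ b) → bd² (edge a b) ∅ x y ≈ δ (x == b) ⊛ δ (y == a) ⊕ ⊖ (δ (x == a) ⊛ δ (y == b))
      by-pair (no h) = ≈-trans (other x≢y h)
        (≈-sym (x-x (≈-trans (off b a (λ { (refl , refl) → h (⊞-comm ∅ x y) })) (≈-sym (off a b λ { (refl , refl) → h refl })))))
      by-pair (yes h) with pair-≡ x y a b x≢y h
      ... | inj₁ (refl , refl) = ≈-trans (straight x y x≢y)
              (≈-sym (≈-trans (⊕-cong (off y x (x≢y ∘ proj₁)) (-‿cong on)) (⊕-identityˡ _)))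
      ... | inj₂ (refl , refl) = ≈-trans (bd²-antisym (edge y x) ∅ x y x≢y) (≈-trans (-‿cong (straight y x (x≢y ∘ sym)))
              (≈-trans (-‿involutive 1#) (≈-sym (≈-trans (⊕-cong on (≈-trans (-‿cong (off y x (x≢y ∘ proj₁))) -0#≈0#)) (⊕-identityʳ 1#)))))

  cut-edge : ∀ {n} (D : Fin n → Bool) (a b : Fin n) → cut D (edge a b) ≈ δ (D b) ⊕ ⊖ δ (D a)
  cut-edge D a b = ≈-trans (sum-cong-≋ term) (≈-trans (∑-distrib-+ (λ x → δ (D x) ⊛ δ (x == b)) (λ x → ⊖ (δ (D x) ⊛ δ (x == a))))
    (⊕-cong (sum-δ (δ ∘ D) b) (≈-trans (sum-neg (λ x → δ (D x) ⊛ δ (x == a))) (-‿cong (sum-δ (δ ∘ D) a)))))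
    where
    collapse : ∀ p y → sum (λ z → p ⊛ δ (z == y)) ≈ p
    collapse p y = sum-δ (λ _ → p) y
    ∂-edge : ∀ x → ∂ (edge a b) ⁅ x ⁆ ≈ δ (x == b) ⊕ ⊖ δ (x == a)
    ∂-edge x = ≈-trans (∂-vertex (edge a b) x) (≈-trans (sum-cong-≋ (bd²-edge a b x))
      (≈-trans (∑-distrib-+ (λ y → δ (x == b) ⊛ δ (y == a)) (λ y → ⊖ (δ (x == a) ⊛ δ (y == b))))
        (⊕-cong (collapse (δ (x == b)) a) (≈-trans (sum-neg (λ y → δ (x == a) ⊛ δ (y == b))) (-‿cong (collapse (δ (x == a)) b))))))
    term : ∀ x → δ (D x) ⊛ ∂ (edge a b) ⁅ x ⁆ ≈ δ (D x) ⊛ δ (x == b) ⊕ ⊖ (δ (D x) ⊛ δ (x == a))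
    term x = ≈-trans (*-cong ≈-refl (∂-edge x)) (x[y-z]≈xy-xz (δ (D x)) (δ (x == b)) (δ (x == a)))

  cut-+ : ∀ {n} (D : Fin n → Bool) (z z′ : Chain n) → cut D (λ σ → z σ ⊕ z′ σ) ≈ cut D z ⊕ cut D z′
  cut-+ D z z′ = ≈-trans (sum-cong-≋ λ x → ≈-trans (*-cong ≈-refl (∂-+ z z′ ⁅ x ⁆)) (distribˡ (δ (D x)) (∂ z ⁅ x ⁆) (∂ z′ ⁅ x ⁆)))
    (∑-distrib-+ (λ x → δ (D x) ⊛ ∂ z ⁅ x ⁆) (λ x → δ (D x) ⊛ ∂ z′ ⁅ x ⁆))
    where open Field K using (distribˡ)

  cut-* : ∀ {n} (D : Fin n → Bool) k (z : Chain n) → cut D (λ σ → k ⊛ z σ) ≈ k ⊛ cut D z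
  cut-* D k z = ≈-trans (sum-cong-≋ λ x → ≈-trans (*-cong ≈-refl (∂-* k z ⁅ x ⁆)) (swap (δ (D x)) k (∂ z ⁅ x ⁆)))
    (≈-sym (*-distribˡ-sum k (λ x → δ (D x) ⊛ ∂ z ⁅ x ⁆)))
    where
    swap : ∀ p q r → p ⊛ (q ⊛ r) ≈ q ⊛ (p ⊛ r)
    swap p q r = ≈-trans (≈-sym (⊛-assoc p q r)) (≈-trans (*-cong (⊛-comm p q) ≈-refl) (⊛-assoc q p r))

  cut-sum : ∀ {n k} (D : Fin n → Bool) (t : Fin k → Carrier) (z : Fin k → Chain n) →
    cut D (λ σ → sum (λ i → t i ⊛ z i σ)) ≈ sum (λ i → t i ⊛ cut D (z i))
  cut-sum {k = zero}  D t z = cut-zero D (∂-zero (λ _ → ≈-refl) ∘ ⁅_⁆)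
  cut-sum {k = suc k} D t z = ≈-trans (cut-+ D (λ σ → t zero ⊛ z zero σ) (λ σ → sum (λ i → t (suc i) ⊛ z (suc i) σ)))
    (⊕-cong (cut-* D (t zero) (z zero)) (cut-sum D (t ∘ suc) (z ∘ suc)))

  IsTriangleBoundary : ∀ {n} → Fin n → Fin n → Fin n → Set (c ⊔ ℓ)
  IsTriangleBoundary {n} a b e = Σ (Chain n) λ w → (∀ σ → σ ≢ ∅ ⊞ a ⊞ b ⊞ e → w σ ≈ 0#) ×
    (∀ τ → ∂ w τ ≈ edge a b τ ⊕ (edge b e τ ⊕ edge e a τ))

  -- With sorted vertices the filling chain is the indicator of the triangle. The cyclic form of the
  -- boundary lets `rotate` and `reflect` reduce every other order to this one.
  triangle-sorted : ∀ {n} {a b e : Fin n} → a Fin.< b → b Fin.< e → IsTriangleBoundary a b e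
  triangle-sorted {n} {a} {b} {e} a<b b<e = w , (λ σ h → ≈-reflexive (cong δ (dec-false (σ ≟ₛ κ) h))) , boundary
    where
    a<e : a Fin.< e
    a<e = <-trans a<b b<e
    ≢ab : a ≢ b
    ≢ab refl = <-irrefl refl a<b
    ≢be : b ≢ e
    ≢be refl = <-irrefl refl b<e
    ≢ae : a ≢ e
    ≢ae refl = <-irrefl refl a<e
    κ ab be ae : Subset n
    κ = ∅ ⊞ a ⊞ b ⊞ e
    ab = ∅ ⊞ a ⊞ b
    be = ∅ ⊞ b ⊞ e
    ae = ∅ ⊞ e ⊞ a
    w : Chain n
    w σ = δ (does (σ ≟ₛ κ))
    w-κ : ∀ σ → σ ≡ κ → w σ ≡ 1#
    w-κ σ h = cong δ (dec-true (σ ≟ₛ κ) h)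
    be⊞a : be ⊞ a ≡ κ
    be⊞a = trans (⊞-comm (∅ ⊞ b) e a) (cong (_⊞ e) (⊞-comm ∅ b a))
    ae⊞b : ae ⊞ b ≡ κ
    ae⊞b = trans (cong (_⊞ b) (⊞-comm ∅ e a)) (⊞-comm (∅ ⊞ a) e b)
    out : ∀ x y z → z ≢ x → z ≢ y → lookup (∅ ⊞ x ⊞ y) z ≡ false
    out x y z z≢x z≢y = trans (⊞-other (∅ ⊞ x) z≢y) (trans (⊞-other ∅ z≢x) (∅-lookup z))
    which : ∀ τ t → lookup τ t ≡ false → τ ⊞ t ≡ κ → (t ≡ e × τ ≡ ab) ⊎ (t ≡ a × τ ≡ be) ⊎ (t ≡ b × τ ≡ ae)
    which τ t τt h with ∨-true {t == e} (trans (sym (lookup-⊞ ab e t)) (trans (cong (λ σ → lookup σ t) (sym h)) (∈-⊞ τ t)))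
    ... | inj₁ p with ==⇒≡ {x = t} {e} p
    ...   | refl = inj₁ (refl , trans (sym (⊞-⊟ τ t τt)) (trans (cong (_⊟ t) h) (⊞-⊟ ab e (out a b e (≢ae ∘ sym) (≢be ∘ sym)))))
    which τ t τt h | inj₂ p with ∨-true {t == b} (trans (sym (lookup-⊞ (∅ ⊞ a) b t)) p)
    ... | inj₁ q with ==⇒≡ {x = t} {b} q
    ...   | refl = inj₂ (inj₂ (refl , trans (sym (⊞-⊟ τ t τt)) (trans (cong (_⊟ t) (trans h (sym ae⊞b))) (⊞-⊟ ae b (out e a b ≢be (≢ab ∘ sym))))))
    which τ t τt h | inj₂ p | inj₂ q with ∨-true {t == a} (trans (sym (lookup-⊞ ∅ a t)) q)
    ... | inj₂ r = ⊥-elim (true≢false r (∅-lookup t))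
    ... | inj₁ r with ==⇒≡ {x = t} {a} r
    ...   | refl = inj₂ (inj₁ (refl , trans (sym (⊞-⊟ τ t τt)) (trans (cong (_⊟ t) (trans h (sym be⊞a))) (⊞-⊟ be a (out b e a ≢ab ≢ae)))))
    only-term : ∀ τ t → (∀ s → lookup τ s ≡ false → τ ⊞ s ≡ κ → s ≡ t) → ∂ w τ ≈ bd w τ t
    only-term τ t uniq = ≈-trans (∂≈ w τ) (sum-single t others)
      where
      others : ∀ s → s ≢ t → bd w τ s ≈ 0#
      others s s≢t with lookup τ s in τs
      ... | true = ≈-refl
      ... | false = ≈-trans (signed-cong (even (below s τ)) (≈-reflexive (cong δ (dec-false ((τ ⊞ s) ≟ₛ κ) λ h → s≢t (uniq s τs h))))) (signed-0 (even (below s τ)))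
    ab≢be : ab ≢ be
    ab≢be h = true≢false (trans (cong (λ σ → lookup σ a) (sym h)) (⊞-mono (∅ ⊞ a) b (∈-⊞ ∅ a))) (out b e a ≢ab ≢ae)
    ab≢ae : ab ≢ ae
    ab≢ae h = true≢false (trans (cong (λ σ → lookup σ b) (sym h)) (∈-⊞ (∅ ⊞ a) b)) (out e a b ≢be (≢ab ∘ sym))
    be≢ae : be ≢ ae
    be≢ae h = true≢false (trans (cong (λ σ → lookup σ b) (sym h)) (⊞-mono (∅ ⊞ b) e (∈-⊞ ∅ b))) (out e a b ≢be (≢ab ∘ sym))
    Boundary : Subset n → Set ℓ
    Boundary τ = ∂ w τ ≈ edge a b τ ⊕ (edge b e τ ⊕ edge e a τ)
    boundary : ∀ τ → Boundary τ
    by-face : ∀ τ → Dec (τ ≡ ab) → Dec (τ ≡ be) → Dec (τ ≡ ae) → Boundary τ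
    boundary τ = by-face τ (τ ≟ₛ ab) (τ ≟ₛ be) (τ ≟ₛ ae)
    by-face τ (yes refl) _ _ = ≈-trans (only-term ab e uniq) (≈-trans value (≈-sym
            (≈-trans (⊕-cong (≈-trans (≈-reflexive (edge-self a b)) (≈-reflexive (cong (λ q → signed q 1#) (<ᵇ′-true a<b))))
              (≈-trans (⊕-cong (edge-≢ b e ab ab≢be) (edge-≢ e a ab ab≢ae)) (⊕-identityˡ 0#))) (⊕-identityʳ 1#))))
      where
      uniq : ∀ s → lookup ab s ≡ false → ab ⊞ s ≡ κ → s ≡ e
      uniq s h k with which ab s h k
      ... | inj₁ (p , _) = p
      ... | inj₂ (inj₁ (_ , q)) = ⊥-elim (ab≢be q)
      ... | inj₂ (inj₂ (_ , q)) = ⊥-elim (ab≢ae q)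
      value : bd w ab e ≈ 1#
      value rewrite bd-∉ w ab e (out a b e (≢ae ∘ sym) (≢be ∘ sym)) | below-⊞-< (∅ ⊞ a) b<e (trans (⊞-other ∅ (≢ab ∘ sym)) (∅-lookup b))
        | below-⊞-< ∅ a<e (∅-lookup a) | below-∅ e = ≈-reflexive (w-κ κ refl)
    by-face τ (no _) (yes refl) _ = ≈-trans (only-term be a uniq) (≈-trans value (≈-sym
            (≈-trans (⊕-cong (edge-≢ a b be (ab≢be ∘ sym)) (≈-trans (⊕-cong (≈-trans (≈-reflexive (edge-self b e))
              (≈-reflexive (cong (λ q → signed q 1#) (<ᵇ′-true b<e)))) (edge-≢ e a be be≢ae)) (⊕-identityʳ 1#))) (⊕-identityˡ 1#))))
      where
      uniq : ∀ s → lookup be s ≡ false → be ⊞ s ≡ κ → s ≡ a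
      uniq s h k with which be s h k
      ... | inj₁ (_ , q) = ⊥-elim (ab≢be (sym q))
      ... | inj₂ (inj₁ (p , _)) = p
      ... | inj₂ (inj₂ (_ , q)) = ⊥-elim (be≢ae q)
      value : bd w be a ≈ 1#
      value rewrite bd-∉ w be a (out b e a ≢ab ≢ae) | below-⊞-≥ (∅ ⊞ b) {e} {a} (<⇒≤ a<e) | below-⊞-≥ ∅ {b} {a} (<⇒≤ a<b) | below-∅ a =
        ≈-reflexive (w-κ (be ⊞ a) be⊞a)
    by-face τ (no _) (no _) (yes refl) = ≈-trans (only-term ae b uniq) (≈-trans value (≈-sym
            (≈-trans (⊕-cong (edge-≢ a b ae (ab≢ae ∘ sym)) (≈-trans (⊕-cong (edge-≢ b e ae (be≢ae ∘ sym))
              (≈-trans (≈-reflexive (edge-self e a)) (≈-reflexive (cong (λ q → signed q 1#) (<ᵇ′-false (<⇒≤ a<e)))))) (⊕-identityˡ _))) (⊕-identityˡ _))))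
      where
      uniq : ∀ s → lookup ae s ≡ false → ae ⊞ s ≡ κ → s ≡ b
      uniq s h k with which ae s h k
      ... | inj₁ (_ , q) = ⊥-elim (ab≢ae (sym q))
      ... | inj₂ (inj₁ (_ , q)) = ⊥-elim (be≢ae (sym q))
      ... | inj₂ (inj₂ (p , _)) = p
      value : bd w ae b ≈ ⊖ 1#
      value rewrite bd-∉ w ae b (out e a b ≢be (≢ab ∘ sym)) | below-⊞-< (∅ ⊞ e) a<b (trans (⊞-other ∅ ≢ae) (∅-lookup a))
        | below-⊞-≥ ∅ {e} {b} (<⇒≤ b<e) | below-∅ b = -‿cong (≈-reflexive (w-κ (ae ⊞ b) ae⊞b))
    by-face τ (no ≢₁) (no ≢₂) (no ≢₃) = ≈-trans (≈-trans (∂≈ w τ) (sum-zero none))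
            (≈-sym (≈-trans (⊕-cong (edge-≢ a b τ ≢₁) (≈-trans (⊕-cong (edge-≢ b e τ ≢₂) (edge-≢ e a τ ≢₃)) (⊕-identityˡ 0#))) (⊕-identityˡ 0#)))
      where
      none : ∀ s → bd w τ s ≈ 0#
      none s with lookup τ s in τs
      ... | true = ≈-refl
      ... | false = ≈-trans (signed-cong (even (below s τ)) (≈-reflexive (cong δ (dec-false ((τ ⊞ s) ≟ₛ κ) λ h → case which τ s τs h of λ
              { (inj₁ (_ , q)) → ≢₁ q ; (inj₂ (inj₁ (_ , q))) → ≢₂ q ; (inj₂ (inj₂ (_ , q))) → ≢₃ q })))) (signed-0 (even (below s τ)))

  rotate : ∀ {n} {a b e : Fin n} → IsTriangleBoundary a b e → IsTriangleBoundary b e a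
  rotate {a = a} {b} {e} (w , supp , bdry) = w , (λ σ h → supp σ λ { refl → h (trans (⊞-rotate a b e) refl) }) ,
    λ τ → ≈-trans (bdry τ) (≈-trans (⊕-comm (edge a b τ) (edge b e τ ⊕ edge e a τ)) (⊕-assoc (edge b e τ) (edge e a τ) (edge a b τ)))
    where
    ⊞-rotate : ∀ a b e → ∅ ⊞ a ⊞ b ⊞ e ≡ ∅ ⊞ b ⊞ e ⊞ a
    ⊞-rotate a b e = trans (cong (_⊞ e) (⊞-comm ∅ a b)) (⊞-comm (∅ ⊞ b) a e)

  reflect : ∀ {n} {a b e : Fin n} → a ≢ b → b ≢ e → e ≢ a → IsTriangleBoundary a b e → IsTriangleBoundary b a e
  reflect {a = a} {b} {e} a≢b b≢e e≢a (w , supp , bdry) = (λ σ → ⊖ 1# ⊛ w σ) ,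
    (λ σ h → ≈-trans (*-cong ≈-refl (supp σ λ { refl → h (cong (_⊞ e) (⊞-comm ∅ a b)) })) (zeroʳ _)) ,
    λ τ → ≈-trans (∂-* (⊖ 1#) w τ) (≈-trans (-1*x≈-x (∂ w τ)) (≈-trans (-‿cong (bdry τ))
      (≈-trans (≈-sym (-‿+-comm (edge a b τ) (edge b e τ ⊕ edge e a τ))) (⊕-cong (≈-sym (edge-flip a b a≢b τ))
        (≈-trans (≈-sym (-‿+-comm (edge b e τ) (edge e a τ))) (≈-trans (⊕-comm (⊖ edge b e τ) (⊖ edge e a τ))
          (⊕-cong (≈-sym (edge-flip e a e≢a τ)) (≈-sym (edge-flip b e b≢e τ)))))))))

  triangle : ∀ {n} (a b e : Fin n) → a ≢ b → b ≢ e → e ≢ a → IsTriangleBoundary a b e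
  triangle a b e a≢b b≢e e≢a with ≢⇒<⊎> a≢b | ≢⇒<⊎> b≢e | ≢⇒<⊎> e≢a
  ... | inj₁ a<b | inj₁ b<e | _        = triangle-sorted a<b b<e
  ... | inj₁ a<b | inj₂ e<b | inj₁ e<a = rotate (triangle-sorted e<a a<b)
  ... | inj₁ a<b | inj₂ e<b | inj₂ a<e = rotate (reflect (e≢a ∘ sym) (b≢e ∘ sym) (a≢b ∘ sym) (triangle-sorted a<e e<b))
  ... | inj₂ b<a | inj₁ b<e | inj₁ e<a = rotate (rotate (triangle-sorted b<e e<a))
  ... | inj₂ b<a | inj₁ b<e | inj₂ a<e = reflect (a≢b ∘ sym) (e≢a ∘ sym) (b≢e ∘ sym) (triangle-sorted b<a a<e)
  ... | inj₂ b<a | inj₂ e<b | _        = rotate (rotate (reflect (b≢e ∘ sym) (a≢b ∘ sym) (e≢a ∘ sym) (triangle-sorted e<b b<a)))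

-- Links

isEmpty-intro : (σ : Subset n) → (∀ i → lookup σ i ≡ false) → isEmpty σ ≡ true
isEmpty-intro []      h = refl
isEmpty-intro (b ∷ σ) h = ∧-intro (not-true (h zero)) (isEmpty-intro σ (h ∘ suc))

isEmpty-elim : (σ : Subset n) → isEmpty σ ≡ true → ∀ i → lookup σ i ≡ false
isEmpty-elim (b ∷ σ) h zero    = not-true⁻¹ (proj₁ (∧-true h))
isEmpty-elim (b ∷ σ) h (suc i) = isEmpty-elim σ (proj₂ (∧-true {not b} h)) i

Disjoint : Subset n → Subset n → Set
Disjoint σ τ = ∀ i → lookup σ i ≡ true → lookup τ i ≡ false

size-∪ : (σ τ : Subset n) → Disjoint σ τ → ∣ σ ∪ τ ∣ ≡ ∣ σ ∣ + ∣ τ ∣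
size-∪ []          []          h = refl
size-∪ (true  ∷ σ) (true  ∷ τ) h = case h zero refl of λ ()
size-∪ (true  ∷ σ) (false ∷ τ) h = cong suc (size-∪ σ τ (h ∘ suc))
size-∪ (false ∷ σ) (true  ∷ τ) h = trans (cong suc (size-∪ σ τ (h ∘ suc))) (sym (+-suc ∣ σ ∣ ∣ τ ∣))
size-∪ (false ∷ σ) (false ∷ τ) h = size-∪ σ τ (h ∘ suc)

_⊑_ : Subset n → Subset n → Set
σ ⊑ τ = ∀ i → lookup σ i ≡ true → lookup τ i ≡ true

⊑-size : (σ τ : Subset n) → σ ⊑ τ → ∣ τ ∣ ≤ ∣ σ ∣ → σ ≡ τ
⊑-size σ τ h le = subset-ext λ i → ⇔⇒≡ (h i) λ τi → ¬false⇒true λ σi → <⇒≱ (subst₂ _<_ (sym (size≡# σ)) (sym (size≡# τ)) (#-mono-< i σi τi h)) le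

⊑-⊞ : (σ τ : Subset n) (x : Fin n) → σ ⊑ τ → lookup τ x ≡ true → (σ ⊞ x) ⊑ τ
⊑-⊞ σ τ x h τx i p with i ≟ x
... | yes refl = τx
... | no i≢x = h i (trans (sym (⊞-other σ i≢x)) p)

⊑-extra : (σ τ : Subset n) → ∣ σ ∣ < ∣ τ ∣ → ∃ λ x → lookup τ x ≡ true × lookup σ x ≡ false
⊑-extra σ τ lt with any? (λ x → (lookup τ x ≟ᵇ true) ×-dec (lookup σ x ≟ᵇ false))
... | yes p = p
... | no none = ⊥-elim (<⇒≱ lt (subst₂ _≤_ (sym (size≡# τ)) (sym (size≡# σ)) (#-mono λ i τi → ¬false⇒true λ σi → none (i , τi , σi))))

∪-∅ : (σ : Subset n) → ∅ ∪ σ ≡ σ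
∪-∅ σ = subset-ext λ i → trans (∪-lookup ∅ σ i) (cong (_∨ lookup σ i) (∅-lookup i))

∪-⊞ : (σ τ : Subset n) (x : Fin n) → (σ ⊞ x) ∪ τ ≡ (σ ∪ τ) ⊞ x
∪-⊞ σ τ x = subset-ext λ i → trans (∪-lookup (σ ⊞ x) τ i) (trans (cong (_∨ lookup τ i) (lookup-⊞ σ x i))
  (trans (∨-assoc (i == x) (lookup σ i) (lookup τ i)) (sym (trans (lookup-⊞ (σ ∪ τ) x i) (cong (i == x ∨_) (∪-lookup σ τ i))))))

∪-⊞ʳ : (σ τ : Subset n) (x : Fin n) → σ ∪ (τ ⊞ x) ≡ (σ ∪ τ) ⊞ x
∪-⊞ʳ σ τ x = subset-ext λ i → trans (∪-lookup σ (τ ⊞ x) i) (trans (cong (lookup σ i ∨_) (lookup-⊞ τ x i))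
  (trans (lemma (lookup σ i) (i == x) (lookup τ i)) (sym (trans (lookup-⊞ (σ ∪ τ) x i) (cong (i == x ∨_) (∪-lookup σ τ i))))))
  where
  lemma : ∀ a b c → a ∨ (b ∨ c) ≡ b ∨ (a ∨ c)
  lemma true  true  c = refl
  lemma true  false c = refl
  lemma false b     c = refl

module Complexes {n} (Δ : Complex n) where

  face-⊑ : ∀ {σ τ} → σ ⊑ τ → face Δ τ ≡ true → face Δ σ ≡ true
  face-⊑ {σ} {τ} h p = T⇒true (downward Δ σ τ (λ i t → true⇒T (h i (T⇒true t))) (true⇒T p))

  lk : Subset n → Subset n → Bool
  lk = lkFace Δ

  lk-intro : ∀ ρ τ → Disjoint τ ρ → face Δ (τ ∪ ρ) ≡ true → lk ρ τ ≡ true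
  lk-intro ρ τ disj p = ∧-intro (isEmpty-intro (τ ∩ ρ) λ i → trans (∩-lookup τ ρ i) (lemma (lookup τ i) (lookup ρ i) (disj i))) p
    where
    lemma : ∀ a b → (a ≡ true → b ≡ false) → a ∧ b ≡ false
    lemma true  b h = h refl
    lemma false b h = refl

  lk-disjoint : ∀ ρ τ → lk ρ τ ≡ true → Disjoint τ ρ
  lk-disjoint ρ τ h i τi = trans (sym (cong (_∧ lookup ρ i) τi)) (trans (sym (∩-lookup τ ρ i)) (isEmpty-elim (τ ∩ ρ) (proj₁ (∧-true h)) i))

  lk-face : ∀ ρ τ → lk ρ τ ≡ true → face Δ (τ ∪ ρ) ≡ true
  lk-face ρ τ h = proj₂ (∧-true {isEmpty (τ ∩ ρ)} h)

  lk-⊑ : ∀ ρ {σ τ} → σ ⊑ τ → lk ρ τ ≡ true → lk ρ σ ≡ true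
  lk-⊑ ρ {σ} {τ} h p = lk-intro ρ σ (λ i σi → lk-disjoint ρ τ p i (h i σi))
    (face-⊑ (λ i q → trans (∪-lookup τ ρ i) (mono i (trans (sym (∪-lookup σ ρ i)) q))) (lk-face ρ τ p))
    where
    mono : ∀ i → lookup σ i ∨ lookup ρ i ≡ true → lookup τ i ∨ lookup ρ i ≡ true
    mono i q with ∨-true {lookup σ i} q
    ... | inj₁ σi = ∨-introˡ (h i σi)
    ... | inj₂ ρi = ∨-introʳ {lookup τ i} ρi

  vtx : Subset n → Fin n → Bool
  vtx ρ x = not (lookup ρ x) ∧ face Δ (ρ ⊞ x)

  -- Adjacency in the link of ρ, written so that the neighbours of a vertex a are the vertices of
  -- the link of ρ ⊞ a; edges of a link are then counted by degrees of smaller links.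
  adjL : Subset n → Graph n
  adjL ρ a b = not (a == b) ∧ (vtx ρ a ∧ vtx (ρ ⊞ a) b)

  lk-∅ : ∀ ρ → face Δ ρ ≡ true → lk ρ ∅ ≡ true
  lk-∅ ρ p = lk-intro ρ ∅ (λ i q → ⊥-elim (true≢false q (∅-lookup i))) (trans (cong (face Δ) (∪-∅ ρ)) p)

  lk-⊞ : ∀ ρ τ x → lookup τ x ≡ false → lk ρ (τ ⊞ x) ≡ not (lookup ρ x) ∧ lk (ρ ⊞ x) τ
  lk-⊞ ρ τ x τx = ⇔⇒≡ to from
    where
    shift : (τ ⊞ x) ∪ ρ ≡ τ ∪ (ρ ⊞ x)
    shift = trans (∪-⊞ τ ρ x) (sym (∪-⊞ʳ τ ρ x))
    to : lk ρ (τ ⊞ x) ≡ true → not (lookup ρ x) ∧ lk (ρ ⊞ x) τ ≡ true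
    to p = ∧-intro (not-true (lk-disjoint ρ (τ ⊞ x) p x (∈-⊞ τ x)))
      (lk-intro (ρ ⊞ x) τ disj (trans (cong (face Δ) (sym shift)) (lk-face ρ (τ ⊞ x) p)))
      where
      disj : Disjoint τ (ρ ⊞ x)
      disj i τi = trans (⊞-other ρ λ { refl → true≢false τi τx }) (lk-disjoint ρ (τ ⊞ x) p i (⊞-mono τ x τi))
    from : not (lookup ρ x) ∧ lk (ρ ⊞ x) τ ≡ true → lk ρ (τ ⊞ x) ≡ true
    from q = lk-intro ρ (τ ⊞ x) disj (trans (cong (face Δ) shift) (lk-face (ρ ⊞ x) τ p))
      where
      p = proj₂ (∧-true {not (lookup ρ x)} q)
      disj : Disjoint (τ ⊞ x) ρ
      disj i h with i ≟ x
      ... | yes refl = not-true⁻¹ (proj₁ (∧-true q))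
      ... | no i≢x = trans (sym (⊞-other ρ i≢x)) (lk-disjoint (ρ ⊞ x) τ p i (trans (sym (⊞-other τ i≢x)) h))

  lk-∅-face : ∀ ρ → lk ρ ∅ ≡ face Δ ρ
  lk-∅-face ρ = ⇔⇒≡ (λ p → trans (cong (face Δ) (sym (∪-∅ ρ))) (lk-face ρ ∅ p)) (lk-∅ ρ)

  lk-⁅⁆ : ∀ ρ x → lk ρ ⁅ x ⁆ ≡ vtx ρ x
  lk-⁅⁆ ρ x = trans (cong (lk ρ) (⁅⁆≡∅⊞ x)) (trans (lk-⊞ ρ ∅ x (∅-lookup x)) (cong (not (lookup ρ x) ∧_) (lk-∅-face (ρ ⊞ x))))

  lk-∪ : ∀ ρ η x → lk ρ η ≡ true → lookup η x ≡ false → lk ρ (η ⊞ x) ≡ vtx (η ∪ ρ) x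
  lk-∪ ρ η x p ηx = ⇔⇒≡ to from
    where
    to : lk ρ (η ⊞ x) ≡ true → vtx (η ∪ ρ) x ≡ true
    to q = ∧-intro (not-true (trans (∪-lookup η ρ x) (cong₂ _∨_ ηx (lk-disjoint ρ (η ⊞ x) q x (∈-⊞ η x)))))
      (trans (cong (face Δ) (sym (∪-⊞ η ρ x))) (lk-face ρ (η ⊞ x) q))
    from : vtx (η ∪ ρ) x ≡ true → lk ρ (η ⊞ x) ≡ true
    from q = lk-intro ρ (η ⊞ x) disj (trans (cong (face Δ) (∪-⊞ η ρ x)) (proj₂ (∧-true {not (lookup (η ∪ ρ) x)} q)))
      where
      disj : Disjoint (η ⊞ x) ρ
      disj i h with i ≟ x
      ... | yes refl = ¬true⇒false λ ρx → true≢false (trans (∪-lookup η ρ i) (∨-introʳ {lookup η i} ρx)) (not-true⁻¹ (proj₁ (∧-true q)))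
      ... | no i≢x = lk-disjoint ρ η p i (trans (sym (⊞-other η i≢x)) h)

  lk-∪-∉ : ∀ ρ η x → vtx (η ∪ ρ) x ≡ true → lookup η x ≡ false
  lk-∪-∉ ρ η x q = ¬true⇒false λ ηx → true≢false (trans (∪-lookup η ρ x) (∨-introˡ ηx)) (not-true⁻¹ (proj₁ (∧-true q)))

  adjL-irrefl : ∀ ρ → Irreflexive (adjL ρ)
  adjL-irrefl ρ a rewrite ==-refl a = refl

  adjL-intro : ∀ ρ a b → a ≢ b → lookup ρ a ≡ false → lookup ρ b ≡ false → face Δ (ρ ⊞ a ⊞ b) ≡ true → adjL ρ a b ≡ true
  adjL-intro ρ a b a≢b ρa ρb p = ∧-intro (not-true (==-≢ a≢b)) (∧-intro
    (∧-intro (not-true ρa) (face-⊑ {ρ ⊞ a} (λ i → ⊞-mono (ρ ⊞ a) b) p))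
    (∧-intro (not-true (trans (⊞-other ρ (a≢b ∘ sym)) ρb)) p))

  adjL-sym : ∀ ρ → Symmetric (adjL ρ)
  adjL-sym ρ a b h = adjL-intro ρ b a (a≢b ∘ sym) (trans (sym (⊞-other ρ (a≢b ∘ sym))) ρb) ρa (trans (cong (face Δ) (⊞-comm ρ b a)) p)
    where
    a≢b : a ≢ b
    a≢b refl = true≢false h (adjL-irrefl ρ a)
    h₁ = proj₂ (∧-true {not (a == b)} h)
    ρa = not-true⁻¹ (proj₁ (∧-true {not (lookup ρ a)} (proj₁ (∧-true {vtx ρ a} h₁))))
    ρb = not-true⁻¹ (proj₁ (∧-true {not (lookup (ρ ⊞ a) b)} (proj₂ (∧-true {vtx ρ a} h₁))))
    p = proj₂ (∧-true {not (lookup (ρ ⊞ a) b)} (proj₂ (∧-true {vtx ρ a} h₁)))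

-- The combinatorial content extracted from the homology of the links. Connectedness says that a
-- colouring constant along edges is constant: cuts deliver it in this form, and `facets-minimal`
-- consumes it in this form.
record NormalPseudomanifold {n} (Δ : Complex n) (d : ℕ) : Set where
  open Complexes Δ
  field
    bounded   : ∀ σ → face Δ σ ≡ true → ∣ σ ∣ ≤ d
    pure      : ∀ σ → face Δ σ ≡ true → ∃ λ τ → face Δ τ ≡ true × ∣ τ ∣ ≡ d × σ ⊑ τ
    ridge     : ∀ ρ → face Δ ρ ≡ true → 1 ≤ ∣ ρ ∣ → suc ∣ ρ ∣ ≡ d → Two (vtx ρ)
    connected : ∀ ρ → face Δ ρ ≡ true → 1 ≤ ∣ ρ ∣ → 2 + ∣ ρ ∣ ≤ d → (D : Fin n → Bool) →
      (∀ a b → adjL ρ a b ≡ true → D a ≡ D b) → ∀ u v → vtx ρ u ≡ true → vtx ρ v ≡ true → D u ≡ D v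

module LinkCycles {n} (Δ : Complex n) (d : ℕ) (pm : NormalPseudomanifold Δ d)
  (ρ : Subset n) (ρ∈ : face Δ ρ ≡ true) (ρ≥1 : 1 ≤ ∣ ρ ∣) (e : ℕ) (dim : e + ∣ ρ ∣ ≡ d) where

  open Complexes Δ
  open NormalPseudomanifold pm

  facets : Family n
  facets τ = lk ρ τ ∧ does (∣ τ ∣ ≟ₙ e)

  facets-lk : ∀ τ → facets τ ≡ true → lk ρ τ ≡ true
  facets-lk τ h = proj₁ (∧-true h)

  facets-size : ∀ τ → facets τ ≡ true → ∣ τ ∣ ≡ e
  facets-size τ h = does-true (∣ τ ∣ ≟ₙ e) (proj₂ (∧-true {lk ρ τ} h))

  size-join : ∀ {η} → lk ρ η ≡ true → ∣ η ∪ ρ ∣ ≡ ∣ η ∣ + ∣ ρ ∣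
  size-join {η} p = size-∪ η ρ (lk-disjoint ρ η p)

  join≥1 : ∀ {η} → lk ρ η ≡ true → 1 ≤ ∣ η ∪ ρ ∣
  join≥1 p = ≤-trans ρ≥1 (≤-trans (m≤n+m _ _) (≤-reflexive (sym (size-join p))))

  extend : ∀ θ → lk ρ θ ≡ true → ∃ λ σ → facets σ ≡ true × θ ⊑ σ
  extend θ p with pure (θ ∪ ρ) (lk-face ρ θ p)
  ... | τ , fτ , sτ , sub = σ , ∧-intro (lk-intro ρ σ disj (trans (cong (face Δ) σ∪ρ) fτ)) (dec-true (∣ σ ∣ ≟ₙ e) sizeσ) , θ⊑σ
    where
    σ : Subset n
    σ = tabulate (λ i → lookup τ i ∧ not (lookup ρ i))
    look : ∀ i → lookup σ i ≡ lookup τ i ∧ not (lookup ρ i)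
    look i = lookup∘tabulate _ i
    disj : Disjoint σ ρ
    disj i h = not-true⁻¹ (proj₂ (∧-true {lookup τ i} (trans (sym (look i)) h)))
    σ∪ρ : σ ∪ ρ ≡ τ
    σ∪ρ = subset-ext λ i → trans (∪-lookup σ ρ i) (trans (cong (_∨ lookup ρ i) (look i))
      (lemma (lookup τ i) (lookup ρ i) λ ρi → sub i (trans (∪-lookup θ ρ i) (∨-introʳ {lookup θ i} ρi))))
      where
      lemma : ∀ a b → (b ≡ true → a ≡ true) → (a ∧ not b) ∨ b ≡ a
      lemma true  true  h = refl
      lemma true  false h = refl
      lemma false true  h = sym (h refl)
      lemma false false h = refl
    sizeσ : ∣ σ ∣ ≡ e
    sizeσ = +-cancelʳ-≡ ∣ ρ ∣ ∣ σ ∣ e (trans (sym (size-∪ σ ρ disj)) (trans (cong ∣_∣ σ∪ρ) (trans sτ (sym dim))))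
    θ⊑σ : θ ⊑ σ
    θ⊑σ i θi = trans (look i) (∧-intro (sub i (trans (∪-lookup θ ρ i) (∨-introˡ θi))) (not-true (lk-disjoint ρ θ p i θi)))

  ridge-of : ∀ η → lk ρ η ≡ true → suc ∣ η ∣ ≡ e → Two (vtx (η ∪ ρ))
  ridge-of η p s = ridge (η ∪ ρ) (lk-face ρ η p) (join≥1 p)
    (trans (cong suc (size-join p)) (trans (cong (_+ ∣ ρ ∣) s) dim))

  facets-⊞ : ∀ η x → lk ρ η ≡ true → suc ∣ η ∣ ≡ e → not (lookup η x) ∧ facets (η ⊞ x) ≡ vtx (η ∪ ρ) x
  facets-⊞ η x p s = ⇔⇒≡
    (λ h → let ηx = not-true⁻¹ (proj₁ (∧-true h)) in
      trans (sym (lk-∪ ρ η x p ηx)) (facets-lk (η ⊞ x) (proj₂ (∧-true {not (lookup η x)} h))))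
    (λ h → let ηx = lk-∪-∉ ρ η x h in ∧-intro (not-true ηx)
      (∧-intro (trans (lk-∪ ρ η x p ηx) h) (dec-true (∣ η ⊞ x ∣ ≟ₙ e) (trans (size-⊞ η x ηx) s))))

  -- By `ridge`, a face with one vertex fewer than a facet lies in exactly two facets, and two is
  -- zero modulo 2.
  facets-cycle : Cycle₂ e facets
  facets-cycle = record { size = facets-size ; boundary = boundary }
    where
    boundary : ∀ η → ∂₂ facets η ≡ false
    boundary η with lk ρ η in lkη | suc ∣ η ∣ ≟ₙ e
    ... | true | yes s = trans (⨁-cong λ x → trans (facets-⊞ η x lkη s) (indicator x))
          (trans (⨁-xor (_== first) (_== second)) (cong₂ _xor_ (one first) (one second)))
      where
      open Two (ridge-of η lkη s)
      one : ∀ y → ⨁ (_== y) ≡ true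
      one y = trans (⨁-single y λ j → ==-≢) (==-refl y)
      indicator : ∀ x → vtx (η ∪ ρ) x ≡ (x == first) xor (x == second)
      indicator x with x ≟ first | x ≟ second
      ... | yes refl | yes p    = ⊥-elim (distinct p)
      ... | yes refl | no _     = first∈
      ... | no _     | yes refl = second∈
      ... | no ≢₁    | no ≢₂    = ¬true⇒false λ h → [ ≢₁ , ≢₂ ]′ (only x h)
    ... | true | no ¬s = ⨁-false λ x → ¬true⇒false λ h →
          ¬s (trans (sym (size-⊞ η x (not-true⁻¹ (proj₁ (∧-true h))))) (facets-size (η ⊞ x) (proj₂ (∧-true {not (lookup η x)} h))))
    ... | false | _ = ⨁-false λ x → ¬true⇒false λ h →
          true≢false (lk-⊑ ρ (λ i → ⊞-mono η x) (facets-lk (η ⊞ x) (proj₂ (∧-true {not (lookup η x)} h)))) lkη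

  -- By induction on k, a subcycle Y contains all or none of the facets above a face θ with e - k
  -- vertices. Above a ridge this is the cycle condition; for larger k it spreads along the edges of
  -- the connected link of θ. The case θ = ∅ is the claim.
  facets-minimal : ∀ F → facets F ≡ true → MinimalAt e facets F
  facets-minimal F F∈ Y cY Y⊆ YF σ σ∈ = trans (agree e ∅ (lk-∅ ρ ρ∈) (trans (cong (e +_) (∅-size n)) (+-identityʳ e)) σ F σ∈ F∈ (∅⊑ σ) (∅⊑ F)) YF
    where
    ∅⊑ : ∀ τ → ∅ ⊑ τ
    ∅⊑ τ i p = ⊥-elim (true≢false p (∅-lookup i))
    Agree : ℕ → Set
    Agree k = ∀ θ → lk ρ θ ≡ true → k + ∣ θ ∣ ≡ e → ∀ σ σ′ → facets σ ≡ true → facets σ′ ≡ true →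
      θ ⊑ σ → θ ⊑ σ′ → Y σ ≡ Y σ′
    agree-step : ∀ k → Agree (suc k) → Agree (suc (suc k))
    agree : ∀ k → Agree k
    agree zero θ p s σ σ′ σ∈ σ′∈ sub sub′ = cong Y (trans (sym (eq σ σ∈ sub)) (eq σ′ σ′∈ sub′))
      where
      eq : ∀ σ → facets σ ≡ true → θ ⊑ σ → θ ≡ σ
      eq σ σ∈ sub = ⊑-size θ σ sub (≤-reflexive (trans (facets-size σ σ∈) (sym s)))
    agree (suc zero) θ p s σ σ′ σ∈ σ′∈ sub sub′ = ⇔⇒≡ (transfer σ σ′ σ∈ σ′∈ sub sub′) (transfer σ′ σ σ′∈ σ∈ sub′ sub)
      where
      open Two (ridge-of θ p s)
      over-ridge : ∀ σ → facets σ ≡ true → θ ⊑ σ → ∃ λ x → lookup θ x ≡ false × θ ⊞ x ≡ σ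
      over-ridge σ σ∈ sub with ⊑-extra θ σ (≤-reflexive (trans s (sym (facets-size σ σ∈))))
      ... | x , σx , θx = x , θx , ⊑-size (θ ⊞ x) σ (⊑-⊞ θ σ x sub σx)
            (≤-reflexive (trans (facets-size σ σ∈) (sym (trans (size-⊞ θ x θx) s))))
      transfer : ∀ σ σ′ → facets σ ≡ true → facets σ′ ≡ true → θ ⊑ σ → θ ⊑ σ′ → Y σ ≡ true → Y σ′ ≡ true
      transfer σ σ′ σ∈ σ′∈ sub sub′ Yσ with over-ridge σ σ∈ sub | over-ridge σ′ σ′∈ sub′
      ... | x , θx , refl | x′ , θx′ , refl with ⨁-other (Cycle₂.boundary cY θ) x (∧-intro (not-true θx) Yσ)
      ...   | z , z≢x , h = found (∧-true {not (lookup θ z)} h)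
        where
        in-two : ∀ t → lookup θ t ≡ false → facets (θ ⊞ t) ≡ true → t ≡ first ⊎ t ≡ second
        in-two t θt q = only t (trans (sym (facets-⊞ θ t p s)) (∧-intro (not-true θt) q))
        found : not (lookup θ z) ≡ true × Y (θ ⊞ z) ≡ true → Y (θ ⊞ x′) ≡ true
        found (q , Yz) with x′ ≟ x
        ... | yes refl = Yσ
        ... | no x′≢x with in-two z (not-true⁻¹ q) (Y⊆ _ Yz) | in-two x θx σ∈ | in-two x′ θx′ σ′∈
        ...   | inj₁ refl | inj₁ refl | _         = ⊥-elim (z≢x refl)
        ...   | inj₂ refl | inj₂ refl | _         = ⊥-elim (z≢x refl)
        ...   | inj₁ refl | inj₂ refl | inj₁ refl = Yz
        ...   | inj₂ refl | inj₁ refl | inj₂ refl = Yz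
        ...   | inj₁ refl | inj₂ refl | inj₂ refl = ⊥-elim (x′≢x refl)
        ...   | inj₂ refl | inj₁ refl | inj₁ refl = ⊥-elim (x′≢x refl)
    agree (suc (suc k)) = agree-step k (agree (suc k))
    agree-step k ih θ p s = through
      where
      Over : Fin n → Subset n → Set
      Over x τ = facets τ ≡ true × (lookup τ x ≡ true × Y τ ≡ true) × (∀ i → lookup θ i ≡ true → lookup τ i ≡ true)
      over? : ∀ x → Dec (∃ (Over x))
      over? x = anySubset? λ τ → (facets τ ≟ᵇ true) ×-dec (((lookup τ x ≟ᵇ true) ×-dec (Y τ ≟ᵇ true)) ×-dec all? (λ i → (lookup θ i ≟ᵇ true) →-dec (lookup τ i ≟ᵇ true)))
      -- The colour of x is the common value of Y on the facets above θ ⊞ x. The ends of an edge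
      -- have the same colour, since together with θ they lie in one facet.
      D : Fin n → Bool
      D x = does (over? x)
      D≡ : ∀ x → lookup θ x ≡ false → ∀ τ → facets τ ≡ true → θ ⊑ τ → lookup τ x ≡ true → D x ≡ Y τ
      D≡ x θx τ τ∈ sub τx = ⇔⇒≡ (λ h → let τ′ , τ′∈ , (τ′x , Yτ′) , sub′ = does-true (over? x) h in
          trans (ih (θ ⊞ x) (lk-⊑ ρ (⊑-⊞ θ τ x sub τx) (facets-lk τ τ∈)) size τ τ′ τ∈ τ′∈ (⊑-⊞ θ τ x sub τx) (⊑-⊞ θ τ′ x sub′ τ′x)) Yτ′)
        (λ Yτ → dec-true (over? x) (τ , τ∈ , (τx , Yτ) , sub))
        where
        size : suc k + ∣ θ ⊞ x ∣ ≡ e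
        size = trans (cong (suc k +_) (size-⊞ θ x θx)) (trans (+-suc (suc k) ∣ θ ∣) s)
      extra : ∀ τ → facets τ ≡ true → ∃ λ x → lookup τ x ≡ true × lookup θ x ≡ false
      extra τ τ∈ = ⊑-extra θ τ (≤-trans (s≤s (m≤n+m ∣ θ ∣ (suc k))) (≤-reflexive (trans s (sym (facets-size τ τ∈)))))
      small : 2 + ∣ θ ∪ ρ ∣ ≤ d
      small = ≤-trans (+-monoʳ-≤ 2 (≤-reflexive (size-join p))) (≤-trans (+-monoˡ-≤ ∣ ρ ∣ {2 + ∣ θ ∣} {suc (suc k) + ∣ θ ∣} (+-monoʳ-≤ 2 (m≤n+m ∣ θ ∣ k)))
        (≤-reflexive (trans (cong (_+ ∣ ρ ∣) s) dim)))
      uncrossed : ∀ a b → adjL (θ ∪ ρ) a b ≡ true → D a ≡ D b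
      uncrossed a b h = trans (D≡ a θa τ τ∈ θ⊑τ (sub-τ a (⊞-mono (θ ⊞ a) b (∈-⊞ θ a)))) (sym (D≡ b θb τ τ∈ θ⊑τ (sub-τ b (∈-⊞ (θ ⊞ a) b))))
        where
        h₁ = proj₂ (∧-true {not (a == b)} h)
        va = proj₁ (∧-true {vtx (θ ∪ ρ) a} h₁)
        vb = proj₂ (∧-true {vtx (θ ∪ ρ) a} h₁)
        θa = lk-∪-∉ ρ θ a va
        va′ : lk ρ (θ ⊞ a) ≡ true
        va′ = trans (lk-∪ ρ θ a p θa) va
        vb₁ : vtx ((θ ⊞ a) ∪ ρ) b ≡ true
        vb₁ = trans (cong (λ τ → vtx τ b) (∪-⊞ θ ρ a)) vb
        θab = lk-∪-∉ ρ (θ ⊞ a) b vb₁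
        θb : lookup θ b ≡ false
        θb = ¬true⇒false λ q → true≢false (⊞-mono θ a q) θab
        vb′ : lk ρ (θ ⊞ a ⊞ b) ≡ true
        vb′ = trans (lk-∪ ρ (θ ⊞ a) b va′ θab) vb₁
        ext = extend (θ ⊞ a ⊞ b) vb′
        τ = proj₁ ext
        τ∈ = proj₁ (proj₂ ext)
        sub-τ = proj₂ (proj₂ ext)
        θ⊑τ : θ ⊑ τ
        θ⊑τ i θi = sub-τ i (⊞-mono (θ ⊞ a) b (⊞-mono θ a θi))
      through : ∀ σ σ′ → facets σ ≡ true → facets σ′ ≡ true → θ ⊑ σ → θ ⊑ σ′ → Y σ ≡ Y σ′
      through σ σ′ σ∈ σ′∈ sub sub′ with extra σ σ∈ | extra σ′ σ′∈
      ... | x , σx , θx | x′ , σ′x′ , θx′ = trans (sym (D≡ x θx σ σ∈ sub σx)) (trans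
            (connected (θ ∪ ρ) (lk-face ρ θ p) (join≥1 p) small D uncrossed x x′ (is-vtx x σ σ∈ sub θx σx) (is-vtx x′ σ′ σ′∈ sub′ θx′ σ′x′))
            (D≡ x′ θx′ σ′ σ′∈ sub′ σ′x′))
        where
        is-vtx : ∀ x τ → facets τ ≡ true → θ ⊑ τ → lookup θ x ≡ false → lookup τ x ≡ true → vtx (θ ∪ ρ) x ≡ true
        is-vtx x τ τ∈ sub θx τx = trans (sym (lk-∪ ρ θ x p θx)) (lk-⊑ ρ (⊑-⊞ θ τ x sub τx) (facets-lk τ τ∈))

  facet-vtx : ∀ σ a → facets σ ≡ true → lookup σ a ≡ true → vtx ρ a ≡ true
  facet-vtx σ a σ∈ σa = trans (sym (lk-⁅⁆ ρ a)) (lk-⊑ ρ sub (facets-lk σ σ∈))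
    where
    sub : ⁅ a ⁆ ⊑ σ
    sub i h = subst (λ z → lookup σ z ≡ true) (sym (==⇒≡ (trans (sym (⁅⁆-lookup a i)) h))) σa

  facet-edge : ∀ σ a b → facets σ ≡ true → lookup σ a ≡ true → lookup σ b ≡ true → a ≢ b → adjL ρ a b ≡ true
  facet-edge σ a b σ∈ σa σb a≢b = adjL-intro ρ a b a≢b (lk-disjoint ρ σ lkσ a σa) (lk-disjoint ρ σ lkσ b σb)
    (face-⊑ (⊑-⊞ (ρ ⊞ a) (σ ∪ ρ) b (⊑-⊞ ρ (σ ∪ ρ) a (λ i ρi → trans (∪-lookup σ ρ i) (∨-introʳ {lookup σ i} ρi))
      (trans (∪-lookup σ ρ a) (∨-introˡ σa))) (trans (∪-lookup σ ρ b) (∨-introˡ σb))) (lk-face ρ σ lkσ))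
    where
    lkσ = facets-lk σ σ∈

  record LinkBuilt : Set where
    field
      base      : Subset n
      base∈     : facets base ≡ true
      {verts}   : Fin n → Bool
      {steps}   : ℕ
      built     : Buildable e (adjL ρ) verts (lookup base) steps
      verts≡    : ∀ x → verts x ≡ vtx ρ x

  link-built : 3 ≤ e → ¬ ¬ LinkBuilt
  link-built e≥3 with extend ∅ (lk-∅ ρ ρ∈)
  ... | F , F∈ , _ = ¬¬-bind (minimal-spans (suc (# (outside (vtx ρ) (lookup F)))) e e≥3 facets facets-cycle F F∈ (facets-minimal F F∈)
        (vtx ρ) (lookup F) (λ a p → p) (adjL ρ) (adjL-sym ρ) (record { edges = facet-edge ; inside = facet-vtx }) ≤-refl)
      λ { (spans b cov wit) → ¬¬-return (record { base = F ; base∈ = F∈ ; built = b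
          ; verts≡ = λ x → ⇔⇒≡ (λ h → [ id , facet-vtx F x F∈ ]′ (wit x h)) λ h →
              let σ , σ∈ , sub = extend ⁅ x ⁆ (trans (lk-⁅⁆ ρ x) h) in
              cov σ x σ∈ (sub x (trans (⁅⁆-lookup x x) (==-refl x))) }) }

-- Face numbers of links

absorption : ∀ n k → suc k * (suc n C suc k) ≡ suc n * (n C k)
absorption zero    zero    = refl
absorption zero    (suc k) = *-zeroʳ (2 + k)
absorption (suc n) zero    = trans (+-identityʳ _) (trans (nC1≡n (2 + n)) (sym (*-identityʳ (2 + n))))
absorption (suc n) (suc k) = begin
  (2 + k) * (suc (suc n) C suc (suc k))                        ≡⟨ cong ((2 + k) *_) (sym (nCk+nC[k+1]≡[n+1]C[k+1] (suc n) (suc k))) ⟩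
  (2 + k) * (suc n C suc k + suc n C suc (suc k))              ≡⟨ lemma₁ k (suc n C suc k) (suc n C suc (suc k)) ⟩
  suc k * (suc n C suc k) + suc n C suc k + (2 + k) * (suc n C suc (suc k))
    ≡⟨ cong₂ (λ a b → a + suc n C suc k + b) (absorption n k) (absorption n (suc k)) ⟩
  suc n * (n C k) + suc n C suc k + suc n * (n C suc k)        ≡⟨ lemma₂ (suc n) (n C k) (n C suc k) (suc n C suc k) ⟩
  suc n * (n C k + n C suc k) + suc n C suc k                  ≡⟨ cong (λ a → suc n * a + suc n C suc k) (nCk+nC[k+1]≡[n+1]C[k+1] n k) ⟩
  suc n * (suc n C suc k) + suc n C suc k                      ≡⟨ +-comm (suc n * (suc n C suc k)) _ ⟩
  suc (suc n) * (suc n C suc k) ∎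
  where
  open ≡-Reasoning
  lemma₁ : ∀ k a b → (2 + k) * (a + b) ≡ (1 + k) * a + a + (2 + k) * b
  lemma₁ = solve-∀
  lemma₂ : ∀ n a b c → n * a + c + n * b ≡ n * (a + b) + c
  lemma₂ = solve-∀

choose-2 : ∀ j → 2 * ((2 + j) C j) ≡ (2 + j) * (1 + j)
choose-2 j = trans (cong (2 *_) (trans (nCk≡nC[n∸k] (m≤n+m j 2)) (cong ((2 + j) C_) (m+n∸n≡m 2 j))))
  (trans (absorption (suc j) 1) (cong ((2 + j) *_) (nC1≡n (suc j))))

module FaceNumbers {n} (Δ : Complex n) where

  open Complexes Δ

  count : Subset n → ℕ → ℕ
  count ρ j = ∑ₛ (λ τ → ind (lk ρ τ ∧ does (∣ τ ∣ ≟ₙ j)))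

  deg : Subset n → ℕ
  deg ρ = # (vtx ρ)

  overVertices : Subset n → (Fin n → ℕ) → ℕ
  overVertices ρ f = ∑ (λ v → ind (vtx ρ v) * f v)

  vtx-face : ∀ ρ v → vtx ρ v ≡ true → face Δ (ρ ⊞ v) ≡ true
  vtx-face ρ v h = proj₂ (∧-true {not (lookup ρ v)} h)

  vtx-size : ∀ ρ v → vtx ρ v ≡ true → ∣ ρ ⊞ v ∣ ≡ suc ∣ ρ ∣
  vtx-size ρ v h = size-⊞ ρ v (not-true⁻¹ (proj₁ (∧-true h)))

  overVertices-mono : ∀ ρ {f g : Fin n → ℕ} → (∀ v → vtx ρ v ≡ true → f v ≤ g v) → overVertices ρ f ≤ overVertices ρ g
  overVertices-mono ρ {f} {g} h = ∑-mono pointwise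
    where
    pointwise : ∀ v → ind (vtx ρ v) * f v ≤ ind (vtx ρ v) * g v
    pointwise v with vtx ρ v in eq
    ... | true  = *-monoʳ-≤ 1 (h v eq)
    ... | false = z≤n

  overVertices-+ : ∀ ρ (f g : Fin n → ℕ) → overVertices ρ (λ v → f v + g v) ≡ overVertices ρ f + overVertices ρ g
  overVertices-+ ρ f g = trans (∑-cong λ v → *-distribˡ-+ (ind (vtx ρ v)) (f v) (g v))
    (∑-+ (λ v → ind (vtx ρ v) * f v) (λ v → ind (vtx ρ v) * g v))

  overVertices-* : ∀ ρ c (f : Fin n → ℕ) → overVertices ρ (λ v → c * f v) ≡ c * overVertices ρ f
  overVertices-* ρ c f = trans (∑-cong λ v → swap (ind (vtx ρ v)) c (f v)) (∑-* c (λ v → ind (vtx ρ v) * f v))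
    where
    swap : ∀ a b c → a * (b * c) ≡ b * (a * c)
    swap = solve-∀

  overVertices-const : ∀ ρ c → overVertices ρ (λ _ → c) ≡ c * deg ρ
  overVertices-const ρ c = trans (∑-*ʳ c (ind ∘ vtx ρ)) (*-comm (deg ρ) c)

  count-0 : ∀ ρ → face Δ ρ ≡ true → count ρ 0 ≡ 1
  count-0 ρ p = trans (∑ₛ-single ∅ λ τ τ≢∅ → cong ind (¬true⇒false λ h →
      τ≢∅ (size≡0⇒∅ τ (does-true (∣ τ ∣ ≟ₙ 0) (proj₂ (∧-true {lk ρ τ} h))))))
    (cong ind (∧-intro (lk-∅ ρ p) (dec-true (∣ ∅ {n} ∣ ≟ₙ 0) (∅-size n))))

  -- Pairs of a face of the link of ρ and one of its vertices v: removing v leaves a face of the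
  -- link of ρ ⊞ v.
  double-count : ∀ ρ j → suc j * count ρ (suc j) ≡ overVertices ρ (λ v → count (ρ ⊞ v) j)
  double-count ρ j = begin
    suc j * count ρ (suc j)                                          ≡⟨ sym (∑ₛ-* (suc j) g) ⟩
    ∑ₛ (λ τ → suc j * g τ)                                           ≡⟨ ∑ₛ-cong by-size ⟩
    ∑ₛ (λ τ → ∑ (λ v → ind (lookup τ v) * g τ))                      ≡⟨ ∑ₛ-∑ (λ τ v → ind (lookup τ v) * g τ) ⟩
    ∑ (λ v → ∑ₛ (λ τ → ind (lookup τ v) * g τ))                      ≡⟨ ∑-cong (λ v → ∑ₛ-shift v g) ⟩
    ∑ (λ v → ∑ₛ (λ τ → ind (not (lookup τ v)) * g (τ ⊞ v)))          ≡⟨ ∑-cong (λ v → ∑ₛ-cong (peel v)) ⟩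
    ∑ (λ v → ∑ₛ (λ τ → ind (vtx ρ v) * ind (lk (ρ ⊞ v) τ ∧ does (∣ τ ∣ ≟ₙ j)))) ≡⟨ ∑-cong (λ v → ∑ₛ-* (ind (vtx ρ v)) (λ τ → ind (lk (ρ ⊞ v) τ ∧ does (∣ τ ∣ ≟ₙ j)))) ⟩
    overVertices ρ (λ v → count (ρ ⊞ v) j) ∎
    where
    open ≡-Reasoning
    g : Subset n → ℕ
    g τ = ind (lk ρ τ ∧ does (∣ τ ∣ ≟ₙ suc j))
    by-size : ∀ τ → suc j * g τ ≡ ∑ (λ v → ind (lookup τ v) * g τ)
    by-size τ = sym (trans (∑-*ʳ (g τ) (ind ∘ lookup τ)) (trans (cong (_* g τ) (sym (size≡# τ))) (sized (∣ τ ∣ ≟ₙ suc j))))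
      where
      sized : (dec : Dec (∣ τ ∣ ≡ suc j)) → ∣ τ ∣ * ind (lk ρ τ ∧ does dec) ≡ suc j * ind (lk ρ τ ∧ does dec)
      sized (yes p) = cong (_* ind (lk ρ τ ∧ true)) p
      sized (no _) rewrite ∧-zeroʳ (lk ρ τ) = trans (*-zeroʳ ∣ τ ∣) (sym (*-zeroʳ (suc j)))
    peel : ∀ v τ → ind (not (lookup τ v)) * g (τ ⊞ v) ≡ ind (vtx ρ v) * ind (lk (ρ ⊞ v) τ ∧ does (∣ τ ∣ ≟ₙ j))
    peel v τ with lookup τ v in τv
    ... | true = sym (trans (cong (λ b → ind (vtx ρ v) * ind (b ∧ does (∣ τ ∣ ≟ₙ j))) (¬true⇒false λ h →
            true≢false (∈-⊞ ρ v) (lk-disjoint (ρ ⊞ v) τ h v τv))) (*-zeroʳ (ind (vtx ρ v))))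
    ... | false rewrite lk-⊞ ρ τ v τv | size-⊞ τ v τv = trans (*-identityˡ _)
          (lemma (not (lookup ρ v)) (lk (ρ ⊞ v) τ) (face Δ (ρ ⊞ v)) (does (suc ∣ τ ∣ ≟ₙ suc j)) (does (∣ τ ∣ ≟ₙ j)) has-face same)
      where
      has-face : lk (ρ ⊞ v) τ ≡ true → face Δ (ρ ⊞ v) ≡ true
      has-face h = trans (sym (lk-∅-face (ρ ⊞ v))) (lk-⊑ (ρ ⊞ v) (λ i q → ⊥-elim (true≢false q (∅-lookup i))) h)
      same : does (suc ∣ τ ∣ ≟ₙ suc j) ≡ does (∣ τ ∣ ≟ₙ j)
      same = ⇔⇒≡ (λ h → dec-true (∣ τ ∣ ≟ₙ j) (suc-injective (does-true (suc ∣ τ ∣ ≟ₙ suc j) h)))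
                 (λ h → dec-true (suc ∣ τ ∣ ≟ₙ suc j) (cong suc (does-true (∣ τ ∣ ≟ₙ j) h)))
      lemma : ∀ a b c s t → (b ≡ true → c ≡ true) → s ≡ t → ind ((a ∧ b) ∧ s) ≡ ind (a ∧ c) * ind (b ∧ t)
      lemma a     true  c s t h refl rewrite h refl with a
      ... | true  = sym (+-identityʳ _)
      ... | false = refl
      lemma a false c s t h refl rewrite ∧-zeroʳ a = sym (*-zeroʳ (ind (a ∧ c)))

  count-1 : ∀ ρ → count ρ 1 ≡ deg ρ
  count-1 ρ = trans (sym (*-identityˡ (count ρ 1))) (trans (double-count ρ 0) (∑-cong one))
    where
    one : ∀ v → ind (vtx ρ v) * count (ρ ⊞ v) 0 ≡ ind (vtx ρ v)
    one v with vtx ρ v in eq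
    ... | true  = trans (*-identityˡ _) (count-0 (ρ ⊞ v) (vtx-face ρ v eq))
    ... | false = refl

module LowerBounds {n} (Δ : Complex n) (d : ℕ) (pm : NormalPseudomanifold Δ d) where

  open Complexes Δ
  open FaceNumbers Δ
  open NormalPseudomanifold pm

  record LinkOf (ρ : Subset n) (e : ℕ) : Set where
    constructor linkOf
    field
      isFace   : face Δ ρ ≡ true
      nonempty : 1 ≤ ∣ ρ ∣
      dim      : e + ∣ ρ ∣ ≡ d

  link-⊞ : ∀ {ρ e} → LinkOf ρ (suc e) → ∀ v → vtx ρ v ≡ true → LinkOf (ρ ⊞ v) e
  link-⊞ {ρ} {e} (linkOf f ne dim) v h = linkOf (vtx-face ρ v h) (≤-trans (s≤s z≤n) (≤-reflexive (sym (vtx-size ρ v h))))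
    (trans (cong (e +_) (vtx-size ρ v h)) (trans (+-suc e ∣ ρ ∣) dim))

  -- Barnette's lower bound for the number of edges of a link, with edges counted twice.
  edge-bound : ∀ ρ e → LinkOf ρ e → 3 ≤ e → 2 * e * deg ρ ≤ overVertices ρ (λ v → deg (ρ ⊞ v)) + e * (1 + e)
  edge-bound ρ e (linkOf ρ∈ ρ≥1 dim) e≥3 = decidable-stable (2 * e * deg ρ ≤? overVertices ρ (λ v → deg (ρ ⊞ v)) + e * (1 + e))
    (¬¬-bind (link-built e≥3) (¬¬-return ∘ from-built))
    where
    open LinkCycles Δ d pm ρ ρ∈ ρ≥1 e dim
    from-built : LinkBuilt → 2 * e * deg ρ ≤ overVertices ρ (λ v → deg (ρ ⊞ v)) + e * (1 + e)
    from-built lb = begin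
      2 * e * deg ρ                                   ≡⟨ cong (2 * e *_) (trans (sym (#-cong verts≡)) (trans (buildable-# built) (cong (steps +_) F-size))) ⟩
      2 * e * (steps + e)                             ≡⟨ lemma₁ e steps ⟩
      steps * (e + e) + (e * e + e * e)               ≤⟨ +-mono-≤ (pairs≥ (adjL-sym ρ) (adjL-irrefl ρ) built) (+-monoˡ-≤ (e * e) inner-pairs) ⟩
      pairs (adjL ρ) verts F + ((∑² inner + e) + e * e)   ≡⟨ lemma₂ (pairs (adjL ρ) verts F) (∑² inner) e ⟩
      (pairs (adjL ρ) verts F + ∑² inner) + e * (1 + e)   ≤⟨ +-monoˡ-≤ (e * (1 + e)) total ⟩
      overVertices ρ (λ v → deg (ρ ⊞ v)) + e * (1 + e) ∎
      where
      open ≤-Reasoning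
      open LinkBuilt lb
      F : Fin n → Bool
      F = lookup base
      F-size : # F ≡ e
      F-size = trans (sym (size≡# base)) (facets-size base base∈)
      lemma₁ : ∀ e m → 2 * e * (m + e) ≡ m * (e + e) + (e * e + e * e)
      lemma₁ = solve-∀
      lemma₂ : ∀ p i e → p + ((i + e) + e * e) ≡ (p + i) + e * (1 + e)
      lemma₂ = solve-∀
      inner : Fin n → Fin n → ℕ
      inner a b = ind (F a ∧ F b ∧ not (a == b))
      -- The starting facet is a clique and supplies e (e - 1) ordered pairs; the diagonal is moved
      -- to the other side.
      inner-pairs : e * e ≤ ∑² inner + e
      inner-pairs = ≤-trans (≤-reflexive (trans (sym (cong₂ _*_ F-size F-size)) (sym square)))
        (≤-trans (∑²-mono bound) (≤-reflexive (trans (∑²-+ inner (λ a b → ind (b == a) * ind (F a)))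
          (cong (∑² inner +_) (trans (∑-cong λ a → ∑-select a (λ _ → ind (F a))) F-size)))))
        where
        square : ∑² (λ a b → ind (F a) * ind (F b)) ≡ # F * # F
        square = trans (∑-cong λ a → ∑-* (ind (F a)) (ind ∘ F)) (∑-*ʳ (# F) (ind ∘ F))
        bound : ∀ a b → ind (F a) * ind (F b) ≤ inner a b + ind (b == a) * ind (F a)
        bound a b rewrite ==-sym b a with F a | F b | a == b
        ... | false | _     | _     = z≤n
        ... | true  | false | _     = z≤n
        ... | true  | true  | true  = ≤-refl
        ... | true  | true  | false = ≤-refl
      total : pairs (adjL ρ) verts F + ∑² inner ≤ overVertices ρ (λ v → deg (ρ ⊞ v))
      total = ≤-trans (≤-reflexive (sym (∑²-+ (λ a b → ind (adjacentPair (adjL ρ) verts F a b)) inner)))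
        (≤-trans (∑²-mono bound) (≤-reflexive (∑-cong λ a → ∑-* (ind (vtx ρ a)) (λ b → ind (vtx (ρ ⊞ a) b)))))
        where
        clique : ∀ a b → F a ≡ true → F b ≡ true → not (a == b) ≡ true → adjL ρ a b ≡ true
        clique a b Fa Fb ne = facet-edge base a b base∈ Fa Fb λ { refl → true≢false (==-refl a) (not-true⁻¹ ne) }
        lemma : ∀ u v f g ne p q → (f ≡ true → g ≡ true → ne ≡ true → ne ∧ (p ∧ q) ≡ true) →
          ind (u ∧ v ∧ (ne ∧ (p ∧ q)) ∧ not (f ∧ g)) + ind (f ∧ g ∧ ne) ≤ ind p * ind q
        lemma true  true  true true true  p q h with p | q | h refl refl refl
        ... | true | true | _ = ≤-refl
        lemma true  false true true true  p q h with p | q | h refl refl refl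
        ... | true | true | _ = ≤-refl
        lemma false v     true true true  p q h with p | q | h refl refl refl
        ... | true | true | _ = ≤-refl
        lemma true  true  true true false p q h = z≤n
        lemma true  false true true false p q h = z≤n
        lemma false v     true true false p q h = z≤n
        lemma true  true  true false true  true  true  h = ≤-refl
        lemma true  true  true false true  true  false h = z≤n
        lemma true  true  true false true  false q     h = z≤n
        lemma true  true  true false false p q h = z≤n
        lemma true  false true false ne p q h = z≤n
        lemma false v     true false ne p q h = z≤n
        lemma true  true  false g true  true  true  h = ≤-refl
        lemma true  true  false g true  true  false h = z≤n
        lemma true  true  false g true  false q     h = z≤n
        lemma true  true  false g false p q h = z≤n
        lemma true  false false g ne p q h = z≤n
        lemma false v     false g ne p q h = z≤n
        bound : ∀ a b → ind (adjacentPair (adjL ρ) verts F a b) + inner a b ≤ ind (vtx ρ a) * ind (vtx (ρ ⊞ a) b)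
        bound a b = lemma (verts a) (verts b) (F a) (F b) (not (a == b)) (vtx ρ a) (vtx (ρ ⊞ a) b) (clique a b)

  -- The McMullen–Perles–Walkup reduction: averaging over vertex links turns the bound for edges into bounds for all faces.
  face-bound : ∀ j e ρ → LinkOf ρ e → 2 + j ≤ e → (e C j) * deg ρ ≤ count ρ (suc j) + j * (suc e C suc j)
  face-bound zero e ρ l _ = ≤-trans (≤-reflexive (trans (*-identityˡ (deg ρ)) (sym (count-1 ρ)))) (m≤m+n _ _)
  -- The term j X N is the sum over the vertices of the corrections j X in their links. It is added
  -- on both sides to avoid subtraction; with it the left side becomes 2 (j + 1) X N, which
  -- absorption makes a multiple of the left side of `edge-bound`.
  face-bound (suc j) (suc e) ρ l (s≤s j≤e) = *-cancelˡ-≤ (2 + j) (+-cancelʳ-≤ (j * (X * N)) _ _ (begin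
    (2 + j) * (X * N) + j * (X * N)                            ≡⟨ lemma₁ j X N ⟩
    2 * (suc j * X) * N                                        ≡⟨ cong (λ m → 2 * m * N) (absorption e j) ⟩
    2 * (suc e * (e C j)) * N                                  ≡⟨ lemma₂ (suc e) (e C j) N ⟩
    (e C j) * (2 * suc e * N)                                  ≤⟨ *-monoʳ-≤ (e C j) (edge-bound ρ (suc e) l (≤-trans (s≤s (s≤s (s≤s z≤n))) (s≤s j≤e))) ⟩
    (e C j) * (D + suc e * (2 + e))                            ≡⟨ *-distribˡ-+ (e C j) D (suc e * (2 + e)) ⟩
    (e C j) * D + (e C j) * (suc e * (2 + e))                  ≤⟨ +-monoˡ-≤ _ averaged ⟩
    (2 + j) * count ρ (2 + j) + j * X * N + (e C j) * (suc e * (2 + e))   ≡⟨ cong ((2 + j) * count ρ (2 + j) + j * X * N +_) choose-shift ⟩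
    (2 + j) * count ρ (2 + j) + j * X * N + suc j * ((2 + j) * Y)         ≡⟨ lemma₃ j (count ρ (2 + j)) X N Y ⟩
    (2 + j) * (count ρ (2 + j) + suc j * Y) + j * (X * N) ∎))
    where
    open ≤-Reasoning
    X = suc e C suc j
    Y = suc (suc e) C suc (suc j)
    N = deg ρ
    D = overVertices ρ (λ v → deg (ρ ⊞ v))
    lemma₁ : ∀ j X N → (2 + j) * (X * N) + j * (X * N) ≡ 2 * ((1 + j) * X) * N
    lemma₁ = solve-∀
    lemma₂ : ∀ e x N → 2 * (e * x) * N ≡ x * (2 * e * N)
    lemma₂ = solve-∀
    lemma₃ : ∀ j c X N Y → (2 + j) * c + j * X * N + (1 + j) * ((2 + j) * Y) ≡ (2 + j) * (c + (1 + j) * Y) + j * (X * N)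
    lemma₃ = solve-∀
    averaged : (e C j) * D ≤ (2 + j) * count ρ (2 + j) + j * X * N
    averaged = begin
      (e C j) * D                                                     ≡⟨ sym (overVertices-* ρ (e C j) (λ v → deg (ρ ⊞ v))) ⟩
      overVertices ρ (λ v → (e C j) * deg (ρ ⊞ v))                    ≤⟨ overVertices-mono ρ (λ v h → face-bound j e (ρ ⊞ v) (link-⊞ l v h) j≤e) ⟩
      overVertices ρ (λ v → count (ρ ⊞ v) (suc j) + j * X)            ≡⟨ overVertices-+ ρ (λ v → count (ρ ⊞ v) (suc j)) (λ _ → j * X) ⟩
      overVertices ρ (λ v → count (ρ ⊞ v) (suc j)) + overVertices ρ (λ _ → j * X)
        ≡⟨ cong₂ _+_ (sym (double-count ρ (suc j))) (overVertices-const ρ (j * X)) ⟩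
      (2 + j) * count ρ (2 + j) + j * X * N ∎
    choose-shift : (e C j) * (suc e * (2 + e)) ≡ suc j * ((2 + j) * Y)
    choose-shift = begin-equality
      (e C j) * (suc e * (2 + e))    ≡⟨ reorder (e C j) (suc e) (2 + e) ⟩
      (2 + e) * (suc e * (e C j))    ≡⟨ cong ((2 + e) *_) (sym (absorption e j)) ⟩
      (2 + e) * (suc j * X)          ≡⟨ reorder′ (2 + e) (suc j) X ⟩
      suc j * ((2 + e) * X)          ≡⟨ cong (suc j *_) (sym (absorption (suc e) (suc j))) ⟩
      suc j * ((2 + j) * Y) ∎
      where
      reorder : ∀ a b c → a * (b * c) ≡ c * (b * a)
      reorder = solve-∀
      reorder′ : ∀ a b c → a * (b * c) ≡ b * (a * c)
      reorder′ = solve-∀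

  ridge-deg : ∀ ρ → LinkOf ρ 1 → deg ρ ≡ 2
  ridge-deg ρ (linkOf f ne dim) = trans (#-adjoin second (==-≢ (distinct ∘ sym)) members) (cong suc (#-== first))
    where
    open Two (ridge ρ f ne dim)
    members : ∀ x → vtx ρ x ≡ x == first ∨ x == second
    members x with x ≟ first | x ≟ second
    ... | yes refl | _        = first∈
    ... | no _     | yes refl = second∈
    ... | no ≢₁    | no ≢₂    = ¬true⇒false λ h → [ ≢₁ , ≢₂ ]′ (only x h)

  -- A facet has e + 1 ridges and a ridge lies in two facets. The identity is passed down to links
  -- of vertices until the link is a pair of points.
  facet-count : ∀ e ρ → LinkOf ρ (suc e) → suc e * count ρ (suc e) ≡ 2 * count ρ e
  facet-count zero ρ l = trans (*-identityˡ _) (trans (count-1 ρ) (trans (ridge-deg ρ l) (cong (2 *_) (sym (count-0 ρ (LinkOf.isFace l))))))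
  facet-count (suc e) ρ l = *-cancelˡ-≡ _ _ (suc e) (begin
    suc e * (suc (suc e) * count ρ (suc (suc e)))              ≡⟨ cong (suc e *_) (double-count ρ (suc e)) ⟩
    suc e * overVertices ρ (λ v → count (ρ ⊞ v) (suc e))       ≡⟨ sym (overVertices-* ρ (suc e) (λ v → count (ρ ⊞ v) (suc e))) ⟩
    overVertices ρ (λ v → suc e * count (ρ ⊞ v) (suc e))       ≡⟨ ∑-cong by-induction ⟩
    overVertices ρ (λ v → 2 * count (ρ ⊞ v) e)                 ≡⟨ overVertices-* ρ 2 (λ v → count (ρ ⊞ v) e) ⟩
    2 * overVertices ρ (λ v → count (ρ ⊞ v) e)                 ≡⟨ cong (2 *_) (sym (double-count ρ e)) ⟩
    2 * (suc e * count ρ (suc e))                              ≡⟨ reorder 2 (suc e) (count ρ (suc e)) ⟩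
    suc e * (2 * count ρ (suc e)) ∎)
    where
    open ≡-Reasoning
    reorder : ∀ a b c → a * (b * c) ≡ b * (a * c)
    reorder = solve-∀
    by-induction : ∀ v → ind (vtx ρ v) * (suc e * count (ρ ⊞ v) (suc e)) ≡ ind (vtx ρ v) * (2 * count (ρ ⊞ v) e)
    by-induction v with vtx ρ v in eq
    ... | true  = cong (1 *_) (facet-count e (ρ ⊞ v) (link-⊞ l v eq))
    ... | false = refl

  -- `face-bound` ends one dimension below the facets. Its last instance bounds the ridges, and
  -- `facet-count` turns ridges into facets.
  facet-bound : ∀ j ρ → LinkOf ρ (2 + j) → (1 + j) * deg ρ ≤ count ρ (2 + j) + (3 + j) * j
  facet-bound j ρ l = *-cancelˡ-≤ (2 + j) (begin
    (2 + j) * ((1 + j) * deg ρ)                                ≡⟨ trans (sym (*-assoc (2 + j) (1 + j) (deg ρ))) (cong (_* deg ρ) (sym (choose-2 j))) ⟩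
    2 * ((2 + j) C j) * deg ρ                                  ≡⟨ *-assoc 2 ((2 + j) C j) (deg ρ) ⟩
    2 * (((2 + j) C j) * deg ρ)                                ≤⟨ *-monoʳ-≤ 2 (face-bound j (2 + j) ρ l ≤-refl) ⟩
    2 * (count ρ (suc j) + j * ((3 + j) C suc j))              ≡⟨ lemma₁ (count ρ (suc j)) j ((3 + j) C suc j) ⟩
    2 * count ρ (suc j) + j * (2 * ((3 + j) C suc j))          ≡⟨ cong₂ (λ a b → a + j * b) (sym (facet-count (suc j) ρ l)) (choose-2 (suc j)) ⟩
    (2 + j) * count ρ (2 + j) + j * ((3 + j) * (2 + j))        ≡⟨ lemma₂ j (count ρ (2 + j)) ⟩
    (2 + j) * (count ρ (2 + j) + (3 + j) * j) ∎)
    where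
    open ≤-Reasoning
    lemma₁ : ∀ c j x → 2 * (c + j * x) ≡ 2 * c + j * (2 * x)
    lemma₁ = solve-∀
    lemma₂ : ∀ j c → (2 + j) * c + j * ((3 + j) * (2 + j)) ≡ (2 + j) * (c + (3 + j) * j)
    lemma₂ = solve-∀

-- First homology and spanning forests

module SpanningEdges {c ℓ} (K : Field c ℓ) {n} (Δ : Complex n) where

  open Field K
    using (Carrier; _≈_; 0#; 1#; ring; semiring; setoid; *-cong; -‿cong; zeroˡ; zeroʳ; -‿inverseʳ; distribˡ)
    renaming (_+_ to _⊕_; _*_ to _⊛_; -_ to ⊖_; refl to ≈-refl; sym to ≈-sym; trans to ≈-trans; reflexive to ≈-reflexive;
      +-cong to ⊕-cong; +-identityˡ to ⊕-identityˡ; +-identityʳ to ⊕-identityʳ; +-assoc to ⊕-assoc; +-comm to ⊕-comm;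
      *-identityˡ to ⊛-identityˡ; *-identityʳ to ⊛-identityʳ; *-assoc to ⊛-assoc; distribʳ to ⊛-distribʳ)
  open Homology K
  open RingProperties ring using (-0#≈0#; -‿involutive; -1*x≈-x; -‿+-comm; -‿distribʳ-*)
  open SemiringSum semiring using (sum; sum-cong-≋; ∑-distrib-+; *-distribˡ-sum)
  open FieldChains K
  open Complexes Δ

  Edges : Set
  Edges = List (Fin n × Fin n)

  -- The linear span of T together with the boundaries of 2-chains. As an inductive predicate it
  -- needs no bookkeeping of coefficients; these are extracted once, by `spanned-decompose`.
  data Spanned (T : Edges) : Chain n → Set (c ⊔ ℓ) where
    gen      : ∀ {a b} → (a , b) ∈ T → Spanned T (edge a b)
    boundary : ∀ w → IsChain (face Δ) 3 w → Spanned T (∂ w)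
    add      : ∀ {z z′} → Spanned T z → Spanned T z′ → Spanned T (λ σ → z σ ⊕ z′ σ)
    scale    : ∀ k {z} → Spanned T z → Spanned T (λ σ → k ⊛ z σ)
    resp     : ∀ {z z′} → (∀ σ → z σ ≈ z′ σ) → Spanned T z → Spanned T z′

  spanned-zero : ∀ {T z} → (∀ σ → z σ ≈ 0#) → Spanned T z
  spanned-zero h = resp (λ σ → ≈-trans (∂-zero (λ _ → ≈-refl) σ) (≈-sym (h σ))) (boundary (λ _ → 0#) (λ _ _ → ≈-refl))

  spanned-sum : ∀ {T k} (f : Fin k → Chain n) → (∀ i → Spanned T (f i)) → Spanned T (λ σ → sum (λ i → f i σ))
  spanned-sum {k = zero}  f h = spanned-zero (λ _ → ≈-refl)
  spanned-sum {k = suc k} f h = add (h zero) (spanned-sum (f ∘ suc) (h ∘ suc))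

  spanned-++ : ∀ {T z} (T′ : Edges) → Spanned T z → Spanned (T′ List.++ T) z
  spanned-++ T′ (gen p)        = gen (∈-++⁺ʳ T′ p)
  spanned-++ T′ (boundary w h) = boundary w h
  spanned-++ T′ (add s s′)     = add (spanned-++ T′ s) (spanned-++ T′ s′)
  spanned-++ T′ (scale k s)    = scale k (spanned-++ T′ s)
  spanned-++ T′ (resp h s)     = resp h (spanned-++ T′ s)

  spanned-flip : ∀ {T} (a b : Fin n) → a ≢ b → Spanned T (edge a b) → Spanned T (edge b a)
  spanned-flip a b a≢b s = resp (λ σ → ≈-trans (-1*x≈-x (edge a b σ)) (≈-sym (edge-flip a b a≢b σ))) (scale (⊖ 1#) s)

  spanned-triangle : ∀ {T} (a b e : Fin n) → a ≢ b → b ≢ e → e ≢ a → face Δ (∅ ⊞ a ⊞ b ⊞ e) ≡ true →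
    Spanned T (edge a b) → Spanned T (edge b e) → Spanned T (edge a e)
  spanned-triangle a b e a≢b b≢e e≢a f sab sbe with triangle a b e a≢b b≢e e≢a
  ... | w , supp , bdry = resp pointwise (add (add sab sbe) (scale (⊖ 1#) (boundary w chain)))
    where
    chain : IsChain (face Δ) 3 w
    chain σ (inj₁ p) = supp σ λ { refl → true≢false f p }
    chain σ (inj₂ p) = supp σ λ { refl → p (trans (size-⊞ (∅ ⊞ a ⊞ b) e (trans (⊞-other (∅ ⊞ a) (b≢e ∘ sym)) (trans (⊞-other ∅ e≢a) (∅-lookup e))))
      (cong suc (size-pair a b a≢b))) }
    pointwise : ∀ σ → (edge a b σ ⊕ edge b e σ) ⊕ (⊖ 1# ⊛ ∂ w σ) ≈ edge a e σ
    pointwise σ = begin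
      (x ⊕ y) ⊕ (⊖ 1# ⊛ ∂ w σ)      ≈⟨ ⊕-cong ≈-refl (≈-trans (-1*x≈-x (∂ w σ)) (-‿cong (≈-trans (bdry σ) (≈-sym (⊕-assoc x y z))))) ⟩
      (x ⊕ y) ⊕ ⊖ ((x ⊕ y) ⊕ z)     ≈⟨ ⊕-cong ≈-refl (≈-sym (-‿+-comm (x ⊕ y) z)) ⟩
      (x ⊕ y) ⊕ (⊖ (x ⊕ y) ⊕ ⊖ z)   ≈⟨ ≈-sym (⊕-assoc (x ⊕ y) (⊖ (x ⊕ y)) (⊖ z)) ⟩
      ((x ⊕ y) ⊕ ⊖ (x ⊕ y)) ⊕ ⊖ z   ≈⟨ ⊕-cong (-‿inverseʳ (x ⊕ y)) ≈-refl ⟩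
      0# ⊕ ⊖ z                      ≈⟨ ⊕-identityˡ (⊖ z) ⟩
      ⊖ z                           ≈⟨ ≈-sym (edge-flip e a e≢a σ) ⟩
      edge a e σ                    ∎
      where
      open import Relation.Binary.Reasoning.Setoid setoid
      x = edge a b σ
      y = edge b e σ
      z = edge e a σ

  edgeAt : (T : Edges) → Fin (length T) → Chain n
  edgeAt T i = edge (proj₁ (List.lookup T i)) (proj₂ (List.lookup T i))

  combination : (T : Edges) → (Fin (length T) → Carrier) → Chain n
  combination T t σ = sum (λ i → t i ⊛ edgeAt T i σ)

  spanned-decompose : ∀ {T z} → Spanned T z → Σ (Fin (length T) → Carrier) λ t → Σ (Chain n) λ w →
    IsChain (face Δ) 3 w × (∀ σ → z σ ≈ combination T t σ ⊕ ∂ w σ)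
  spanned-decompose {T} (gen {a} {b} p) = (λ j → δ (j == i)) , (λ _ → 0#) , (λ _ _ → ≈-refl) , λ σ → ≈-sym
    (≈-trans (⊕-cong (≈-trans (sum-single i λ j j≢i → ≈-trans (*-cong (≈-reflexive (cong δ (==-≢ j≢i))) ≈-refl) (zeroˡ _))
        (≈-trans (*-cong (≈-reflexive (cong δ (==-refl i))) ≈-refl) (≈-trans (⊛-identityˡ _)
          (≈-reflexive (cong (λ q → edge (proj₁ q) (proj₂ q) σ) (sym (lookup-index p)))))))
      (∂-zero (λ _ → ≈-refl) σ)) (⊕-identityʳ _))
    where
    i = Any.index p
  spanned-decompose {T} (boundary w h) = (λ _ → 0#) , w , h , λ σ → ≈-sym
    (≈-trans (⊕-cong (sum-zero λ i → zeroˡ (edgeAt T i σ)) ≈-refl) (⊕-identityˡ _))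
  spanned-decompose {T} (add {z} {z′} s s′) with spanned-decompose s | spanned-decompose s′
  ... | t , w , h , eq | t′ , w′ , h′ , eq′ = (λ i → t i ⊕ t′ i) , (λ σ → w σ ⊕ w′ σ)
    , (λ σ p → ≈-trans (⊕-cong (h σ p) (h′ σ p)) (⊕-identityˡ 0#)) , λ σ → ≈-trans (⊕-cong (eq σ) (eq′ σ))
      (≈-trans (interchange _ _ _ _) (⊕-cong (≈-trans (≈-sym (∑-distrib-+ (λ i → t i ⊛ edgeAt T i σ) (λ i → t′ i ⊛ edgeAt T i σ)))
        (sum-cong-≋ λ i → ≈-sym (⊛-distribʳ (edgeAt T i σ) (t i) (t′ i)))) (≈-sym (∂-+ w w′ σ))))
    where
    interchange : ∀ p q r s → (p ⊕ q) ⊕ (r ⊕ s) ≈ (p ⊕ r) ⊕ (q ⊕ s)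
    interchange p q r s = ≈-trans (⊕-assoc p q (r ⊕ s)) (≈-trans (⊕-cong ≈-refl (≈-trans (≈-sym (⊕-assoc q r s))
      (≈-trans (⊕-cong (⊕-comm q r) ≈-refl) (⊕-assoc r q s)))) (≈-sym (⊕-assoc p r (q ⊕ s))))
  spanned-decompose {T} (scale k s) with spanned-decompose s
  ... | t , w , h , eq = (λ i → k ⊛ t i) , (λ σ → k ⊛ w σ) , (λ σ p → ≈-trans (*-cong ≈-refl (h σ p)) (zeroʳ k)) ,
    λ σ → ≈-trans (*-cong ≈-refl (eq σ)) (≈-trans (distribˡ k _ _) (⊕-cong
      (≈-trans (*-distribˡ-sum k (λ i → t i ⊛ edgeAt T i σ)) (sum-cong-≋ λ i → ≈-sym (⊛-assoc k (t i) (edgeAt T i σ)))) (≈-sym (∂-* k w σ))))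
  spanned-decompose (resp h s) with spanned-decompose s
  ... | t , w , h′ , eq = t , w , h′ , λ σ → ≈-trans (≈-sym (h σ)) (eq σ)

  -- Edges of T do not cross D, and boundaries have no cut because the boundary of a boundary
  -- vanishes.
  cut-spanned : ∀ {T z} (D : Fin n → Bool) → (∀ a b → (a , b) ∈ T → D a ≡ D b) → Spanned T z → cut D z ≈ 0#
  cut-spanned D closed (gen {a} {b} p) = ≈-trans (cut-edge D a b) (x-x (≈-reflexive (cong δ (sym (closed a b p)))))
  cut-spanned D closed (boundary w h) = cut-zero D {∂ w} (λ x → ∂∂≈0 w ⁅ x ⁆)
  cut-spanned D closed (add {z} {z′} s s′) = ≈-trans (cut-+ D z z′) (≈-trans (⊕-cong (cut-spanned D closed s) (cut-spanned D closed s′)) (⊕-identityˡ 0#))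
  cut-spanned D closed (scale k {z} s) = ≈-trans (cut-* D k z) (≈-trans (*-cong ≈-refl (cut-spanned D closed s)) (zeroʳ k))
  cut-spanned D closed (resp {z} {z′} h s) = ≈-trans (≈-sym (cut-cong D {z} {z′} λ x → ∂-cong h ⁅ x ⁆)) (cut-spanned D closed s)

  Spanning : Subset n → Edges → Set (c ⊔ ℓ)
  Spanning A T = ∀ a b → lookup A a ≡ true → lookup A b ≡ true → a ≢ b → face Δ (∅ ⊞ a ⊞ b) ≡ true → Spanned T (edge a b)

  -- With an empty forbidden set, `rep` picks the least vertex of every component of the part of the
  -- link of v present in A.
  laterReps : Subset n → Fin n → Fin n → Bool
  laterReps A v = rep (adjL ⁅ v ⁆) (A ∩ᵇ vtx ⁅ v ⁆) (λ _ → false)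

  newEdges : Subset n → Fin n → Edges
  newEdges A v = List.map (v ,_) (trues (laterReps A v))

  -- One edge from v to each component of its link in A suffices: within a component, the edges at v differ
  -- by edges of A and boundaries of triangles.
  spanning-⊞ : ∀ A T v → lookup A v ≡ false → Spanning A T → ¬ ¬ Spanning (A ⊞ v) (newEdges A v List.++ T)
  -- The closed set D below has to be a set of booleans, so for all b at once it is decided, under
  -- double negation, whether the edge from v to b is spanned.
  spanning-⊞ A T v v∉A span = ¬¬-bind (¬¬-Fin λ b → ¬¬-excluded-middle {A = Spanned T′ (edge v b)}) (¬¬-return ∘ from-decisions)
    where
    T′ = newEdges A v List.++ T
    adj = adjL ⁅ v ⁆
    S : Fin n → Bool
    S = A ∩ᵇ vtx ⁅ v ⁆
    module Decided (good? : ∀ b → Dec (Spanned T′ (edge v b))) where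
      D : Subset n
      D = tabulate (λ x → S x ∧ does (good? x))
      look : ∀ x → lookup D x ≡ S x ∧ does (good? x)
      look x = lookup∘tabulate _ x
      S≢v : ∀ x → S x ≡ true → x ≢ v
      S≢v x Sx refl = true≢false (proj₁ (∧-true Sx)) v∉A
      D-closed : Closed adj S D
      D-closed = (λ x p → proj₁ (∧-true (trans (sym (look x)) p))) , λ x y p Sy xy →
        let Sx , gx = ∧-true {S x} (trans (sym (look x)) p)
            h = proj₂ (∧-true {not (x == y)} xy)
            x≢y : x ≢ y
            x≢y = λ { refl → true≢false xy (adjL-irrefl ⁅ v ⁆ x) }
            fxy : face Δ (∅ ⊞ v ⊞ x ⊞ y) ≡ true
            fxy = trans (cong (λ τ → face Δ (τ ⊞ x ⊞ y)) (sym (⁅⁆≡∅⊞ v))) (vtx-face′ (⁅ v ⁆ ⊞ x) y (proj₂ (∧-true {vtx ⁅ v ⁆ x} h)))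
            x-y = spanned-++ (newEdges A v) (span x y (proj₁ (∧-true Sx)) (proj₁ (∧-true Sy)) x≢y
                    (face-⊑ (⊑-⊞ (∅ ⊞ x) (∅ ⊞ v ⊞ x ⊞ y) y (⊑-⊞ ∅ (∅ ⊞ v ⊞ x ⊞ y) x (λ i q → ⊥-elim (true≢false q (∅-lookup i))) (⊞-mono (∅ ⊞ v ⊞ x) y (∈-⊞ (∅ ⊞ v) x))) (∈-⊞ (∅ ⊞ v ⊞ x) y)) fxy))
        in trans (look y) (∧-intro Sy (dec-true (good? y)
          (spanned-triangle v x y (S≢v x Sx ∘ sym) x≢y (S≢v y Sy) fxy (does-true (good? x) gx) x-y)))
        where
        vtx-face′ : ∀ ρ y → vtx ρ y ≡ true → face Δ (ρ ⊞ y) ≡ true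
        vtx-face′ ρ y q = proj₂ (∧-true {not (lookup ρ y)} q)
      at-v : ∀ b → b ≢ v → lookup A b ≡ true → face Δ (∅ ⊞ v ⊞ b) ≡ true → Spanned T′ (edge v b)
      at-v b b≢v Ab f = does-true (good? b) (proj₂ (∧-true {S b} (trans (sym (look b)) (conn-elim adj S rb D D-closed Dr))))
        where
        Sb : S b ≡ true
        Sb = ∧-intro Ab (∧-intro (not-true (trans (⁅⁆-lookup v b) (==-≢ b≢v))) (trans (cong (λ τ → face Δ (τ ⊞ b)) (⁅⁆≡∅⊞ v)) f))
        found = closed-has-rep adj S (λ _ → false) (comp adj S b) (comp-closed adj S b Sb) (λ _ _ → refl) b (comp-self adj S b)
        r = proj₁ found
        br : conn adj S b r ≡ true
        br = trans (sym (comp-lookup adj S b r)) (proj₁ (proj₂ found))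
        rb : conn adj S r b ≡ true
        rb = conn-sym adj (adjL-sym ⁅ v ⁆) S Sb br
        Dr : lookup D r ≡ true
        Dr = trans (look r) (∧-intro (proj₁ (does-true (rep? adj S (λ _ → false) r) (proj₂ (proj₂ found))))
          (dec-true (good? r) (gen (∈-++⁺ˡ (∈-map⁺ (v ,_) (∈-trues (laterReps A v) r (proj₂ (proj₂ found))))))))
    from-decisions : (∀ b → Dec (Spanned T′ (edge v b))) → Spanning (A ⊞ v) T′
    from-decisions good? a b Aa Ab a≢b f with a ≟ v | b ≟ v
    ... | yes refl | yes refl = ⊥-elim (a≢b refl)
    ... | no a≢v   | no b≢v   = spanned-++ (newEdges A v) (span a b (trans (sym (⊞-other A a≢v)) Aa) (trans (sym (⊞-other A b≢v)) Ab) a≢b f)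
    ... | yes refl | no b≢v   = Decided.at-v good? b b≢v (trans (sym (⊞-other A b≢v)) Ab) f
    ... | no a≢v   | yes refl = spanned-flip b a (a≢b ∘ sym)
            (Decided.at-v good? a a≢v (trans (sym (⊞-other A a≢v)) Aa) (trans (cong (face Δ) (⊞-comm ∅ b a)) f))

  cycle-spanned : ∀ {T} → Spanning (tabulate (λ _ → true)) T → ∀ z → IsCycle (face Δ) 2 z → Spanned T z
  cycle-spanned {T} span z (z-chain , _) = resp (λ σ → ≈-sym (expansion σ)) (spanned-sum _ λ a → spanned-sum _ (term-spanned a))
    where
    term : Fin n → Fin n → Chain n
    term a b σ = if a <ᵇ′ b then z (∅ ⊞ a ⊞ b) ⊛ edge a b σ else 0#
    all : ∀ x → lookup (tabulate {n = n} (λ _ → true)) x ≡ true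
    all x = lookup∘tabulate _ x
    term-spanned : ∀ a b → Spanned T (term a b)
    term-spanned a b = by-order (a <ᵇ′ b) refl
      where
      by-order : ∀ q → (a <ᵇ′ b) ≡ q → Spanned T (λ σ → if q then z (∅ ⊞ a ⊞ b) ⊛ edge a b σ else 0#)
      by-order false _ = spanned-zero (λ _ → ≈-refl)
      by-order true  h with face Δ (∅ ⊞ a ⊞ b) in f
      ... | true  = scale (z (∅ ⊞ a ⊞ b)) (span a b (all a) (all b) (λ { refl → <-irrefl refl (does-true (a Fin.<? b) h) }) f)
      ... | false = spanned-zero λ σ → ≈-trans (*-cong (z-chain (∅ ⊞ a ⊞ b) (inj₁ f)) ≈-refl) (zeroˡ _)
    term-zero : ∀ a b σ → (a Fin.< b → σ ≢ ∅ ⊞ a ⊞ b) → term a b σ ≈ 0#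
    term-zero a b σ h = by-order (a <ᵇ′ b) refl
      where
      by-order : ∀ q → (a <ᵇ′ b) ≡ q → (if q then z (∅ ⊞ a ⊞ b) ⊛ edge a b σ else 0#) ≈ 0#
      by-order false _ = ≈-refl
      by-order true  p = ≈-trans (*-cong ≈-refl (edge-≢ a b σ (h (does-true (a Fin.<? b) p)))) (zeroʳ _)
    expansion : ∀ σ → z σ ≈ sum (λ a → sum (λ b → term a b σ))
    expansion σ with ∣ σ ∣ ≟ₙ 2
    ... | no ¬2 = ≈-trans (z-chain σ (inj₂ ¬2)) (≈-sym (sum-zero λ a → sum-zero λ b →
            term-zero a b σ λ { a<b refl → ¬2 (size-pair a b λ { refl → <-irrefl refl a<b }) }))
    ... | yes p with size≡2⇒pair σ p
    ...   | a , b , a<b , refl = ≈-sym (≈-trans (sum-single a λ a′ a′≢a → sum-zero λ b′ → term-zero a′ b′ (∅ ⊞ a ⊞ b) λ a′<b′ h → a′≢a (first a′ b′ a′<b′ h))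
            (≈-trans (sum-single b λ b′ b′≢b → term-zero a b′ (∅ ⊞ a ⊞ b) λ a<b′ h → b′≢b (second b′ a<b′ h)) self))
      where
      a≢b : a ≢ b
      a≢b refl = <-irrefl refl a<b
      first : ∀ a′ b′ → a′ Fin.< b′ → ∅ ⊞ a ⊞ b ≡ ∅ ⊞ a′ ⊞ b′ → a′ ≡ a
      first a′ b′ a′<b′ h with pair-≡ a b a′ b′ a≢b h
      ... | inj₁ (q , _) = sym q
      ... | inj₂ (refl , refl) = ⊥-elim (<-asym a<b a′<b′)
      second : ∀ b′ → a Fin.< b′ → ∅ ⊞ a ⊞ b ≡ ∅ ⊞ a ⊞ b′ → b′ ≡ b
      second b′ a<b′ h with pair-≡ a b a b′ a≢b h
      ... | inj₁ (_ , q) = sym q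
      ... | inj₂ (_ , q) = ⊥-elim (a≢b (sym q))
      self : term a b (∅ ⊞ a ⊞ b) ≈ z (∅ ⊞ a ⊞ b)
      self rewrite <ᵇ′-true a<b | dec-true ((∅ ⊞ a ⊞ b) ≟ₛ (∅ ⊞ a ⊞ b)) refl = ⊛-identityʳ _

  isVertex : Fin n → Bool
  isVertex x = face Δ ⁅ x ⁆

  -- A spanning set with fewer edges than vertices is a tree, so it carries no cycle.
  tree⇒acyclic : ∀ T → Spanning (tabulate (λ _ → true)) T → suc (length T) ≤ # isVertex → Connected Δ → HasBetti (face Δ) 2 0
  tree⇒acyclic T span few conn-Δ = (λ ()) , (λ ()) , (λ _ _ ()) , bounds
    where
    all : ∀ x → lookup (tabulate {n = n} (λ _ → true)) x ≡ true
    all x = lookup∘tabulate _ x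
    -- Each edge of Δ is spanned by T, so a colouring constant on the edges of T has zero cut on it
    -- and is constant along it.
    constant : (D : Fin n → Bool) → (∀ a b → (a , b) ∈ T → D a ≡ D b) → ∀ {x x′} → Reach Δ x x′ → D x ≡ D x′
    constant D closed here = refl
    constant D closed (step {u} {v} f r) = trans (along (u ≟ v)) (constant D closed r)
      where
      f′ : face Δ (∅ ⊞ u ⊞ v) ≡ true
      f′ = trans (cong (face Δ) (sym (trans (∪⁅⁆ ⁅ u ⁆ v) (cong (_⊞ v) (⁅⁆≡∅⊞ u))))) (T⇒true f)
      along : Dec (u ≡ v) → D u ≡ D v
      along (yes refl) = refl
      along (no u≢v) = sym (δ-injective (D v) (D u) (≈-trans (≈-sym (cut-edge D u v)) (cut-spanned D closed (span u v (all u) (all v) u≢v f′))))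
    bounds : ∀ y → IsCycle (face Δ) 2 y → Σ (Fin 0 → Carrier) λ a → IsBoundary (face Δ) 2 (λ σ → y σ ⊕ ⊖ lincomb a (λ ()) σ)
    bounds y cyc with spanned-decompose (cycle-spanned span y cyc)
    ... | t , w , w-chain , eq = (λ ()) , w , w-chain , λ σ → ≈-sym (≈-trans (x-0 ≈-refl)
          (≈-trans (eq σ) (≈-trans (⊕-cong (sum-zero λ i → ≈-trans (*-cong (t≈0 i) ≈-refl) (zeroˡ (edgeAt T i σ))) ≈-refl) (⊕-identityˡ _))))
      where
      -- The colouring is constant on every edge of T except possibly edge i. If it were constant
      -- there too, it would be constant on the connected complex Δ. So edge i crosses, and the cut
      -- of the cycle y, which is zero, equals its coefficient up to sign.
      t≈0 : ∀ i → t i ≈ 0#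
      t≈0 i with separating-colouring (List.lookup T) isVertex few i
      ... | D , closed , x , x′ , Vx , Vx′ , Dx , Dx′ = unit (D a) (D b) refl refl
        where
        a = proj₁ (List.lookup T i)
        b = proj₂ (List.lookup T i)
        flow : t i ⊛ (δ (D b) ⊕ ⊖ δ (D a)) ≈ 0#
        flow = begin
          t i ⊛ (δ (D b) ⊕ ⊖ δ (D a))                ≈⟨ *-cong ≈-refl (≈-sym (cut-edge D a b)) ⟩
          t i ⊛ cut D (edgeAt T i)                   ≈⟨ ≈-sym (sum-single i λ j j≢i → ≈-trans (*-cong ≈-refl (≈-trans
                                                         (cut-edge D (proj₁ (List.lookup T j)) (proj₂ (List.lookup T j)))
                                                         (x-x (≈-reflexive (cong δ (sym (closed j j≢i))))))) (zeroʳ (t j))) ⟩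
          sum (λ j → t j ⊛ cut D (edgeAt T j))       ≈⟨ ≈-sym (cut-sum D t (edgeAt T)) ⟩
          cut D (combination T t)                    ≈⟨ ≈-sym (⊕-identityʳ _) ⟩
          cut D (combination T t) ⊕ 0#               ≈⟨ ⊕-cong ≈-refl (≈-sym (cut-zero D {∂ w} (λ x → ∂∂≈0 w ⁅ x ⁆))) ⟩
          cut D (combination T t) ⊕ cut D (∂ w)      ≈⟨ ≈-sym (cut-+ D (combination T t) (∂ w)) ⟩
          cut D (λ σ → combination T t σ ⊕ ∂ w σ)    ≈⟨ ≈-sym (cut-cong D {y} {λ σ → combination T t σ ⊕ ∂ w σ} λ x → ∂-cong eq ⁅ x ⁆) ⟩
          cut D y                                    ≈⟨ cut-zero D {y} (λ x → proj₂ cyc ⁅ x ⁆) ⟩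
          0# ∎
          where open import Relation.Binary.Reasoning.Setoid setoid
        uncut : D a ≡ D b → ⊥
        uncut same = true≢false Dx (trans (constant D everywhere (conn-Δ x x′ (true⇒T Vx) (true⇒T Vx′))) Dx′)
          where
          at : ∀ j → D (proj₁ (List.lookup T j)) ≡ D (proj₂ (List.lookup T j))
          at j with j ≟ i
          ... | yes refl = same
          ... | no j≢i   = closed j j≢i
          everywhere : ∀ p q → (p , q) ∈ T → D p ≡ D q
          everywhere p q m = subst (λ r → D (proj₁ r) ≡ D (proj₂ r)) (sym (lookup-index m)) (at (Any.index m))
        unit : ∀ p q → D a ≡ p → D b ≡ q → t i ≈ 0#
        unit true  true  h k = ⊥-elim (uncut (trans h (sym k)))
        unit false false h k = ⊥-elim (uncut (trans h (sym k)))
        unit false true  h k = ≈-trans (≈-sym (⊛-identityʳ (t i))) (≈-trans (*-cong ≈-refl (≈-sym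
          (≈-trans (≈-reflexive (cong₂ (λ p q → δ q ⊕ ⊖ δ p) h k)) (x-0 ≈-refl)))) flow)
        unit true  false h k = ≈-trans (≈-sym (-‿involutive (t i))) (≈-trans (-‿cong negated) -0#≈0#)
          where
          negated : ⊖ t i ≈ 0#
          negated = ≈-trans (-‿cong (≈-sym (⊛-identityʳ (t i)))) (≈-trans (-‿distribʳ-* (t i) 1#) (≈-trans (*-cong ≈-refl (≈-sym
            (≈-trans (≈-reflexive (cong₂ (λ p q → δ q ⊕ ⊖ δ p) h k)) (⊕-identityˡ _)))) flow))

-- Averaging over all orderings of the vertices

∑-if : (P : Fin n → Bool) (c : ℕ) → ∑ (λ v → ind (P v) * c) ≡ # P * c
∑-if P c = ∑-*ʳ c (ind ∘ P)

full : Subset n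
full = tabulate (λ _ → true)

full-lookup : (x : Fin n) → lookup full x ≡ true
full-lookup x = lookup∘tabulate _ x

-- The step from A to A ⊞ v carries wt A + wt (A ⊞ v), which is n + 1 times the number of orderings
-- in which exactly A precedes v. As wt A orderings pass through A, the amount n + 1 times wt A
-- enters A if it is nonempty and leaves it if it is not full.
inflow outflow : Subset n → ℕ
inflow A = ∑ (λ v → ind (lookup A v) * (wt (A ⊟ v) + wt A))
outflow A = ∑ (λ v → ind (not (lookup A v)) * (wt A + wt (A ⊞ v)))

inflow≡ : (A : Subset n) (a : ℕ) → ∣ A ∣ ≡ suc a → inflow A ≡ suc n * wt A
inflow≡ {n} A a h = begin
  inflow A                                           ≡⟨ ∑-cong pointwise ⟩
  ∑ (λ v → ind (lookup A v) * (a ! * suc b ! + suc a ! * b !))  ≡⟨ ∑-if (lookup A) _ ⟩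
  # (lookup A) * (a ! * suc b ! + suc a ! * b !)     ≡⟨ cong (_* (a ! * suc b ! + suc a ! * b !)) (trans (sym (size≡# A)) h) ⟩
  suc a * (a ! * suc b ! + suc a ! * b !)            ≡⟨ lemma a b (a !) (b !) ⟩
  suc (suc a + b) * (suc a ! * b !)                  ≡⟨ cong₂ (λ m k → suc m * (k ! * b !)) (trans (cong (_+ b) (sym h)) (sizes-sum A)) (sym h) ⟩
  suc n * wt A ∎
  where
  open ≡-Reasoning
  b = ∁-size A
  lemma : ∀ a b x y → (1 + a) * (x * (y + b * y) + (x + a * x) * y) ≡ (2 + a + b) * ((x + a * x) * y)
  lemma = solve-∀
  pointwise : ∀ v → ind (lookup A v) * (wt (A ⊟ v) + wt A) ≡ ind (lookup A v) * (a ! * suc b ! + suc a ! * b !)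
  pointwise v with lookup A v in Av
  ... | false = refl
  ... | true  = cong (1 *_) (cong₂ _+_
        (cong₂ (λ p q → p ! * q !) (suc-injective (trans (size-⊟ A v Av) h))
          (trans (sym (∁-size-⊞ (A ⊟ v) v (∉-⊟ A v))) (cong (suc ∘ ∁-size) (⊟-⊞ A v Av))))
        (cong (λ p → p ! * b !) h))

outflow≡ : (A : Subset n) (b : ℕ) → ∁-size A ≡ suc b → outflow A ≡ suc n * wt A
outflow≡ {n} A b h = begin
  outflow A                                          ≡⟨ ∑-cong pointwise ⟩
  ∑ (λ v → ind (not (lookup A v)) * (a ! * suc b ! + suc a ! * b !))  ≡⟨ ∑-if (λ v → not (lookup A v)) _ ⟩
  # (λ v → not (lookup A v)) * (a ! * suc b ! + suc a ! * b !)     ≡⟨ cong (_* (a ! * suc b ! + suc a ! * b !)) (trans (sym (∁-size≡# A)) h) ⟩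
  suc b * (a ! * suc b ! + suc a ! * b !)            ≡⟨ lemma a b (a !) (b !) ⟩
  suc (a + suc b) * (a ! * suc b !)                  ≡⟨ cong₂ (λ m k → suc m * (a ! * k !)) (trans (cong (a +_) (sym h)) (sizes-sum A)) (sym h) ⟩
  suc n * wt A ∎
  where
  open ≡-Reasoning
  a = ∣ A ∣
  lemma : ∀ a b x y → (1 + b) * (x * (y + b * y) + (x + a * x) * y) ≡ (1 + (a + (1 + b))) * (x * (y + b * y))
  lemma = solve-∀
  pointwise : ∀ v → ind (not (lookup A v)) * (wt A + wt (A ⊞ v)) ≡ ind (not (lookup A v)) * (a ! * suc b ! + suc a ! * b !)
  pointwise v with lookup A v in Av
  ... | true  = refl
  ... | false = cong (1 *_) (cong₂ _+_ (cong (λ p → a ! * p !) h)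
        (cong₂ (λ p q → p ! * q !) (size-⊞ A v Av) (suc-injective (trans (∁-size-⊞ A v Av) h))))

outflow-full : outflow (full {n}) ≡ 0
outflow-full {n} = ∑-zero λ (v : Fin n) → cong (λ p → ind (not p) * (wt (full {n}) + wt (full ⊞ v))) (full-lookup v)

∁-size-0⇒full : (A : Subset n) → ∁-size A ≡ 0 → A ≡ full
∁-size-0⇒full A h = subset-ext λ i → trans (¬false⇒true λ p →
    case subst (1 ≤_) (trans (sym (∁-size≡# A)) h) (≤-trans (≤-reflexive (cong (ind ∘ not) (sym p))) (term≤∑ (λ i → ind (not (lookup A i))) i)) of λ ())
  (sym (full-lookup i))

total-wt-full : suc n * wt (full {n}) ≡ suc n !
total-wt-full {n} = cong (suc n *_) (trans (cong₂ (λ a b → a ! * b !) size co) (*-identityʳ (n !)))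
  where
  co : ∁-size (full {n}) ≡ 0
  co = trans (∁-size≡# (full {n})) (∑-zero λ i → cong (ind ∘ not) (full-lookup {n} i))
  size : ∣ full {n} ∣ ≡ n
  size = trans (sym (+-identityʳ _)) (trans (cong (∣ full {n} ∣ +_) (sym co)) (sizes-sum (full {n})))

-- The right-hand side is (n + 1)! times the expected total cost of adding the elements in a random order.
telescoping : (g : Subset n → ℕ) (cost : Subset n → Fin n → ℕ) → g ∅ ≡ 0 →
  (∀ A v → lookup A v ≡ false → g (A ⊞ v) ≤ g A + cost A v) →
  (∀ A v → lookup A v ≡ false → cost A v ≤ cost (A ⊞ v) v) →
  g full * suc n ! ≤ ∑ (λ v → E (λ A → cost A v))
-- Flow balance for g: the intermediate sets cancel, the empty set contributes nothing as g vanishes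
-- there, and only the full set remains. The outgoing flow is added to both sides in place of a
-- subtraction.
telescoping {n} g cost g∅ g-step cost-stable = +-cancelˡ-≤ (∑ₛ (λ A → outflow A * g A)) _ _ (begin
  ∑ₛ (λ A → outflow A * g A) + g full * suc n !          ≤⟨ out-side ⟩
  ∑ₛ (λ A → suc n * wt A * g A)                          ≤⟨ in-side ⟩
  ∑ₛ (λ A → inflow A * g A)                              ≡⟨ expand-in ⟩
  ∑ (λ v → ∑ₛ (λ A → ind (not (lookup A v)) * ((wt A + wt (A ⊞ v)) * g (A ⊞ v))))
    ≤⟨ ∑-mono (λ v → ≤-trans (∑ₛ-mono (one-step v)) (≤-reflexive (∑ₛ-+ (gain v) (paid v)))) ⟩
  ∑ (λ v → ∑ₛ (gain v) + ∑ₛ (paid v))                    ≡⟨ ∑-+ (λ v → ∑ₛ (gain v)) (λ v → ∑ₛ (paid v)) ⟩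
  ∑ (λ v → ∑ₛ (gain v)) + ∑ (λ v → ∑ₛ (paid v))          ≤⟨ +-mono-≤ (≤-reflexive (sym expand-out)) (∑-mono paid≤) ⟩
  ∑ₛ (λ A → outflow A * g A) + ∑ (λ v → E (λ A → cost A v)) ∎)
  where
  open ≤-Reasoning
  gain paid : Fin n → Subset n → ℕ
  gain v A = ind (not (lookup A v)) * (wt A + wt (A ⊞ v)) * g A
  -- The share of A ⊞ v is charged at the cost for A ⊞ v, which is allowed by stability. Summed over
  -- the sets without v this is the expectation over all sets.
  paid v A = ind (not (lookup A v)) * (wt A * cost A v + wt (A ⊞ v) * cost (A ⊞ v) v)
  one-step : ∀ v A → ind (not (lookup A v)) * ((wt A + wt (A ⊞ v)) * g (A ⊞ v)) ≤ gain v A + paid v A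
  one-step v A with lookup A v in Av
  ... | true  = z≤n
  ... | false = ≤-trans (*-monoʳ-≤ 1 (*-monoʳ-≤ (wt A + wt (A ⊞ v)) (g-step A v Av)))
        (≤-trans (≤-reflexive (lemma (wt A) (wt (A ⊞ v)) (g A) (cost A v)))
          (+-monoʳ-≤ (1 * (wt A + wt (A ⊞ v)) * g A) (*-monoʳ-≤ 1 (+-monoʳ-≤ (wt A * cost A v) (*-monoʳ-≤ (wt (A ⊞ v)) (cost-stable A v Av))))))
    where
    lemma : ∀ a b g c → 1 * ((a + b) * (g + c)) ≡ 1 * (a + b) * g + 1 * (a * c + b * c)
    lemma = solve-∀
  paid≤ : ∀ v → ∑ₛ (paid v) ≤ E (λ A → cost A v)
  paid≤ v = ≤-reflexive (sym (∑ₛ-pair v (λ A → wt A * cost A v)))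
  expand-out : ∑ₛ (λ A → outflow A * g A) ≡ ∑ (λ v → ∑ₛ (gain v))
  expand-out = trans (∑ₛ-cong λ A → sym (∑-*ʳ (g A) (λ v → ind (not (lookup A v)) * (wt A + wt (A ⊞ v))))) (∑ₛ-∑ (λ A v → gain v A))
  expand-in : ∑ₛ (λ A → inflow A * g A) ≡ ∑ (λ v → ∑ₛ (λ A → ind (not (lookup A v)) * ((wt A + wt (A ⊞ v)) * g (A ⊞ v))))
  expand-in = trans (∑ₛ-cong λ A → sym (trans (∑-cong λ v → sym (*-assoc (ind (lookup A v)) (wt (A ⊟ v) + wt A) (g A))) (∑-*ʳ (g A) (λ v → ind (lookup A v) * (wt (A ⊟ v) + wt A)))))
    (trans (∑ₛ-∑ (λ A v → ind (lookup A v) * ((wt (A ⊟ v) + wt A) * g A))) (∑-cong λ v → trans (∑ₛ-shift v (λ A → (wt (A ⊟ v) + wt A) * g A)) (∑ₛ-cong (restore v))))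
    where
    restore : ∀ v A → ind (not (lookup A v)) * ((wt (A ⊞ v ⊟ v) + wt (A ⊞ v)) * g (A ⊞ v)) ≡ ind (not (lookup A v)) * ((wt A + wt (A ⊞ v)) * g (A ⊞ v))
    restore v A with lookup A v in Av
    ... | true  = refl
    ... | false = cong (λ B → 1 * ((wt B + wt (A ⊞ v)) * g (A ⊞ v))) (⊞-⊟ A v Av)
  in-side : ∑ₛ (λ A → suc n * wt A * g A) ≤ ∑ₛ (λ A → inflow A * g A)
  in-side = ∑ₛ-mono pointwise
    where
    pointwise : ∀ A → suc n * wt A * g A ≤ inflow A * g A
    pointwise A = by-size ∣ A ∣ refl
      where
      by-size : ∀ a → ∣ A ∣ ≡ a → suc n * wt A * g A ≤ inflow A * g A
      by-size (suc a) size = ≤-reflexive (cong (_* g A) (sym (inflow≡ A a size)))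
      by-size zero    size = ≤-reflexive (trans (cong (suc n * wt A *_) gA) (trans (*-zeroʳ (suc n * wt A))
        (sym (trans (cong (inflow A *_) gA) (*-zeroʳ (inflow A))))))
        where
        gA : g A ≡ 0
        gA = trans (cong g (size≡0⇒∅ A size)) g∅
  out-side : ∑ₛ (λ A → outflow A * g A) + g full * suc n ! ≤ ∑ₛ (λ A → suc n * wt A * g A)
  out-side = ≤-trans (≤-reflexive (trans (cong (∑ₛ (λ A → outflow A * g A) +_) (sym single)) (sym (∑ₛ-+ (λ A → outflow A * g A) last))))
    (∑ₛ-mono λ A → pointwise A (A ≟ₛ full))
    where
    last : Subset n → ℕ
    last A = ind (does (A ≟ₛ full)) * (suc n * wt A * g A)
    single : ∑ₛ last ≡ g full * suc n !
    single = trans (∑ₛ-single (full {n}) λ A A≢ → cong (λ b → ind b * (suc n * wt A * g A)) (dec-false (A ≟ₛ full) A≢))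
      (trans (cong (λ b → ind b * (suc n * wt (full {n}) * g full)) (dec-true (full {n} ≟ₛ full) refl))
        (trans (*-identityˡ _) (trans (cong (_* g full) (total-wt-full {n})) (*-comm (suc n !) (g full)))))
    pointwise : ∀ A → (dec : Dec (A ≡ full)) → outflow A * g A + ind (does dec) * (suc n * wt A * g A) ≤ suc n * wt A * g A
    pointwise A (yes refl) rewrite outflow-full {n} = ≤-reflexive (+-identityʳ _)
    pointwise A (no A≢) = by-size (∁-size A) refl
      where
      by-size : ∀ b → ∁-size A ≡ b → outflow A * g A + 0 ≤ suc n * wt A * g A
      by-size zero    co = ⊥-elim (A≢ (∁-size-0⇒full A co))
      by-size (suc b) co = ≤-reflexive (trans (+-identityʳ _) (cong (_* g A) (outflow≡ A b co)))

-- Classical choices over finite sets, and counting faces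

¬¬-Subset : ∀ {p} {P : Subset n → Set p} → (∀ A → ¬ ¬ P A) → ¬ ¬ (∀ A → P A)
¬¬-Subset {zero}  h = ¬¬-bind (h []) λ p → ¬¬-return λ { [] → p }
¬¬-Subset {suc n} h = ¬¬-bind (¬¬-Subset (h ∘ (false ∷_))) λ p → ¬¬-bind (¬¬-Subset (h ∘ (true ∷_))) λ q →
  ¬¬-return λ { (false ∷ A) → p A ; (true ∷ A) → q A }

¬¬-minimum : ∀ {p} {P : ℕ → Set p} (k : ℕ) → P k → ¬ ¬ (Σ ℕ λ m → P m × (∀ j → P j → m ≤ j))
¬¬-minimum {P = P} k = bounded (suc k) k ≤-refl
  where
  bounded : ∀ b k → k < b → P k → ¬ ¬ (Σ ℕ λ m → P m × (∀ j → P j → m ≤ j))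
  bounded (suc b) k (s≤s k≤b) Pk = ¬¬-bind (¬¬-excluded-middle {A = Σ ℕ λ j → P j × j < k}) λ
    { (yes (j , Pj , j<k)) → bounded b j (<-≤-trans j<k k≤b) Pj
    ; (no none) → ¬¬-return (k , Pk , λ j Pj → ≮⇒≥ λ j<k → none (j , Pj , j<k)) }

length-filter-map : ∀ {a b} {A : Set a} {B : Set b} (p : B → Bool) (f : A → B) (xs : List A) →
  length (filter (T? ∘ p) (List.map f xs)) ≡ length (filter (T? ∘ p ∘ f) xs)
length-filter-map p f [] = refl
length-filter-map p f (x ∷ xs) with p (f x)
... | true  = cong suc (length-filter-map p f xs)
... | false = length-filter-map p f xs

length-filter-allSubsets : (p : Subset n → Bool) → length (filter (T? ∘ p) (allSubsets n)) ≡ ∑ₛ (ind ∘ p)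
length-filter-allSubsets {zero} p with p []
... | true  = refl
... | false = refl
length-filter-allSubsets {suc n} p = trans (cong length (Listₚ.filter-++ (T? ∘ p) (List.map (false ∷_) (allSubsets n)) _))
  (trans (Listₚ.length-++ (filter (T? ∘ p) (List.map (false ∷_) (allSubsets n))))
    (cong₂ _+_ (trans (length-filter-map p (false ∷_) (allSubsets n)) (length-filter-allSubsets (p ∘ (false ∷_))))
               (trans (length-filter-map p (true ∷_) (allSubsets n)) (length-filter-allSubsets (p ∘ (true ∷_))))))

module Counting {n} (Δ : Complex n) where

  open Complexes Δ
  open FaceNumbers Δ

  lk-of-∅ : ∀ σ → lk ∅ σ ≡ face Δ σ
  lk-of-∅ σ = ⇔⇒≡ (λ h → trans (cong (face Δ) (sym σ∪∅)) (lk-face ∅ σ h))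
    (λ h → lk-intro ∅ σ (λ i _ → ∅-lookup i) (trans (cong (face Δ) σ∪∅) h))
    where
    σ∪∅ : σ ∪ ∅ ≡ σ
    σ∪∅ = subset-ext λ i → trans (∪-lookup σ ∅ i) (trans (cong (lookup σ i ∨_) (∅-lookup i)) (∨-identityʳ (lookup σ i)))

  fcount≡count : ∀ i → fcount Δ i ≡ count ∅ (suc i)
  fcount≡count i = trans (length-filter-allSubsets (λ σ → face Δ σ ∧ (∣ σ ∣ ≡ᵇ suc i)))
    (∑ₛ-cong λ σ → cong (λ b → ind (b ∧ (∣ σ ∣ ≡ᵇ suc i))) (sym (lk-of-∅ σ)))

-- From homology to the bounds for face numbers

module FromHomology {c ℓ} (K : Field c ℓ) {n} (Δ : Complex n) (d : ℕ)
  (pure-dim : PureOfDim Δ d) (manifold : Homology.HomologyManifoldWithoutBoundary K Δ d) where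

  open Homology K
  open FieldChains K
  open Complexes Δ

  -- Chains of size 1 have degree 0. There the link of a ridge has the reduced homology of two
  -- points, of rank 1, and the link of a smaller nonempty face has rank 0; these give `ridge` and
  -- `connected`.
  pseudomanifold : NormalPseudomanifold Δ d
  pseudomanifold = record { bounded = bounded′ ; pure = pure′ ; ridge = ridge′ ; connected = connected′ }
    where
    bounded′ : ∀ σ → face Δ σ ≡ true → ∣ σ ∣ ≤ d
    bounded′ σ h = proj₁ (proj₂ pure-dim) σ (true⇒T h)
    pure′ : ∀ σ → face Δ σ ≡ true → ∃ λ τ → face Δ τ ≡ true × ∣ τ ∣ ≡ d × σ ⊑ τ
    pure′ σ h with proj₂ (proj₂ pure-dim) σ (true⇒T h)
    ... | τ , f , s , sub = τ , T⇒true f , s , λ i p → T⇒true (sub i (true⇒T p))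
    ridge′ : ∀ ρ → face Δ ρ ≡ true → 1 ≤ ∣ ρ ∣ → suc ∣ ρ ∣ ≡ d → Two (vtx ρ)
    ridge′ ρ f ne s = record { Two two ; first∈ = as-vtx (Two.first∈ two) ; second∈ = as-vtx (Two.second∈ two)
        ; only = λ x h → Two.only two x (trans (lk-⁅⁆ ρ x) h) }
      where
      codim : d ∸ ∣ ρ ∣ ≡ 1
      codim = trans (cong (_∸ ∣ ρ ∣) (sym s)) (m+n∸n≡m 1 ∣ ρ ∣)
      no-edges : ∀ σ → ∣ σ ∣ ≡ 2 → lk ρ σ ≡ false
      no-edges σ σ2 = ¬true⇒false λ h → <-irrefl refl (≤-trans
        (≤-reflexive (trans (cong suc (sym s)) (sym (trans (size-∪ σ ρ (lk-disjoint ρ σ h)) (cong (_+ ∣ ρ ∣) σ2)))))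
        (bounded′ (σ ∪ ρ) (lk-face ρ σ h)))
      two : Two (λ x → lk ρ ⁅ x ⁆)
      two = two-points-of-homology (lk ρ)
        (subst (λ m → HasBetti (lk ρ) 1 (if 1 ≡ᵇ m then 1 else 0)) codim (manifold ρ (true⇒T f) ne 1)) no-edges
      as-vtx : ∀ {x} → lk ρ ⁅ x ⁆ ≡ true → vtx ρ x ≡ true
      as-vtx {x} h = trans (sym (lk-⁅⁆ ρ x)) h
    connected′ : ∀ ρ → face Δ ρ ≡ true → 1 ≤ ∣ ρ ∣ → 2 + ∣ ρ ∣ ≤ d → (D : Fin n → Bool) →
      (∀ a b → adjL ρ a b ≡ true → D a ≡ D b) → ∀ u v → vtx ρ u ≡ true → vtx ρ v ≡ true → D u ≡ D v
    connected′ ρ f ne small D uncrossed u v hu hv = connected-of-homology (lk ρ) betti D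
        (λ a b a≢b h → uncrossed a b (adjacent a b a≢b h)) u v (trans (lk-⁅⁆ ρ u) hu) (trans (lk-⁅⁆ ρ v) hv)
      where
      codim : d ∸ ∣ ρ ∣ ≡ 2 + (d ∸ (2 + ∣ ρ ∣))
      codim = trans (cong (_∸ ∣ ρ ∣) (sym (m+[n∸m]≡n small))) (trans (cong (_∸ ∣ ρ ∣) (reorder ∣ ρ ∣ (d ∸ (2 + ∣ ρ ∣)))) (m+n∸n≡m (2 + (d ∸ (2 + ∣ ρ ∣))) ∣ ρ ∣))
        where
        reorder : ∀ r k → 2 + r + k ≡ 2 + k + r
        reorder = solve-∀
      betti : HasBetti (lk ρ) 1 0
      betti = subst (λ m → HasBetti (lk ρ) 1 (if 1 ≡ᵇ m then 1 else 0)) codim (manifold ρ (true⇒T f) ne 1)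
      adjacent : ∀ a b → a ≢ b → lk ρ (∅ ⊞ a ⊞ b) ≡ true → adjL ρ a b ≡ true
      adjacent a b a≢b h = adjL-intro ρ a b a≢b (disj a (⊞-mono (∅ ⊞ a) b (∈-⊞ ∅ a))) (disj b (∈-⊞ (∅ ⊞ a) b))
        (trans (cong (face Δ) (sym join)) (lk-face ρ (∅ ⊞ a ⊞ b) h))
        where
        disj = lk-disjoint ρ (∅ ⊞ a ⊞ b) h
        join : (∅ ⊞ a ⊞ b) ∪ ρ ≡ ρ ⊞ a ⊞ b
        join = trans (∪-⊞ (∅ ⊞ a) ρ b) (cong (_⊞ b) (trans (∪-⊞ ∅ ρ a) (cong (_⊞ a) (∪-∅ ρ))))

  open FaceNumbers Δ
  open LowerBounds Δ d pseudomanifold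
  open SpanningEdges K Δ

  linkComps : Subset n → Fin n → ℕ
  linkComps A v = # (laterReps A v)

  -- The vertex v does not lie in its own link, so adding v to A changes nothing there.
  linkComps-stable : ∀ A v → lookup A v ≡ false → linkComps A v ≤ linkComps (A ⊞ v) v
  linkComps-stable A v _ = comps-mono (adjL ⁅ v ⁆) (adjL ⁅ v ⁆) (adjL-sym ⁅ v ⁆) (A ∩ᵇ vtx ⁅ v ⁆) (A ⊞ v ∩ᵇ vtx ⁅ v ⁆) (λ _ → false) (λ _ → false)
    λ D cl miss u Du → D , (λ _ p → p) , ((λ a p → grow a (proj₁ cl a p)) , λ a b p Sb ab → proj₂ cl a b p (shrink b Sb) ab) , miss , u , Du
    where
    grow : ∀ a → (A ∩ᵇ vtx ⁅ v ⁆) a ≡ true → (A ⊞ v ∩ᵇ vtx ⁅ v ⁆) a ≡ true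
    grow a h = let Aa , va = ∩ᵇ-true A (vtx ⁅ v ⁆) a h in ∧-intro (⊞-mono A v Aa) va
    v∉link : ∀ a → vtx ⁅ v ⁆ a ≡ true → a ≢ v
    v∉link a h refl = true≢false (trans (⁅⁆-lookup a a) (==-refl a)) (not-true⁻¹ (proj₁ (∧-true h)))
    shrink : ∀ b → (A ⊞ v ∩ᵇ vtx ⁅ v ⁆) b ≡ true → (A ∩ᵇ vtx ⁅ v ⁆) b ≡ true
    shrink b h = let Ab , vb = ∩ᵇ-true (A ⊞ v) (vtx ⁅ v ⁆) b h in ∧-intro (trans (sym (⊞-other A (v∉link b vb))) Ab) vb

  -- The double negation is placed around the edge set alone, so that `spanning-exists` still
  -- returns a size.
  SpanningSize : Subset n → ℕ → Set _
  SpanningSize A k = ¬ ¬ (Σ Edges λ E → Spanning A E × length E ≡ k)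

  spanning-∅ : SpanningSize ∅ 0
  spanning-∅ = ¬¬-return ([] , (λ a b Aa → ⊥-elim (true≢false Aa (∅-lookup a))) , refl)

  spanning-step : ∀ A k v → lookup A v ≡ false → SpanningSize A k → SpanningSize (A ⊞ v) (k + linkComps A v)
  spanning-step A k v v∉A s = ¬¬-bind s λ { (E , span , refl) → ¬¬-bind (spanning-⊞ A E v v∉A span) λ span′ →
    ¬¬-return (newEdges A v List.++ E , span′ , trans (Listₚ.length-++ (newEdges A v))
      (trans (cong (_+ length E) (trans (Listₚ.length-map (v ,_) (trues (laterReps A v))) (length-trues (laterReps A v)))) (+-comm (linkComps A v) (length E)))) }

  spanning-exists : ∀ s A → ∣ A ∣ ≡ s → ∃ (SpanningSize A)
  spanning-exists zero A h = 0 , subst (λ B → SpanningSize B 0) (sym (size≡0⇒∅ A h)) spanning-∅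
  spanning-exists (suc s) A h with size≥1⇒∈ A (≤-trans (s≤s z≤n) (≤-reflexive (sym h)))
  ... | v , Av with spanning-exists s (A ⊟ v) (suc-injective (trans (size-⊟ A v Av) h))
  ...   | k , sp = k + linkComps (A ⊟ v) v , subst (λ B → SpanningSize B (k + linkComps (A ⊟ v) v)) (⊟-⊞ A v Av)
            (spanning-step (A ⊟ v) k v (∉-⊟ A v) sp)

  -- Nonzero first homology forces at least f₀ edges on every spanning set, so the expected number of edges
  -- needed along a random ordering is at least f₀.
  expected-comps : Connected Δ → FirstBettiNonzero Δ → # isVertex * suc n ! ≤ ∑ (λ v → E (λ A → linkComps A v))
  expected-comps conn-Δ β₁ = decidable-stable (# isVertex * suc n ! ≤? ∑ (λ v → E (λ A → linkComps A v)))
    (¬¬-bind (¬¬-Subset λ A → let k , sp = spanning-exists ∣ A ∣ A refl in ¬¬-minimum {P = SpanningSize A} k sp) (¬¬-return ∘ from-minimum))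
    where
    from-minimum : (∀ A → Σ ℕ λ m → SpanningSize A m × (∀ j → SpanningSize A j → m ≤ j)) →
      # isVertex * suc n ! ≤ ∑ (λ v → E (λ A → linkComps A v))
    from-minimum least-size = ≤-trans (*-monoˡ-≤ (suc n !) enough) (telescoping g linkComps (n≤0⇒n≡0 (proj₂ (proj₂ (least-size ∅)) 0 spanning-∅)) g-step linkComps-stable)
      where
      -- Sizes accumulated along an ordering depend on the ordering. The least size is a function of
      -- A, as `telescoping` requires, and it inherits the one-step bound.
      g : Subset n → ℕ
      g A = proj₁ (least-size A)
      g-step : ∀ A v → lookup A v ≡ false → g (A ⊞ v) ≤ g A + linkComps A v
      g-step A v v∉A = proj₂ (proj₂ (least-size (A ⊞ v))) _ (spanning-step A (g A) v v∉A (proj₁ (proj₂ (least-size A))))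
      enough : # isVertex ≤ g full
      enough = ≮⇒≥ λ few → proj₁ (proj₂ (least-size full)) λ { (E , span , len) →
        β₁ (tree⇒acyclic E span (≤-trans (s≤s (≤-reflexive len)) few) conn-Δ) }

  vtx-∅ : ∀ v → vtx ∅ v ≡ isVertex v
  vtx-∅ v = trans (cong (λ b → not b ∧ face Δ (∅ ⊞ v)) (∅-lookup v)) (cong (face Δ) (sym (⁅⁆≡∅⊞ v)))

  f₀ : ℕ
  f₀ = deg ∅

  degreeSum : ℕ
  degreeSum = overVertices ∅ (λ v → deg ⁅ v ⁆)

  module _ (e : ℕ) (e≥3 : 3 ≤ e) (d≡ : suc e ≡ d) where

    vertex-link : ∀ v → vtx ∅ v ≡ true → LinkOf ⁅ v ⁆ e
    vertex-link v h = linkOf (trans (sym (vtx-∅ v)) h) (≤-reflexive (sym (size-⁅⁆ v)))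
      (trans (cong (e +_) (size-⁅⁆ v)) (trans (+-comm e 1) d≡))

    -- The starting facet contributes at most e / (e + 1) and each of the deg v - e steps at most 1
    -- / ((e + 1) (e + 2)). The sum is multiplied by (e + 1) (e + 2) (n + 1)!, with the negative
    -- term moved to the left.
    link-comps-bound : ∀ v → vtx ∅ v ≡ true →
      suc e * (2 + e) * E (λ A → linkComps A v) + e * suc n ! ≤ ((2 + e) * e + deg ⁅ v ⁆) * suc n !
    link-comps-bound v hv = decidable-stable (_ ≤? _) (¬¬-bind (link-built e≥3) (¬¬-return ∘ from-built))
      where
      open LinkOf (vertex-link v hv)
      open LinkCycles Δ d pseudomanifold ⁅ v ⁆ isFace nonempty e dim
      adj = adjL ⁅ v ⁆
      M = suc n !
      from-built : LinkBuilt → suc e * (2 + e) * E (λ A → linkComps A v) + e * M ≤ ((2 + e) * e + deg ⁅ v ⁆) * M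
      from-built lb = begin
        suc e * (2 + e) * E (λ A → linkComps A v) + e * M                  ≤⟨ +-monoˡ-≤ (e * M) (*-monoʳ-≤ (suc e * (2 + e)) split) ⟩
        suc e * (2 + e) * (E inBase + E offBase) + e * M                   ≡⟨ lemma₁ e (E inBase) (E offBase) M ⟩
        (2 + e) * (suc e * E inBase) + suc e * (2 + e) * E offBase + e * M ≤⟨ +-monoˡ-≤ (e * M) (+-mono-≤ (*-monoʳ-≤ (2 + e) in-bound)
                                                                                (E-comps≤ (adjL-sym ⁅ v ⁆) (adjL-irrefl ⁅ v ⁆) built)) ⟩
        (2 + e) * (e * M) + steps * M + e * M                              ≡⟨ lemma₂ e steps M ⟩
        ((2 + e) * e + (steps + e)) * M                                    ≡⟨ cong (λ k → ((2 + e) * e + k) * M) steps-deg ⟩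
        ((2 + e) * e + deg ⁅ v ⁆) * M ∎
        where
        open ≤-Reasoning
        open LinkBuilt lb
        F : Fin n → Bool
        F = lookup base
        F-size : # F ≡ e
        F-size = trans (sym (size≡# base)) (facets-size base base∈)
        steps-deg : steps + e ≡ deg ⁅ v ⁆
        steps-deg = trans (cong (steps +_) (sym F-size)) (trans (sym (buildable-# built)) (#-cong verts≡))
        lemma₁ : ∀ e a b m → (1 + e) * (2 + e) * (a + b) + e * m ≡ (2 + e) * ((1 + e) * a) + (1 + e) * (2 + e) * b + e * m
        lemma₁ = solve-∀
        lemma₂ : ∀ e s m → (2 + e) * (e * m) + s * m + e * m ≡ ((2 + e) * e + (s + e)) * m
        lemma₂ = solve-∀
        none : Fin n → Bool
        none _ = false
        inBase offBase : Subset n → ℕ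
        inBase A = comps adj (A ∩ᵇ F) none
        offBase A = comps adj (A ∩ᵇ verts) F
        to-verts : ∀ A → linkComps A v ≤ comps adj (A ∩ᵇ verts) none
        to-verts A = comps-mono adj adj (adjL-sym ⁅ v ⁆) (A ∩ᵇ vtx ⁅ v ⁆) (A ∩ᵇ verts) none none λ D cl miss u Du →
          D , (λ _ p → p) , ((λ a p → trans (same a) (proj₁ cl a p)) , λ a b p Sb ab → proj₂ cl a b p (trans (sym (same b)) Sb) ab) , miss , u , Du
          where
          same : ∀ a → (A ∩ᵇ verts) a ≡ (A ∩ᵇ vtx ⁅ v ⁆) a
          same a = cong (lookup A a ∧_) (verts≡ a)
        split : E (λ A → linkComps A v) ≤ E inBase + E offBase
        split = ≤-trans (E-mono λ A → ≤-trans (to-verts A) (comps-glue adj (adjL-sym ⁅ v ⁆) none F verts A (buildable-⊇ built)))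
          (≤-reflexive (E-+ inBase offBase))
        avoids : Subset n → Bool
        avoids = fits none F
        -- The facet F is a clique, so F ∩ A has at most one component, and none when A avoids F.
        at-most-one : ∀ A → inBase A + ind (avoids A) ≤ 1
        at-most-one A with any? (λ x → (A ∩ᵇ F) x ≟ᵇ true)
        ... | no empty = ≤-trans (+-monoˡ-≤ (ind (avoids A)) (≤-trans (comps≤ adj (adjL-sym ⁅ v ⁆) (A ∩ᵇ F) none none
                (λ D cl miss u Du → ⊥-elim (empty (u , proj₁ cl u Du)))) (≤-reflexive (∑-zero λ (_ : Fin n) → refl)))) (ind-≤1 (avoids A))
        ... | yes (x , h) = ≤-trans (+-mono-≤ one-rep (≤-reflexive (cong ind (¬true⇒false λ p → true≢false (proj₂ (∩ᵇ-true A F x h)) (fits-out none F A p x (proj₁ (∩ᵇ-true A F x h))))))) (≤-reflexive (+-identityʳ 1))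
          where
          one-rep : inBase A ≤ 1
          one-rep = ≤-trans (comps≤ adj (adjL-sym ⁅ v ⁆) (A ∩ᵇ F) none (_== x) λ D cl miss u Du →
              x , ==-refl x , reach D cl u Du (u ≟ x)) (≤-reflexive (#-== x))
            where
            reach : ∀ D → Closed adj (A ∩ᵇ F) D → ∀ u → lookup D u ≡ true → Dec (u ≡ x) → lookup D x ≡ true
            reach D cl u Du (yes refl) = Du
            reach D cl u Du (no u≢x) = proj₂ cl u x Du h (facet-edge base u x base∈
              (proj₂ (∩ᵇ-true A F u (proj₁ cl u Du))) (proj₂ (∩ᵇ-true A F x h)) u≢x)
        total-weight : E {n} (λ _ → 1) ≡ M
        total-weight = trans (∑ₛ-cong λ (A : Subset n) → cong (λ b → wt A * ind b) (sym (fits-intro none none A (λ _ ()) (λ _ ()))))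
          (trans (sym (*-identityˡ _)) (trans (cong (λ k → suc k * E (λ A → ind (fits none none A))) (sym (∑-zero λ (_ : Fin n) → refl))) (E-avoid none)))
        -- The facet shows one component unless A avoids all its e vertices, which has probability 1
        -- / (e + 1).
        in-bound : suc e * E inBase ≤ e * M
        in-bound = +-cancelʳ-≤ M (suc e * E inBase) (e * M) (begin
          suc e * E inBase + M                                   ≡⟨ cong (suc e * E inBase +_) (sym (trans (cong (λ k → suc k * E (ind ∘ avoids)) (sym F-size)) (E-avoid F))) ⟩
          suc e * E inBase + suc e * E (ind ∘ avoids)            ≡⟨ sym (*-distribˡ-+ (suc e) (E inBase) (E (ind ∘ avoids))) ⟩
          suc e * (E inBase + E (ind ∘ avoids))                  ≡⟨ cong (suc e *_) (sym (E-+ inBase (ind ∘ avoids))) ⟩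
          suc e * E (λ A → inBase A + ind (avoids A))            ≤⟨ *-monoʳ-≤ (suc e) (E-mono at-most-one) ⟩
          suc e * E {n} (λ _ → 1)                                ≡⟨ cong (suc e *_) total-weight ⟩
          suc e * M                                              ≡⟨ +-comm M (e * M) ⟩
          e * M + M ∎)

    -- Summing `link-comps-bound` over the vertices and comparing with `expected-comps` gives f₀ ≤
    -- f₀ + (Σ deg v - 2 d f₀) / (d (d + 1)) with d = e + 1, so the last numerator is nonnegative.
    -- Everything is multiplied out, and (e + 2) e f₀ (n + 1)! is added to both sides to avoid
    -- subtraction.
    degree-sum-bound : Connected Δ → FirstBettiNonzero Δ → 2 * suc e * f₀ ≤ degreeSum
    degree-sum-bound conn-Δ β₁ = *-cancelʳ-≤ (2 * suc e * f₀) degreeSum M {{>-nonZero (1≤n! (suc n))}} (+-cancelˡ-≤ ((2 + e) * e * f₀ * M) _ _ (begin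
      (2 + e) * e * f₀ * M + 2 * suc e * f₀ * M                     ≡⟨ lemma₁ e f₀ M ⟩
      suc e * (2 + e) * (f₀ * M) + e * M * f₀                       ≤⟨ +-monoˡ-≤ (e * M * f₀) (*-monoʳ-≤ (suc e * (2 + e)) expected) ⟩
      suc e * (2 + e) * overVertices ∅ (λ v → E (λ A → linkComps A v)) + e * M * f₀
        ≡⟨ sym (cong₂ _+_ (overVertices-* ∅ (suc e * (2 + e)) (λ v → E (λ A → linkComps A v))) (overVertices-const ∅ (e * M))) ⟩
      overVertices ∅ (λ v → suc e * (2 + e) * E (λ A → linkComps A v)) + overVertices ∅ (λ _ → e * M)
        ≡⟨ sym (overVertices-+ ∅ (λ v → suc e * (2 + e) * E (λ A → linkComps A v)) (λ _ → e * M)) ⟩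
      overVertices ∅ (λ v → suc e * (2 + e) * E (λ A → linkComps A v) + e * M)  ≤⟨ overVertices-mono ∅ link-comps-bound ⟩
      overVertices ∅ (λ v → ((2 + e) * e + deg ⁅ v ⁆) * M)          ≡⟨ ∑-cong (λ v → cong (ind (vtx ∅ v) *_) (lemma₂ ((2 + e) * e) (deg ⁅ v ⁆) M)) ⟩
      overVertices ∅ (λ v → (2 + e) * e * M + M * deg ⁅ v ⁆)        ≡⟨ overVertices-+ ∅ (λ _ → (2 + e) * e * M) (λ v → M * deg ⁅ v ⁆) ⟩
      overVertices ∅ (λ _ → (2 + e) * e * M) + overVertices ∅ (λ v → M * deg ⁅ v ⁆)
        ≡⟨ cong₂ _+_ (overVertices-const ∅ ((2 + e) * e * M)) (overVertices-* ∅ M (λ v → deg ⁅ v ⁆)) ⟩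
      (2 + e) * e * M * f₀ + M * degreeSum                          ≡⟨ lemma₃ ((2 + e) * e) M f₀ degreeSum ⟩
      (2 + e) * e * f₀ * M + degreeSum * M ∎))
      where
      open ≤-Reasoning
      M = suc n !
      lemma₁ : ∀ e f m → (2 + e) * e * f * m + 2 * (1 + e) * f * m ≡ (1 + e) * (2 + e) * (f * m) + e * m * f
      lemma₁ = solve-∀
      lemma₂ : ∀ a b m → (a + b) * m ≡ a * m + m * b
      lemma₂ = solve-∀
      lemma₃ : ∀ a m f s → a * m * f + m * s ≡ a * f * m + s * m
      lemma₃ = solve-∀
      -- The orderings run over all of `Fin n`. An element that is no vertex of Δ has an empty link
      -- and costs nothing.
      not-vertex : ∀ v → vtx ∅ v ≡ false → E (λ A → linkComps A v) ≡ 0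
      not-vertex v h = ∑ₛ-zero {n} λ A → trans (cong (wt A *_) (∑-zero λ r → cong ind (¬true⇒false λ p →
          true≢false (trans (vtx-∅ v) (face-⊑ {⁅ v ⁆} {⁅ v ⁆ ⊞ r} (λ i → ⊞-mono ⁅ v ⁆ r)
            (proj₂ (∧-true {not (lookup ⁅ v ⁆ r)} (proj₂ (∩ᵇ-true A (vtx ⁅ v ⁆) r
              (proj₁ (does-true (rep? (adjL ⁅ v ⁆) (A ∩ᵇ vtx ⁅ v ⁆) (λ _ → false) r) p)))))))) h))) (*-zeroʳ (wt A))
      expected : f₀ * M ≤ overVertices ∅ (λ v → E (λ A → linkComps A v))
      expected = ≤-trans (≤-reflexive (cong (_* M) (#-cong vtx-∅))) (≤-trans (expected-comps conn-Δ β₁) (∑-mono pointwise))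
        where
        pointwise : ∀ v → E (λ A → linkComps A v) ≤ ind (vtx ∅ v) * E (λ A → linkComps A v)
        pointwise v with vtx ∅ v in hv
        ... | true  = ≤-reflexive (sym (*-identityˡ _))
        ... | false = ≤-reflexive (not-vertex v hv)

    module _ (conn-Δ : Connected Δ) (β₁ : FirstBettiNonzero Δ) where

      -- The average degree is at least 2d, while no vertex has more than f₀ - 1 neighbours.
      many-vertices : 1 + 2 * suc e ≤ f₀
      many-vertices = *-cancelʳ-≤ (1 + 2 * suc e) f₀ f₀ {{>-nonZero positive}} (begin
        (1 + 2 * suc e) * f₀                     ≤⟨ +-monoʳ-≤ f₀ (degree-sum-bound conn-Δ β₁) ⟩
        f₀ + degreeSum                           ≡⟨ cong (_+ degreeSum) (sym (trans (overVertices-const ∅ 1) (*-identityˡ f₀))) ⟩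
        overVertices ∅ (λ _ → 1) + degreeSum     ≡⟨ sym (overVertices-+ ∅ (λ _ → 1) (λ v → deg ⁅ v ⁆)) ⟩
        overVertices ∅ (λ v → suc (deg ⁅ v ⁆))   ≤⟨ overVertices-mono ∅ degree< ⟩
        overVertices ∅ (λ _ → f₀)                ≡⟨ overVertices-const ∅ f₀ ⟩
        f₀ * f₀ ∎)
        where
        open ≤-Reasoning
        degree< : ∀ v → vtx ∅ v ≡ true → deg ⁅ v ⁆ < f₀
        degree< v hv = #-mono-< v (cong (λ b → not b ∧ face Δ (⁅ v ⁆ ⊞ v)) (trans (⁅⁆-lookup v v) (==-refl v))) hv
          λ x h → trans (vtx-∅ x) (face-⊑ {⁅ x ⁆} {⁅ v ⁆ ⊞ x} (λ i p →
            subst (λ z → lookup (⁅ v ⁆ ⊞ x) z ≡ true) (sym (==⇒≡ (trans (sym (⁅⁆-lookup x i)) p))) (∈-⊞ ⁅ v ⁆ x))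
            (vtx-face ⁅ v ⁆ x h))
        positive : 1 ≤ f₀
        positive with proj₁ pure-dim
        ... | σ , f , s with size≥1⇒∈ σ (≤-trans (s≤s z≤n) (≤-reflexive (trans d≡ (sym s))))
        ...   | x , σx = ≤-trans (≤-reflexive (sym (cong ind (trans (vtx-∅ x) (face-⊑ {⁅ x ⁆} {σ} (λ i p →
                  subst (λ z → lookup σ z ≡ true) (sym (==⇒≡ (trans (sym (⁅⁆-lookup x i)) p))) σx) (T⇒true f)))))) (term≤∑ (ind ∘ vtx ∅) x)

      -- As a function of N, φ is affine with slope α and offset β, and the faces of a vertex link
      -- satisfy the bound with the same two numbers. Being affine, the bound can be summed over the
      -- vertices, and only the sum of the degrees enters.
      record LinearBound (j : ℕ) : Set where
        field
          α β     : ℕ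
          φ-value : ∀ N → φ N e j ≡ α * N ∸ β
          bound   : ∀ v → vtx ∅ v ≡ true → α * deg ⁅ v ⁆ ≤ count ⁅ v ⁆ (suc j) + β

      linear-bound : ∀ j → suc j ≤ e → LinearBound j
      linear-bound zero _ = record { α = 1 ; β = 0 ; φ-value = λ N → sym (*-identityˡ N)
        ; bound = λ v h → ≤-reflexive (trans (*-identityˡ (deg ⁅ v ⁆)) (trans (sym (count-1 ⁅ v ⁆)) (sym (+-identityʳ _)))) }
      linear-bound (suc j) j<e = by-top (suc (suc j) ≟ₙ e)
        where
        by-top : Dec (suc (suc j) ≡ e) → LinearBound (suc j)
        by-top (yes refl) = record { α = suc j ; β = (3 + j) * j
          ; φ-value = λ N → cong (λ b → if b then suc j * N ∸ (3 + j) * j else ((2 + j) C suc j) * N ∸ ((3 + j) C (2 + j)) * suc j)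
              (dec-true (suc (suc j) ≟ₙ suc (suc j)) refl)
          ; bound = λ v h → facet-bound j ⁅ v ⁆ (vertex-link v h) }
        by-top (no ≢e) = record { α = e C suc j ; β = suc j * (suc e C suc (suc j))
          ; φ-value = λ N → trans (cong (λ b → if b then (e ∸ 1) * N ∸ suc e * (e ∸ 2) else (e C suc j) * N ∸ (suc e C suc (suc j)) * suc j)
              (dec-false (suc (suc j) ≟ₙ e) ≢e)) (cong ((e C suc j) * N ∸_) (*-comm (suc e C suc (suc j)) (suc j)))
          ; bound = λ v h → face-bound (suc j) e ⁅ v ⁆ (vertex-link v h) (≤∧≢⇒< j<e ≢e) }

      -- Faces are counted with a marked vertex. The bounds in the vertex links add up to at least
      -- f₀ times the value of φ at N = 2d, since the average degree is at least 2d; then f₀ ≥ 2d +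
      -- 1 is inserted.
      faces-bound : ∀ j → suc j ≤ e → suc (2 * suc e) * φ (2 * suc e) e j ≤ (2 + j) * count ∅ (2 + j)
      faces-bound j j<e = begin
        suc (2 * suc e) * φ (2 * suc e) e j                ≤⟨ *-monoˡ-≤ (φ (2 * suc e) e j) many-vertices ⟩
        f₀ * φ (2 * suc e) e j                             ≡⟨ cong (f₀ *_) (φ-value (2 * suc e)) ⟩
        f₀ * (α * (2 * suc e) ∸ β)                         ≡⟨ *-distribˡ-∸ f₀ (α * (2 * suc e)) β ⟩
        f₀ * (α * (2 * suc e)) ∸ f₀ * β                    ≤⟨ ∸-monoˡ-≤ (f₀ * β) averaged ⟩
        (2 + j) * count ∅ (2 + j) + f₀ * β ∸ f₀ * β        ≡⟨ m+n∸n≡m ((2 + j) * count ∅ (2 + j)) (f₀ * β) ⟩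
        (2 + j) * count ∅ (2 + j) ∎
        where
        open ≤-Reasoning
        open LinearBound (linear-bound j j<e)
        reorder : ∀ f a d → f * (a * d) ≡ a * (d * f)
        reorder = solve-∀
        averaged : f₀ * (α * (2 * suc e)) ≤ (2 + j) * count ∅ (2 + j) + f₀ * β
        averaged = begin
          f₀ * (α * (2 * suc e))                                     ≡⟨ reorder f₀ α (2 * suc e) ⟩
          α * (2 * suc e * f₀)                                       ≤⟨ *-monoʳ-≤ α (degree-sum-bound conn-Δ β₁) ⟩
          α * degreeSum                                              ≡⟨ sym (overVertices-* ∅ α (λ v → deg ⁅ v ⁆)) ⟩
          overVertices ∅ (λ v → α * deg ⁅ v ⁆)                       ≤⟨ overVertices-mono ∅ bound ⟩
          overVertices ∅ (λ v → count ⁅ v ⁆ (suc j) + β)             ≡⟨ overVertices-+ ∅ (λ v → count ⁅ v ⁆ (suc j)) (λ _ → β) ⟩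
          overVertices ∅ (λ v → count ⁅ v ⁆ (suc j)) + overVertices ∅ (λ _ → β)
            ≡⟨ cong₂ _+_ (trans (∑-cong λ v → cong (λ ρ → ind (vtx ∅ v) * count ρ (suc j)) (⁅⁆≡∅⊞ v)) (sym (double-count ∅ (suc j))))
                 (trans (overVertices-const ∅ β) (*-comm β f₀)) ⟩
          (2 + j) * count ∅ (2 + j) + f₀ * β ∎

theorem4p7 : ∀ {c ℓ} (K : Field c ℓ) (d n : ℕ) (Δ : Complex n) →
    4 ≤ d →
    PureOfDim Δ d →
    Connected Δ →
    Homology.HomologyManifoldWithoutBoundary K Δ d →
    Homology.FirstBettiNonzero K Δ →
    ∀ i → i ≤ d ∸ 1 → fM d i ≤ fcount Δ i
theorem4p7 K (suc e) n Δ (s≤s e≥3) pure-dim conn-Δ manifold β₁ zero i≤ =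
  ≤-trans (many-vertices e e≥3 refl conn-Δ β₁) (≤-reflexive (sym (trans (fcount≡count 0) (count-1 ∅))))
  where
  open FromHomology K Δ (suc e) pure-dim manifold
  open Counting Δ
  open FaceNumbers Δ
theorem4p7 K (suc e) n Δ (s≤s e≥3) pure-dim conn-Δ manifold β₁ (suc j) j<e = begin
  suc (2 * suc e) * φ (2 * suc e) e j / (2 + j)    ≤⟨ /-monoˡ-≤ (2 + j) (faces-bound e e≥3 refl conn-Δ β₁ j j<e) ⟩
  (2 + j) * count ∅ (2 + j) / (2 + j)              ≡⟨ cong (_/ (2 + j)) (*-comm (2 + j) (count ∅ (2 + j))) ⟩
  count ∅ (2 + j) * (2 + j) / (2 + j)              ≡⟨ m*n/n≡m (count ∅ (2 + j)) (2 + j) ⟩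
  count ∅ (2 + j)                                  ≡⟨ sym (fcount≡count (suc j)) ⟩
  fcount Δ (suc j) ∎
  where
  open ≤-Reasoning
  open FromHomology K Δ (suc e) pure-dim manifold
  open Counting Δ
  open FaceNumbers Δ
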